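{- For $k\ge1$ let $P_0(k)$ be the proportion of integers $n\in[0,k^2+k)$ for which $N(n,k)=0$. Then $P_0(k)\to 3/\pi^2$ as $k\to\infty$.
   Context: For $n>k\ge1$, $N(n,k)$ is the nullity of the $n\times n$ skew-symmetric Toeplitz matrix $A(n,k)$ whose first $k$ superdiagonals have all entries $1$ and whose remaining superdiagonals have all entries $0$. This nullity depends only on $n\bmod (k^2+k)$, and $N(n,k)$ is defined for every integer $n$ as $N(n',k)$ for any $n'>k$ with $n'\equiv n\pmod{k^2+k}$. -}

module Defs where

open import Algebra.Bundles using (CommutativeRing)
open import Data.Bool.Base using (if_then_else_)
open import Data.Fin.Base using (Fin; zero; suc; toℕ; punchIn)
import Data.Fin.Properties as Fin
open import Data.Integer.Base as ℤ using (ℤ; +_; -[1+_]; -1ℤ)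
open import Data.Integer.DivMod using (_%ℕ_)
import Data.Integer.Properties as ℤ
open import Data.List.Base using (length; filter; upTo)
open import Data.Nat.Base as ℕ using (ℕ; zero; suc; NonZero)
import Data.Nat.Coprimality as Coprimality
import Data.Nat.Properties as ℕ
open import Data.Product.Base using (∃; ∃-syntax; _×_; _,_; proj₁; proj₂)
open import Data.Rational.Base as ℚ hiding (NonZero)
open import Data.Rational.Properties
open import Data.Rational.Solver using (module +-*-Solver)
open import Data.Sum.Base using (inj₁; inj₂)
open import Data.Vec.Functional using (Vector; tail; removeAt; insertAt)
open import Data.Vec.Functional.Properties using (insertAt-lookup; insertAt-punchIn)
open import Function.Base using (_∘_)
open import Relation.Binary.PropositionalEquality
  using (_≡_; _≢_; refl; sym; trans; cong; cong₂; subst; subst₂; module ≡-Reasoning)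
open import Relation.Nullary using (yes; no; ¬?; contradiction; decidable-stable)
open import Relation.Unary using (Pred)
open import Level using (0ℓ)

open import Algebra.Properties.Semiring.Sum
  (CommutativeRing.semiring +-*-commutativeRing)
  using (sum; sum-syntax; sum-cong-≗; sum-remove; sum-replicate-zero;
         ∑-distrib-+; ∑-comm; *-distribˡ-sum; *-distribʳ-sum)
open +-*-Solver using (solve; _:=_; _:+_; _:*_; _:-_; :-_; con)

Matrix : ℕ → ℕ → Set
Matrix m n = Fin m → Fin n → ℚ

infix 7 _∙_
_∙_ : ∀ {n} → Vector ℚ n → Vector ℚ n → ℚ
_∙_ {n} x y = ∑[ i < n ] (x i * y i)

Kernel : ∀ {m n} → Matrix m n → Pred (Vector ℚ n) 0ℓ
Kernel A x = ∀ i → A i ∙ x ≡ 0ℚ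

combination : ∀ {n d} → Vector ℚ d → Vector (Vector ℚ n) d → Vector ℚ n
combination {d = d} c b i = ∑[ j < d ] (c j * b j i)

record IsBasis {n d} (V : Pred (Vector ℚ n) 0ℓ) (b : Vector (Vector ℚ n) d) : Set where
  field
    contained   : ∀ j → V (b j)
    independent : ∀ c → (∀ i → combination c b i ≡ 0ℚ) → ∀ j → c j ≡ 0ℚ
    spanning    : ∀ x → V x → ∃[ c ] ∀ i → x i ≡ combination c b i

HasBasis : ∀ {n} → Pred (Vector ℚ n) 0ℓ → ℕ → Set
HasBasis {n} V d = ∃[ b ] IsBasis {n} {d} V b

private
  δ : ∀ {n} → Fin n → Fin n → ℚ
  δ i j with i Fin.≟ j
  ... | yes _ = 1ℚ
  ... | no  _ = 0ℚ

  δ-suc : ∀ {n} (i j : Fin n) → δ (suc i) (suc j) ≡ δ i j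
  δ-suc i j with i Fin.≟ j
  ... | yes _ = refl
  ... | no  _ = refl

  ∑-zero : ∀ {n} (t : Vector ℚ n) → (∀ i → t i ≡ 0ℚ) → sum t ≡ 0ℚ
  ∑-zero {n} t t≡0 = trans (sum-cong-≗ t≡0) (sum-replicate-zero n)

  ∑-δ : ∀ {n} (c : Vector ℚ n) i → ∑[ j < n ] (c j * δ j i) ≡ c i
  ∑-δ {suc n} c zero = trans
    (cong₂ _+_ (*-identityʳ (c zero)) (∑-zero _ (λ j → *-zeroʳ (c (suc j)))))
    (+-identityʳ (c zero))
  ∑-δ {suc n} c (suc i) = trans
    (cong₂ _+_ (*-zeroʳ (c zero))
      (trans (sum-cong-≗ (λ j → cong (c (suc j) *_) (δ-suc j i))) (∑-δ (c ∘ suc) i)))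
    (+-identityˡ (c (suc i)))

  ∙-combination : ∀ {n d} (a : Vector ℚ n) (c : Vector ℚ d) (b : Vector (Vector ℚ n) d) →
                  a ∙ combination c b ≡ ∑[ j < d ] (c j * (a ∙ b j))
  ∙-combination {n} {d} a c b = begin
    ∑[ i < n ] (a i * ∑[ j < d ] (c j * b j i))
      ≡⟨ sum-cong-≗ (λ i → *-distribˡ-sum (a i) (λ j → c j * b j i)) ⟩
    ∑[ i < n ] ∑[ j < d ] (a i * (c j * b j i))
      ≡⟨ ∑-comm (λ i j → a i * (c j * b j i)) ⟩
    ∑[ j < d ] ∑[ i < n ] (a i * (c j * b j i))
      ≡⟨ sum-cong-≗ (λ j → sum-cong-≗ (λ i → swap (a i) (c j) (b j i))) ⟩
    ∑[ j < d ] ∑[ i < n ] (c j * (a i * b j i))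
      ≡⟨ sum-cong-≗ (λ j → sym (*-distribˡ-sum (c j) (λ i → a i * b j i))) ⟩
    ∑[ j < d ] (c j * (a ∙ b j)) ∎
    where
    open ≡-Reasoning
    swap : ∀ x y z → x * (y * z) ≡ y * (x * z)
    swap = solve 3 (λ x y z → x :* (y :* z) := y :* (x :* z)) refl

  ∙-cong : ∀ {n} (a : Vector ℚ n) {x y : Vector ℚ n} → (∀ i → x i ≡ y i) → a ∙ x ≡ a ∙ y
  ∙-cong a x≗y = sum-cong-≗ (λ i → cong (a i *_) (x≗y i))

  ∙-reduce : ∀ {n} (a x y : Vector ℚ n) r →
             a ∙ (λ i → x i + r * y i) ≡ a ∙ x + r * (a ∙ y)
  ∙-reduce {n} a x y r = begin
    ∑[ i < n ] (a i * (x i + r * y i))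
      ≡⟨ sum-cong-≗ (λ i → expand (a i) (x i) (y i) r) ⟩
    ∑[ i < n ] (a i * x i + r * (a i * y i))
      ≡⟨ ∑-distrib-+ (λ i → a i * x i) (λ i → r * (a i * y i)) ⟩
    a ∙ x + ∑[ i < n ] (r * (a i * y i))
      ≡⟨ cong (λ z → a ∙ x + z) (*-distribˡ-sum r (λ i → a i * y i)) ⟨
    a ∙ x + r * (a ∙ y) ∎
    where
    open ≡-Reasoning
    expand : ∀ a x y r → a * (x + r * y) ≡ a * x + r * (a * y)
    expand = solve 4 (λ a x y r → a :* (x :+ r :* y) := a :* x :+ r :* (a :* y)) refl

  standardBasis : ∀ {n} (A : Matrix 0 n) → HasBasis (Kernel A) n
  standardBasis A = δ , record
    { contained   = λ _ ()
    ; independent = λ c eq j → trans (sym (∑-δ c j)) (eq j)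
    ; spanning    = λ x _ → x , λ i → sym (∑-δ x i)
    }

  -- Intersecting with the hyperplane a ∙ x ≡ 0: either it contains the whole
  -- space, or a basis vector off the hyperplane is used to eliminate.
  module Eliminate {m n d} (A : Matrix (suc m) n) (b : Vector (Vector ℚ n) (suc d))
                   (isBasis : IsBasis (Kernel (tail A)) b)
                   (p : Fin (suc d)) (pivot≢0 : A zero ∙ b p ≢ 0ℚ) where
    open IsBasis isBasis
    open ≡-Reasoning

    a : Vector ℚ n
    a = A zero

    instance
      pivot-nonZero : ℚ.NonZero (a ∙ b p)
      pivot-nonZero = ≢-nonZero pivot≢0

    r : Vector ℚ d
    r i = - ((a ∙ b (punchIn p i)) * 1/ (a ∙ b p))

    b′ : Vector (Vector ℚ n) d
    b′ i l = b (punchIn p i) l + r i * b p l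

    r-pivot : ∀ i → r i * (a ∙ b p) ≡ - (a ∙ b (punchIn p i))
    r-pivot i = begin
      - (x * 1/ y) * y   ≡⟨ assoc x (1/ y) y ⟩
      - (x * (1/ y * y)) ≡⟨ cong (λ z → - (x * z)) (*-inverseˡ y) ⟩
      - (x * 1ℚ)         ≡⟨ cong -_ (*-identityʳ x) ⟩
      - x                ∎
      where
      x = a ∙ b (punchIn p i)
      y = a ∙ b p
      assoc : ∀ x z y → - (x * z) * y ≡ - (x * (z * y))
      assoc = solve 3 (λ x z y → (:- (x :* z)) :* y := :- (x :* (z :* y))) refl

    combination′ : ∀ (c : Vector ℚ d) (c̃ : Vector ℚ (suc d)) →
                   (∀ i → c̃ (punchIn p i) ≡ c i) → c̃ p ≡ ∑[ i < d ] (c i * r i) →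
                   ∀ l → combination c̃ b l ≡ combination c b′ l
    combination′ c c̃ rest at-p l = begin
      ∑[ j < suc d ] (c̃ j * b j l)
        ≡⟨ sum-remove {i = p} (λ j → c̃ j * b j l) ⟩
      c̃ p * b p l + ∑[ i < d ] (c̃ (punchIn p i) * b (punchIn p i) l)
        ≡⟨ cong₂ _+_ (cong (_* b p l) at-p)
                     (sum-cong-≗ (λ i → cong (_* b (punchIn p i) l) (rest i))) ⟩
      (∑[ i < d ] (c i * r i)) * b p l + ∑[ i < d ] (c i * b (punchIn p i) l)
        ≡⟨ cong (_+ sum (λ i → c i * b (punchIn p i) l)) (*-distribʳ-sum (b p l) (λ i → c i * r i)) ⟩
      ∑[ i < d ] (c i * r i * b p l) + ∑[ i < d ] (c i * b (punchIn p i) l)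
        ≡⟨ ∑-distrib-+ (λ i → c i * r i * b p l) (λ i → c i * b (punchIn p i) l) ⟨
      ∑[ i < d ] (c i * r i * b p l + c i * b (punchIn p i) l)
        ≡⟨ sum-cong-≗ (λ i → collect (c i) (r i) (b p l) (b (punchIn p i) l)) ⟩
      ∑[ i < d ] (c i * b′ i l) ∎
      where
      collect : ∀ c r y x → c * r * y + c * x ≡ c * (x + r * y)
      collect = solve 4 (λ c r y x → c :* r :* y :+ c :* x := c :* (x :+ r :* y)) refl

    contained′ : ∀ j → Kernel A (b′ j)
    contained′ j zero = begin
      a ∙ b′ j                                  ≡⟨ ∙-reduce a (b (punchIn p j)) (b p) (r j) ⟩
      a ∙ b (punchIn p j) + r j * (a ∙ b p)     ≡⟨ cong (λ z → a ∙ b (punchIn p j) + z) (r-pivot j) ⟩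
      a ∙ b (punchIn p j) - a ∙ b (punchIn p j) ≡⟨ +-inverseʳ (a ∙ b (punchIn p j)) ⟩
      0ℚ                                        ∎
    contained′ j (suc i) = begin
      A (suc i) ∙ b′ j
        ≡⟨ ∙-reduce (A (suc i)) (b (punchIn p j)) (b p) (r j) ⟩
      A (suc i) ∙ b (punchIn p j) + r j * (A (suc i) ∙ b p)
        ≡⟨ cong₂ (λ x y → x + r j * y) (contained (punchIn p j) i) (contained p i) ⟩
      0ℚ + r j * 0ℚ
        ≡⟨ trans (+-identityˡ _) (*-zeroʳ (r j)) ⟩
      0ℚ ∎

    independent′ : ∀ c → (∀ l → combination c b′ l ≡ 0ℚ) → ∀ j → c j ≡ 0ℚ
    independent′ c eq j = trans (sym (rest j)) (independent c̃ vanishes (punchIn p j))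
      where
      s : ℚ
      s = ∑[ i < d ] (c i * r i)
      c̃ : Vector ℚ (suc d)
      c̃ = insertAt c p s
      rest : ∀ i → c̃ (punchIn p i) ≡ c i
      rest = insertAt-punchIn c p s
      vanishes : ∀ l → combination c̃ b l ≡ 0ℚ
      vanishes l = trans (combination′ c c̃ rest (insertAt-lookup c p s) l) (eq l)

    spanning′ : ∀ x → Kernel A x → ∃[ c ] ∀ l → x l ≡ combination c b′ l
    spanning′ x Ax≡0 with spanning x (Ax≡0 ∘ suc)
    ... | c , x≗ = removeAt c p , λ l →
      trans (x≗ l) (combination′ (removeAt c p) c (λ _ → refl) at-p l)
      where
      s : ℚ
      s = ∑[ i < d ] (c (punchIn p i) * r i)

      s-pivot : s * (a ∙ b p) ≡ - ∑[ i < d ] (c (punchIn p i) * (a ∙ b (punchIn p i)))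
      s-pivot = begin
        s * (a ∙ b p)
          ≡⟨ *-distribʳ-sum (a ∙ b p) (λ i → c (punchIn p i) * r i) ⟩
        ∑[ i < d ] (c (punchIn p i) * r i * (a ∙ b p))
          ≡⟨ sum-cong-≗ (λ i → trans (*-assoc (c (punchIn p i)) (r i) (a ∙ b p))
                                     (cong (c (punchIn p i) *_) (r-pivot i))) ⟩
        ∑[ i < d ] (c (punchIn p i) * - (a ∙ b (punchIn p i)))
          ≡⟨ sum-cong-≗ (λ i → pull (c (punchIn p i)) (a ∙ b (punchIn p i))) ⟩
        ∑[ i < d ] (- 1ℚ * (c (punchIn p i) * (a ∙ b (punchIn p i))))
          ≡⟨ *-distribˡ-sum (- 1ℚ) (λ i → c (punchIn p i) * (a ∙ b (punchIn p i))) ⟨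
        - 1ℚ * ∑[ i < d ] (c (punchIn p i) * (a ∙ b (punchIn p i)))
          ≡⟨ minus (∑[ i < d ] (c (punchIn p i) * (a ∙ b (punchIn p i)))) ⟩
        - ∑[ i < d ] (c (punchIn p i) * (a ∙ b (punchIn p i))) ∎
        where
        pull : ∀ x y → x * - y ≡ - 1ℚ * (x * y)
        pull = solve 2 (λ x y → x :* (:- y) := con (- 1ℚ) :* (x :* y)) refl
        minus : ∀ x → - 1ℚ * x ≡ - x
        minus = solve 1 (λ x → con (- 1ℚ) :* x := :- x) refl

      relation : c p * (a ∙ b p) + ∑[ i < d ] (c (punchIn p i) * (a ∙ b (punchIn p i))) ≡ 0ℚ
      relation = begin
        c p * (a ∙ b p) + ∑[ i < d ] (c (punchIn p i) * (a ∙ b (punchIn p i)))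
          ≡⟨ sum-remove {i = p} (λ j → c j * (a ∙ b j)) ⟨
        ∑[ j < suc d ] (c j * (a ∙ b j)) ≡⟨ ∙-combination a c b ⟨
        a ∙ combination c b              ≡⟨ ∙-cong a x≗ ⟨
        a ∙ x                            ≡⟨ Ax≡0 zero ⟩
        0ℚ                               ∎

      cancel : ∀ u v → u * (a ∙ b p) ≡ v * (a ∙ b p) → u ≡ v
      cancel u v eq = begin
        u                              ≡⟨ undo u ⟨
        u * (a ∙ b p) * 1/ (a ∙ b p)   ≡⟨ cong (_* 1/ (a ∙ b p)) eq ⟩
        v * (a ∙ b p) * 1/ (a ∙ b p)   ≡⟨ undo v ⟩
        v                              ∎
        where
        undo : ∀ w → w * (a ∙ b p) * 1/ (a ∙ b p) ≡ w
        undo w = trans (*-assoc w (a ∙ b p) (1/ (a ∙ b p)))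
                       (trans (cong (w *_) (*-inverseʳ (a ∙ b p))) (*-identityʳ w))

      at-p : c p ≡ s
      at-p = cancel (c p) s (trans (move _ _ relation) (sym s-pivot))
        where
        move : ∀ u v → u + v ≡ 0ℚ → u ≡ - v
        move u v eq = trans (split u v) (trans (cong (_- v) eq) (+-identityˡ (- v)))
          where
          split : ∀ u v → u ≡ (u + v) - v
          split = solve 2 (λ u v → u := (u :+ v) :- v) refl

    basis′ : HasBasis (Kernel A) d
    basis′ = b′ , record
      { contained = contained′ ; independent = independent′ ; spanning = spanning′ }

  addRow : ∀ {m n} (A : Matrix (suc m) n) → ∃ (HasBasis (Kernel (tail A))) → ∃ (HasBasis (Kernel A))
  addRow A (d , b , isBasis) with Fin.any? (λ j → ¬? (A zero ∙ b j ≟ 0ℚ))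
  addRow A (suc d , b , isBasis) | yes (p , pivot≢0) = d , Eliminate.basis′ A b isBasis p pivot≢0
  addRow A (d , b , isBasis)     | no noPivot = d , b , record
    { contained   = λ { j zero    → decidable-stable (A zero ∙ b j ≟ 0ℚ) (λ ≢0 → noPivot (j , ≢0))
                      ; j (suc i) → IsBasis.contained isBasis j i }
    ; independent = IsBasis.independent isBasis
    ; spanning    = λ x Ax≡0 → IsBasis.spanning isBasis x (Ax≡0 ∘ suc)
    }

kernelBasis : ∀ {m n} (A : Matrix m n) → ∃ (HasBasis (Kernel A))
kernelBasis {zero}  {n} A = n , standardBasis A
kernelBasis {suc m} {n} A = addRow A (kernelBasis (tail A))

-- The dimension of the kernel, i.e. the size of a certified basis.
nullity : ∀ {m n} → Matrix m n → ℕ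
nullity A = proj₁ (kernelBasis A)

-- diagonalEntry k d is the common entry of the d-th diagonal above the main one;
-- d = 0 is the main diagonal.
diagonalEntry : ℕ → ℕ → ℚ
diagonalEntry k zero      = 0ℚ
diagonalEntry k d@(suc _) = if d ℕ.≤ᵇ k then 1ℚ else 0ℚ

-- Truncated subtraction makes at most one of the two terms non-zero: the first
-- on and above the main diagonal, the second on and below it.
toeplitz : ∀ n k → Matrix n n
toeplitz n k i j = diagonalEntry k (toℕ j ℕ.∸ toℕ i) - diagonalEntry k (toℕ i ℕ.∸ toℕ j)

period : ℕ → ℕ
period k = k ℕ.* k ℕ.+ k

period-nonZero : ∀ k .{{_ : NonZero k}} → NonZero (period k)
period-nonZero (suc k) = _

-- A representative of n modulo k² + k that exceeds k; which one is immaterial,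
-- as the nullity of toeplitz n k for n > k depends only on n modulo k² + k.
representative : ℤ → (k : ℕ) .{{_ : NonZero k}} → ℕ
representative n k = (n %ℕ period k) {{period-nonZero k}} ℕ.+ period k

N : ℤ → (k : ℕ) .{{_ : NonZero k}} → ℕ
N n k = nullity (toeplitz (representative n k) k)

P₀ : (k : ℕ) .{{_ : NonZero k}} → ℚ
P₀ k = (+ zeros / period k) {{period-nonZero k}}
  where
  zeros : ℕ
  zeros = length (filter (λ n → N (+ n) k ℕ.≟ 0) (upTo (period k)))

IsCauchy : (ℕ → ℚ) → Set
IsCauchy s = ∀ ε → 0ℚ < ε → ∃[ M ] ∀ m n → M ℕ.≤ m → M ℕ.≤ n → ∣ s m - s n ∣ < ε

-- No modulus of convergence is fixed, and equality of reals is not needed: the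
-- order below does not depend on the choice of representing sequences.
record ℝ : Set where
  constructor real
  field
    seq    : ℕ → ℚ
    cauchy : IsCauchy seq

open ℝ public

infix 4 _<ᴿ_
_<ᴿ_ : ℝ → ℝ → Set
x <ᴿ y = ∃[ δ ] 0ℚ < δ × ∃[ M ] ∀ n → M ℕ.≤ n → seq x n + δ ≤ seq y n

private
  *-pos : ∀ {p q} → 0ℚ < p → 0ℚ < q → 0ℚ < p * q
  *-pos {p} {q} 0<p 0<q =
    positive⁻¹ (p * q) {{pos*pos⇒pos p {{positive 0<p}} q {{positive 0<q}}}}

  *-mono-≤ : ∀ {p p′ q q′} → 0ℚ ≤ q → 0ℚ ≤ p′ → p ≤ p′ → q ≤ q′ → p * q ≤ p′ * q′
  *-mono-≤ {p} {p′} {q} {q′} 0≤q 0≤p′ p≤p′ q≤q′ = ≤-trans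
    (*-monoʳ-≤-nonNeg q {{nonNegative 0≤q}} p≤p′)
    (*-monoˡ-≤-nonNeg p′ {{nonNegative 0≤p′}} q≤q′)

  ½*-pos : ∀ {ε} → 0ℚ < ε → 0ℚ < ½ * ε
  ½*-pos = *-pos (positive⁻¹ ½)

  ½+½ : ∀ ε → ½ * ε + ½ * ε ≡ ε
  ½+½ = solve 1 (λ ε → con ½ :* ε :+ con ½ :* ε := ε) refl

  ∣p-q∣≡∣q-p∣ : ∀ p q → ∣ p - q ∣ ≡ ∣ q - p ∣
  ∣p-q∣≡∣q-p∣ p q = trans (sym (∣-p∣≡∣p∣ (p - q))) (cong ∣_∣ (flip p q))
    where
    flip : ∀ p q → - (p - q) ≡ q - p
    flip = solve 2 (λ p q → :- (p :- q) := q :- p) refl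

  ∣p∣≤∣p-q∣+∣q∣ : ∀ p q → ∣ p ∣ ≤ ∣ p - q ∣ + ∣ q ∣
  ∣p∣≤∣p-q∣+∣q∣ p q =
    subst (λ z → ∣ z ∣ ≤ ∣ p - q ∣ + ∣ q ∣) (undo p q) (∣p+q∣≤∣p∣+∣q∣ (p - q) q)
    where
    undo : ∀ p q → (p - q) + q ≡ p
    undo = solve 2 (λ p q → (p :- q) :+ q := p) refl

  p≤q+r⇒p-r≤q : ∀ {p q r} → p ≤ q + r → p - r ≤ q
  p≤q+r⇒p-r≤q {p} {q} {r} p≤q+r =
    subst (p - r ≤_) (undo q r) (+-monoˡ-≤ (- r) p≤q+r)
    where
    undo : ∀ q r → (q + r) - r ≡ q
    undo = solve 2 (λ q r → (q :+ r) :- r := q) refl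

  ∣-∣-bound : ∀ {p q} → p ≤ q → - p ≤ q → ∣ p ∣ ≤ q
  ∣-∣-bound {p} p≤q -p≤q with ∣p∣≡p∨∣p∣≡-p p
  ... | inj₁ eq = subst (_≤ _) (sym eq) p≤q
  ... | inj₂ eq = subst (_≤ _) (sym eq) -p≤q

  ∣∣p∣-∣q∣∣≤∣p-q∣ : ∀ p q → ∣ ∣ p ∣ - ∣ q ∣ ∣ ≤ ∣ p - q ∣
  ∣∣p∣-∣q∣∣≤∣p-q∣ p q = ∣-∣-bound (p≤q+r⇒p-r≤q (∣p∣≤∣p-q∣+∣q∣ p q))
    (subst₂ _≤_ (flip ∣ p ∣ ∣ q ∣) (∣p-q∣≡∣q-p∣ q p) (p≤q+r⇒p-r≤q (∣p∣≤∣p-q∣+∣q∣ q p)))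
    where
    flip : ∀ p q → q - p ≡ - (p - q)
    flip = solve 2 (λ p q → q :- p := :- (p :- q)) refl

fromℚ : ℚ → ℝ
fromℚ q = real (λ _ → q) λ ε 0<ε → 0 , λ _ _ _ _ →
  subst (_< ε) (sym (cong ∣_∣ (+-inverseʳ q))) 0<ε

infixl 6 _-ᴿ_
_-ᴿ_ : ℝ → ℝ → ℝ
x -ᴿ y = real (λ n → seq x n - seq y n) proof
  where
  rearrange : ∀ a b c d → (a - b) - (c - d) ≡ (a - c) - (b - d)
  rearrange = solve 4 (λ a b c d → (a :- b) :- (c :- d) := (a :- c) :- (b :- d)) refl
  proof : IsCauchy (λ n → seq x n - seq y n)
  proof ε 0<ε with cauchy x (½ * ε) (½*-pos 0<ε) | cauchy y (½ * ε) (½*-pos 0<ε)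
  ... | M₁ , close₁ | M₂ , close₂ = M₁ ℕ.⊔ M₂ , λ m n M≤m M≤n → begin-strict
    ∣ (seq x m - seq y m) - (seq x n - seq y n) ∣
      ≡⟨ cong ∣_∣ (rearrange (seq x m) (seq y m) (seq x n) (seq y n)) ⟩
    ∣ (seq x m - seq x n) - (seq y m - seq y n) ∣
      ≤⟨ ∣p-q∣≤∣p∣+∣q∣ (seq x m - seq x n) (seq y m - seq y n) ⟩
    ∣ seq x m - seq x n ∣ + ∣ seq y m - seq y n ∣
      <⟨ +-mono-< (close₁ m n (ℕ.m⊔n≤o⇒m≤o M₁ M₂ M≤m) (ℕ.m⊔n≤o⇒m≤o M₁ M₂ M≤n))
                  (close₂ m n (ℕ.m⊔n≤o⇒n≤o M₁ M₂ M≤m) (ℕ.m⊔n≤o⇒n≤o M₁ M₂ M≤n)) ⟩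
    ½ * ε + ½ * ε ≡⟨ ½+½ ε ⟩
    ε ∎
    where open ≤-Reasoning

∣_∣ᴿ : ℝ → ℝ
∣ x ∣ᴿ = real (λ n → ∣ seq x n ∣) λ ε 0<ε →
  let M , close = cauchy x ε 0<ε in
  M , λ m n M≤m M≤n → ≤-<-trans (∣∣p∣-∣q∣∣≤∣p-q∣ (seq x m) (seq x n)) (close m n M≤m M≤n)

private
  eventuallyBounded : ∀ x → ∃[ B ] 0ℚ < B × ∃[ M ] ∀ n → M ℕ.≤ n → ∣ seq x n ∣ ≤ B
  eventuallyBounded x with cauchy x 1ℚ (positive⁻¹ 1ℚ)
  ... | M , close = 1ℚ + ∣ seq x M ∣ , +-mono-<-≤ (positive⁻¹ 1ℚ) (0≤∣p∣ (seq x M)) , M , λ n M≤n →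
    ≤-trans (∣p∣≤∣p-q∣+∣q∣ (seq x n) (seq x M))
            (+-monoˡ-≤ ∣ seq x M ∣ (<⇒≤ (close n M M≤n ℕ.≤-refl)))

private
  product-close : ∀ {a b c d D η} → 0ℚ < D → ∣ a ∣ ≤ D → ∣ d ∣ ≤ D →
                  ∣ a - c ∣ < η → ∣ b - d ∣ < η → ∣ a * b - c * d ∣ < D * (η + η)
  product-close {a} {b} {c} {d} {D} {η} 0<D ∣a∣≤D ∣d∣≤D a~c b~d = begin-strict
    ∣ a * b - c * d ∣
      ≡⟨ cong ∣_∣ (rearrange a b c d) ⟩
    ∣ a * (b - d) + d * (a - c) ∣
      ≤⟨ ∣p+q∣≤∣p∣+∣q∣ (a * (b - d)) (d * (a - c)) ⟩
    ∣ a * (b - d) ∣ + ∣ d * (a - c) ∣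
      ≡⟨ cong₂ _+_ (∣p*q∣≡∣p∣*∣q∣ a (b - d)) (∣p*q∣≡∣p∣*∣q∣ d (a - c)) ⟩
    ∣ a ∣ * ∣ b - d ∣ + ∣ d ∣ * ∣ a - c ∣
      ≤⟨ +-mono-≤ (*-monoʳ-≤-nonNeg ∣ b - d ∣ {{∣-∣-nonNeg (b - d)}} ∣a∣≤D)
                  (*-monoʳ-≤-nonNeg ∣ a - c ∣ {{∣-∣-nonNeg (a - c)}} ∣d∣≤D) ⟩
    D * ∣ b - d ∣ + D * ∣ a - c ∣
      ≡⟨ *-distribˡ-+ D ∣ b - d ∣ ∣ a - c ∣ ⟨
    D * (∣ b - d ∣ + ∣ a - c ∣)
      <⟨ *-monoʳ-<-pos D {{positive 0<D}} (+-mono-< b~d a~c) ⟩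
    D * (η + η) ∎
    where
    open ≤-Reasoning
    rearrange : ∀ a b c d → a * b - c * d ≡ a * (b - d) + d * (a - c)
    rearrange = solve 4 (λ a b c d → a :* b :- c :* d := a :* (b :- d) :+ d :* (a :- c)) refl

  share : ∀ D ε → 0ℚ < D → 0ℚ < ε → ∃[ η ] 0ℚ < η × D * (η + η) ≡ ε
  share D ε 0<D 0<ε = 1/ D * (½ * ε) , *-pos (positive⁻¹ (1/ D) {{1/pos⇒pos D}}) (½*-pos 0<ε) , eq
    where
    instance
      D-pos : Positive D
      D-pos = positive 0<D
      D-nonZero : ℚ.NonZero D
      D-nonZero = pos⇒nonZero D
    regroup : ∀ D E ε → D * (E * (½ * ε) + E * (½ * ε)) ≡ (D * E) * (½ * ε + ½ * ε)
    regroup D E ε = trans (cong (D *_) (sym (*-distribˡ-+ E (½ * ε) (½ * ε))))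
                          (sym (*-assoc D E (½ * ε + ½ * ε)))
    eq : D * (1/ D * (½ * ε) + 1/ D * (½ * ε)) ≡ ε
    eq = trans (regroup D (1/ D) ε) (trans (cong₂ _*_ (*-inverseʳ D) (½+½ ε)) (*-identityˡ ε))

infixl 7 _*ᴿ_
_*ᴿ_ : ℝ → ℝ → ℝ
x *ᴿ y = real (λ n → seq x n * seq y n) proof
  where
  proof : IsCauchy (λ n → seq x n * seq y n)
  proof ε 0<ε =
    let B , 0<B , M₁ , bound₁ = eventuallyBounded x
        C , 0<C , M₂ , bound₂ = eventuallyBounded y
        B≤B+C = subst (_≤ B + C) (+-identityʳ B) (+-monoʳ-≤ B (<⇒≤ 0<C))
        C≤B+C = subst (_≤ B + C) (+-identityˡ C) (+-monoˡ-≤ C (<⇒≤ 0<B))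
        η , 0<η , share-eq = share (B + C) ε (+-mono-< 0<B 0<C) 0<ε
        M₃ , close₁ = cauchy x η 0<η
        M₄ , close₂ = cauchy y η 0<η
        M₁₂ = M₁ ℕ.⊔ M₂
        M₃₄ = M₃ ℕ.⊔ M₄
    in M₁₂ ℕ.⊔ M₃₄ , λ m n M≤m M≤n →
    let M₁₂≤m = ℕ.m⊔n≤o⇒m≤o M₁₂ M₃₄ M≤m
        M₁₂≤n = ℕ.m⊔n≤o⇒m≤o M₁₂ M₃₄ M≤n
        M₃₄≤m = ℕ.m⊔n≤o⇒n≤o M₁₂ M₃₄ M≤m
        M₃₄≤n = ℕ.m⊔n≤o⇒n≤o M₁₂ M₃₄ M≤n
    in subst (∣ seq x m * seq y m - seq x n * seq y n ∣ <_) share-eq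
       (product-close {seq x m} {seq y m} {seq x n} {seq y n} (+-mono-< 0<B 0<C)
         (≤-trans (bound₁ m (ℕ.m⊔n≤o⇒m≤o M₁ M₂ M₁₂≤m)) B≤B+C)
         (≤-trans (bound₂ n (ℕ.m⊔n≤o⇒n≤o M₁ M₂ M₁₂≤n)) C≤B+C)
         (close₁ m n (ℕ.m⊔n≤o⇒m≤o M₃ M₄ M₃₄≤m) (ℕ.m⊔n≤o⇒m≤o M₃ M₄ M₃₄≤n))
         (close₂ m n (ℕ.m⊔n≤o⇒n≤o M₃ M₄ M₃₄≤m) (ℕ.m⊔n≤o⇒n≤o M₃ M₄ M₃₄≤n)))

-- The value at 0 is a convention; a sequence representing a positive real
-- vanishes at only finitely many indices.
reciprocalℚ : ℚ → ℚ
reciprocalℚ q with q ≟ 0ℚ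
... | yes _   = 0ℚ
... | no q≢0 = (1/ q) {{≢-nonZero q≢0}}

private
  reciprocalℚ-inverse : ∀ q → q ≢ 0ℚ → reciprocalℚ q * q ≡ 1ℚ
  reciprocalℚ-inverse q q≢0 with q ≟ 0ℚ
  ... | yes q≡0 = contradiction q≡0 q≢0
  ... | no q≢0′ = *-inverseˡ q {{≢-nonZero q≢0′}}

  reciprocalℚ-bound : ∀ δ .{{_ : ℚ.NonZero δ}} q → 0ℚ < δ → δ ≤ q →
                      ∣ reciprocalℚ q ∣ ≤ 1/ δ
  reciprocalℚ-bound δ q 0<δ δ≤q = *-cancelʳ-≤-pos q {{positive 0<q}} (begin
    ∣ reciprocalℚ q ∣ * q     ≡⟨ cong (∣ reciprocalℚ q ∣ *_) (0≤p⇒∣p∣≡p (<⇒≤ 0<q)) ⟨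
    ∣ reciprocalℚ q ∣ * ∣ q ∣ ≡⟨ ∣p*q∣≡∣p∣*∣q∣ (reciprocalℚ q) q ⟨
    ∣ reciprocalℚ q * q ∣     ≡⟨ cong ∣_∣ (reciprocalℚ-inverse q (λ q≡0 → <⇒≢ 0<q (sym q≡0))) ⟩
    1ℚ                        ≡⟨ *-inverseˡ δ ⟨
    1/ δ * δ                  ≤⟨ *-monoˡ-≤-nonNeg (1/ δ) {{pos⇒nonNeg (1/ δ) {{1/δ-pos}}}} δ≤q ⟩
    1/ δ * q                  ∎)
    where
    open ≤-Reasoning
    0<q : 0ℚ < q
    0<q = <-≤-trans 0<δ δ≤q
    1/δ-pos : Positive (1/ δ)
    1/δ-pos = 1/pos⇒pos δ {{positive 0<δ}}

reciprocal : (x : ℝ) → fromℚ 0ℚ <ᴿ x → ℝ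
reciprocal x (δ , 0<δ , M₁ , apart) = real (λ n → reciprocalℚ (seq x n)) proof
  where
  instance
    δ-pos : Positive δ
    δ-pos = positive 0<δ
    δ-nonZero : ℚ.NonZero δ
    δ-nonZero = pos⇒nonZero δ
    1/δ-pos : Positive (1/ δ)
    1/δ-pos = 1/pos⇒pos δ
  δ≤ : ∀ n → M₁ ℕ.≤ n → δ ≤ seq x n
  δ≤ n M≤n = subst (_≤ seq x n) (+-identityˡ δ) (apart n M≤n)
  ≢0 : ∀ n → M₁ ℕ.≤ n → seq x n ≢ 0ℚ
  ≢0 n M≤n eq = <⇒≢ (<-≤-trans 0<δ (δ≤ n M≤n)) (sym eq)
  proof : IsCauchy (λ n → reciprocalℚ (seq x n))
  proof ε 0<ε with cauchy x (ε * (δ * δ)) (*-pos 0<ε (*-pos 0<δ 0<δ))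
  ... | M₂ , close = M₁ ℕ.⊔ M₂ , λ m n M≤m M≤n →
    let u = seq x m
        v = seq x n
        u′ = reciprocalℚ u
        v′ = reciprocalℚ v
        M₁≤m = ℕ.m⊔n≤o⇒m≤o M₁ M₂ M≤m
        M₁≤n = ℕ.m⊔n≤o⇒m≤o M₁ M₂ M≤n
    in begin-strict
    ∣ u′ - v′ ∣
      ≡⟨ cong ∣_∣ (difference u v u′ v′ (reciprocalℚ-inverse u (≢0 m M₁≤m))
                                        (reciprocalℚ-inverse v (≢0 n M₁≤n))) ⟩
    ∣ (v - u) * (u′ * v′) ∣
      ≡⟨ trans (∣p*q∣≡∣p∣*∣q∣ (v - u) (u′ * v′))
               (cong₂ _*_ (∣p-q∣≡∣q-p∣ v u) (∣p*q∣≡∣p∣*∣q∣ u′ v′)) ⟩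
    ∣ u - v ∣ * (∣ u′ ∣ * ∣ v′ ∣)
      ≤⟨ *-monoˡ-≤-nonNeg ∣ u - v ∣ {{∣-∣-nonNeg (u - v)}}
           (*-mono-≤ (0≤∣p∣ v′) (<⇒≤ (positive⁻¹ (1/ δ)))
             (reciprocalℚ-bound δ u 0<δ (δ≤ m M₁≤m))
             (reciprocalℚ-bound δ v 0<δ (δ≤ n M₁≤n))) ⟩
    ∣ u - v ∣ * (1/ δ * 1/ δ)
      <⟨ *-monoˡ-<-pos (1/ δ * 1/ δ) {{pos*pos⇒pos (1/ δ) (1/ δ)}}
           (close m n (ℕ.m⊔n≤o⇒n≤o M₁ M₂ M≤m) (ℕ.m⊔n≤o⇒n≤o M₁ M₂ M≤n)) ⟩
    ε * (δ * δ) * (1/ δ * 1/ δ)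
      ≡⟨ regroup ε δ (1/ δ) ⟩
    ε * ((δ * 1/ δ) * (δ * 1/ δ))
      ≡⟨ cong (λ z → ε * (z * z)) (*-inverseʳ δ) ⟩
    ε * (1ℚ * 1ℚ)
      ≡⟨ *-identityʳ ε ⟩
    ε ∎
    where
    open ≤-Reasoning
    regroup : ∀ ε δ d → ε * (δ * δ) * (d * d) ≡ ε * ((δ * d) * (δ * d))
    regroup = solve 3 (λ ε δ d → ε :* (δ :* δ) :* (d :* d) := ε :* ((δ :* d) :* (δ :* d))) refl
    expand : ∀ u v u′ v′ → (v - u) * (u′ * v′) ≡ u′ * (v′ * v) - (u′ * u) * v′
    expand = solve 4 (λ u v u′ v′ → (v :- u) :* (u′ :* v′) := u′ :* (v′ :* v) :- (u′ :* u) :* v′) refl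
    difference : ∀ u v u′ v′ → u′ * u ≡ 1ℚ → v′ * v ≡ 1ℚ → u′ - v′ ≡ (v - u) * (u′ * v′)
    difference u v u′ v′ eq₁ eq₂ = sym (trans (expand u v u′ v′)
      (cong₂ (λ p q → p - q) (trans (cong (u′ *_) eq₂) (*-identityʳ u′))
                             (trans (cong (_* v′) eq₁) (*-identityˡ v′))))

0<x*y : ∀ {x y} → fromℚ 0ℚ <ᴿ x → fromℚ 0ℚ <ᴿ y → fromℚ 0ℚ <ᴿ x *ᴿ y
0<x*y {x} {y} (δ₁ , 0<δ₁ , M₁ , apart₁) (δ₂ , 0<δ₂ , M₂ , apart₂) =
  δ₁ * δ₂ , *-pos 0<δ₁ 0<δ₂ , M₁ ℕ.⊔ M₂ , λ n M≤n →
  let δ₁≤ = subst (_≤ seq x n) (+-identityˡ δ₁) (apart₁ n (ℕ.m⊔n≤o⇒m≤o M₁ M₂ M≤n))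
      δ₂≤ = subst (_≤ seq y n) (+-identityˡ δ₂) (apart₂ n (ℕ.m⊔n≤o⇒n≤o M₁ M₂ M≤n))
  in subst (_≤ seq x n * seq y n) (sym (+-identityˡ (δ₁ * δ₂)))
       (*-mono-≤ (<⇒≤ 0<δ₂) (<⇒≤ (<-≤-trans 0<δ₁ δ₁≤)) δ₁≤ δ₂≤)

-- Partial sums of π/4 = 1 - 1/3 + 1/5 - 1/7 + ⋯, which serves as the definition of π.
leibnizTerm : ℕ → ℚ
leibnizTerm j = (-1ℤ ℤ.^ j) / suc (2 ℕ.* j)

leibnizSum : ℕ → ℚ
leibnizSum zero    = 0ℚ
leibnizSum (suc m) = leibnizSum m + leibnizTerm m

private
  unit : ℕ → ℚ
  unit d = + 1 / suc d

  unit-mk : ∀ d → unit d ≡ mkℚ (+ 1) d (Coprimality.1-coprimeTo (suc d))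
  unit-mk d = normalize-coprime (Coprimality.1-coprimeTo (suc d))

  unit-antitone : ∀ {c d} → c ℕ.≤ d → unit d ≤ unit c
  unit-antitone {c} {d} c≤d = subst₂ _≤_ (sym (unit-mk d)) (sym (unit-mk c))
    (*≤* (ℤ.*-monoˡ-≤-nonNeg (+ 1) (ℤ.+≤+ (ℕ.s≤s c≤d))))

  unit-strict : ∀ {c d} → c ℕ.< d → unit d < unit c
  unit-strict {c} {d} c<d = subst₂ _<_ (sym (unit-mk d)) (sym (unit-mk c))
    (*<* (ℤ.*-monoˡ-<-pos (+ 1) (ℤ.+<+ (ℕ.s≤s c<d))))

  unit-nonNeg : ∀ d → 0ℚ ≤ unit d
  unit-nonNeg d = <⇒≤ (positive⁻¹ (unit d) {{normalize-pos 1 (suc d)}})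

  unit≤ : ∀ ε → 0ℚ < ε → ∃[ d ] unit d ≤ ε
  unit≤ ε@(mkℚ (+ zero) d _) (*<* p) = contradiction p (ℤ.<-irrefl refl)
  unit≤ (mkℚ (+ suc n) d c) 0<ε = d , subst (_≤ mkℚ (+ suc n) d c) (sym (unit-mk d))
    (*≤* (ℤ.*-monoʳ-≤-nonNeg (+ suc d) {+ 1} {+ suc n} (ℤ.+≤+ (ℕ.s≤s ℕ.z≤n))))
  unit≤ (mkℚ -[1+ n ] d c) (*<* p) = contradiction p (ℤ.≤⇒≯ ℤ.-≤+)

  odd : ℕ → ℚ
  odd j = unit (2 ℕ.* j)

  neg-/ : ∀ i n .{{_ : NonZero n}} → (ℤ.- i) / n ≡ - (i / n)
  neg-/ (+ zero)  n = trans (0/n≡0 n) (sym (cong -_ (0/n≡0 n)))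
  neg-/ (+ suc i) n = refl
  neg-/ -[1+ i ]  n = involutive (normalize (suc i) n)
    where
    involutive : ∀ x → x ≡ - (- x)
    involutive = solve 1 (λ x → x := :- (:- x)) refl

  sgn : ℕ → ℚ
  sgn zero    = 1ℚ
  sgn (suc j) = - sgn j

  ∣sgn∣ : ∀ j → ∣ sgn j ∣ ≡ 1ℚ
  ∣sgn∣ zero    = refl
  ∣sgn∣ (suc j) = trans (∣-p∣≡∣p∣ (sgn j)) (∣sgn∣ j)

  signed : ∀ j n .{{_ : NonZero n}} → (-1ℤ ℤ.^ j) / n ≡ sgn j * (+ 1 / n)
  signed zero    n = sym (*-identityˡ (+ 1 / n))
  signed (suc j) n = begin
    (-1ℤ ℤ.* (-1ℤ ℤ.^ j)) / n ≡⟨ cong (_/ n) (ℤ.-1*i≡-i (-1ℤ ℤ.^ j)) ⟩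
    (ℤ.- (-1ℤ ℤ.^ j)) / n     ≡⟨ neg-/ (-1ℤ ℤ.^ j) n ⟩
    - ((-1ℤ ℤ.^ j) / n)       ≡⟨ cong -_ (signed j n) ⟩
    - (sgn j * (+ 1 / n))     ≡⟨ neg-distribˡ-* (sgn j) (+ 1 / n) ⟩
    - sgn j * (+ 1 / n)       ∎
    where open ≡-Reasoning

  tailSum : ℕ → ℕ → ℚ
  tailSum m zero    = 0ℚ
  tailSum m (suc p) = odd m - tailSum (suc m) p

  p-q≤p : ∀ {p q} → 0ℚ ≤ q → p - q ≤ p
  p-q≤p {p} {q} 0≤q = subst (p - q ≤_) (+-identityʳ p) (+-monoʳ-≤ p (neg-antimono-≤ 0≤q))

  tailSum-bounds : ∀ m p → 0ℚ ≤ tailSum m p × tailSum m p ≤ odd m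
  tailSum-bounds m zero    = ≤-refl , unit-nonNeg (2 ℕ.* m)
  tailSum-bounds m (suc p) with tailSum-bounds (suc m) p
  ... | 0≤t , t≤ =
    subst (_≤ odd m - t) (+-inverseʳ t) (+-monoˡ-≤ (- t) t≤odd) , p-q≤p 0≤t
    where
    t = tailSum (suc m) p
    t≤odd : t ≤ odd m
    t≤odd = ≤-trans t≤ (unit-antitone (ℕ.*-monoʳ-≤ 2 (ℕ.n≤1+n m)))

  leibnizSum-tail : ∀ m p → leibnizSum (p ℕ.+ m) ≡ leibnizSum m + sgn m * tailSum m p
  leibnizSum-tail m zero    = sym (trans (cong (λ z → leibnizSum m + z) (*-zeroʳ (sgn m))) (+-identityʳ (leibnizSum m)))
  leibnizSum-tail m (suc p) = begin
    leibnizSum (suc p ℕ.+ m)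
      ≡⟨ cong leibnizSum (ℕ.+-suc p m) ⟨
    leibnizSum (p ℕ.+ suc m)
      ≡⟨ leibnizSum-tail (suc m) p ⟩
    leibnizSum m + leibnizTerm m + - sgn m * t
      ≡⟨ cong (λ z → leibnizSum m + z + - sgn m * t) (signed m (suc (2 ℕ.* m))) ⟩
    leibnizSum m + sgn m * odd m + - sgn m * t
      ≡⟨ regroup (leibnizSum m) (sgn m) (odd m) t ⟩
    leibnizSum m + sgn m * (odd m - t) ∎
    where
    open ≡-Reasoning
    t = tailSum (suc m) p
    regroup : ∀ s g a t → s + g * a + - g * t ≡ s + g * (a - t)
    regroup = solve 4 (λ s g a t → s :+ g :* a :+ (:- g) :* t := s :+ g :* (a :- t)) refl

  leibniz-close : ∀ m p → ∣ leibnizSum (p ℕ.+ m) - leibnizSum m ∣ ≤ odd m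
  leibniz-close m p = begin
    ∣ leibnizSum (p ℕ.+ m) - leibnizSum m ∣
      ≡⟨ cong (λ z → ∣ z - leibnizSum m ∣) (leibnizSum-tail m p) ⟩
    ∣ leibnizSum m + sgn m * tailSum m p - leibnizSum m ∣
      ≡⟨ cong ∣_∣ (cancel (leibnizSum m) (sgn m * tailSum m p)) ⟩
    ∣ sgn m * tailSum m p ∣
      ≡⟨ ∣p*q∣≡∣p∣*∣q∣ (sgn m) (tailSum m p) ⟩
    ∣ sgn m ∣ * ∣ tailSum m p ∣
      ≡⟨ cong₂ _*_ (∣sgn∣ m) (0≤p⇒∣p∣≡p (proj₁ (tailSum-bounds m p))) ⟩
    1ℚ * tailSum m p
      ≡⟨ *-identityˡ (tailSum m p) ⟩
    tailSum m p
      ≤⟨ proj₂ (tailSum-bounds m p) ⟩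
    odd m ∎
    where
    open ≤-Reasoning
    cancel : ∀ s t → s + t - s ≡ t
    cancel = solve 2 (λ s t → s :+ t :- s := t) refl

  leibniz-close′ : ∀ {m n} → m ℕ.≤ n → ∣ leibnizSum n - leibnizSum m ∣ ≤ odd m
  leibniz-close′ {m} {n} m≤n =
    subst (λ k → ∣ leibnizSum k - leibnizSum m ∣ ≤ odd m) (ℕ.m∸n+n≡m m≤n) (leibniz-close m (n ℕ.∸ m))

  leibnizCauchy : IsCauchy leibnizSum
  leibnizCauchy ε 0<ε with unit≤ ε 0<ε
  ... | d , unit≤ε = suc d , proof
    where
    odd<ε : ∀ m → suc d ℕ.≤ m → odd m < ε
    odd<ε m d<m = <-≤-trans (unit-strict (ℕ.≤-trans d<m (ℕ.m≤m+n m (m ℕ.+ 0)))) unit≤ε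
    proof : ∀ m n → suc d ℕ.≤ m → suc d ℕ.≤ n → ∣ leibnizSum m - leibnizSum n ∣ < ε
    proof m n d<m d<n with ℕ.≤-total m n
    ... | inj₁ m≤n = subst (_< ε) (∣p-q∣≡∣q-p∣ (leibnizSum n) (leibnizSum m))
                       (≤-<-trans (leibniz-close′ m≤n) (odd<ε m d<m))
    ... | inj₂ n≤m = ≤-<-trans (leibniz-close′ n≤m) (odd<ε n d<n)

π/4 : ℝ
π/4 = real leibnizSum leibnizCauchy

π : ℝ
π = fromℚ (+ 4 / 1) *ᴿ π/4

0<π : fromℚ 0ℚ <ᴿ π
0<π = 0<x*y {fromℚ (+ 4 / 1)} {π/4}
  (+ 4 / 1 , positive⁻¹ (+ 4 / 1) , 0 , λ _ _ → ≤-refl)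
  (+ 2 / 3 , positive⁻¹ (+ 2 / 3) , 1 , bound)
  where
  bound : ∀ n → 1 ℕ.≤ n → 0ℚ + + 2 / 3 ≤ leibnizSum n
  bound n 1≤n = p≤q+r⇒p-r≤q {1ℚ} {leibnizSum n} {odd 1}
    (≤-trans 1≤ (≤-reflexive (+-comm (odd 1) (leibnizSum n))))
    where
    undo : ∀ s → 1ℚ - s + s ≡ 1ℚ
    undo = solve 1 (λ s → con 1ℚ :- s :+ s := con 1ℚ) refl
    p≤∣p∣ : ∀ p → p ≤ ∣ p ∣
    p≤∣p∣ p with ≤-total 0ℚ p
    ... | inj₁ 0≤p = ≤-reflexive (sym (0≤p⇒∣p∣≡p 0≤p))
    ... | inj₂ p≤0 = ≤-trans p≤0 (0≤∣p∣ p)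
    1≤ : 1ℚ ≤ odd 1 + leibnizSum n
    1≤ = subst (_≤ odd 1 + leibnizSum n) (undo (leibnizSum n))
      (+-monoˡ-≤ (leibnizSum n) (≤-trans (p≤∣p∣ (1ℚ - leibnizSum n))
        (subst (_≤ odd 1) (∣p-q∣≡∣q-p∣ (leibnizSum n) 1ℚ) (leibniz-close′ 1≤n))))

3/π² : ℝ
3/π² = fromℚ (+ 3 / 1) *ᴿ reciprocal (π *ᴿ π) (0<x*y {π} {π} 0<π 0<π)

-- Rational ε suffice, since every positive real exceeds a positive rational.
_⟶_ : ((k : ℕ) .{{_ : NonZero k}} → ℝ) → ℝ → Set
f ⟶ ℓ = ∀ ε → 0ℚ < ε → ∃[ K ] ∀ k .{{_ : NonZero k}} → K ℕ.≤ k → ∣ f k -ᴿ ℓ ∣ᴿ <ᴿ fromℚ ε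

{-# OPTIONS --safe #-}

-- Put m = k + 1. A kernel vector of A(n, k), padded by k zeros on either side, satisfies a recurrence with
-- characteristic polynomial (t^k - 1)(t^m - 1)/(t - 1), so it is the difference of a k-periodic and an m-periodic
-- sequence. The zeros at both ends identify these two sequences along a graph on ℤ/k ⊔ ℤ/m, and the kernel vanishes
-- iff one permutation τ of ℤ/m, an exchange of three intervals one of which is a single point, is an m-cycle.
--
-- Let σ be the rotation x ↦ x + 1 of ℤ/m. Then σ and τ commute up to a 3-cycle, and this relation is symmetric in σ
-- and τ. If τ is a cycle, labelling the points by their time along it turns τ into a rotation and σ into an exchange of
-- the intervals [0, a), [a, a + b), [a + b, m) into the opposite order. That exchange is the first return map of a
-- rotation by v = b + c on ℤ/(u + v), where u = a + b and c = m - u, hence a cycle iff u and v are coprime. Up to O(k)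
-- exceptions, the n with N(n, k) = 0 therefore correspond to the coprime pairs u, v ≤ k with u + v > k.
--
-- There are asymptotically k²/(2ζ(2)) such pairs: sorting all pairs by their gcd gives a relation that contracts the
-- error, because ζ(2) - 1 < 1. Finally π enters by squaring the Leibniz series, whose off-diagonal terms cancel in the
-- limit, which leaves ζ(2) = π²/6.
module Submission where

-- For a given n there is no formula for the pair (u, v): u and v are read off as times along the
-- orbit of τ. So the correspondence is kept as a relation, `Match`, either side of which determines
-- the other, and the two finite sets are compared by two injections, each with m spare targets for
-- exceptions. On the side of n, τ depends only on n - 1 modulo k and modulo m, and by Chinese
-- remaindering each pair of residues occurs once per period.
--
-- The limit compares P₀(k) with every late term θ of the rational sequence representing 3/π², while
-- the threshold for k must not depend on that term. Hence all estimates are made for an arbitrary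
-- rational θ with 2θζ(m) near 1, with constants uniform in θ; of ζ(2) only partial sums occur.
-- Smallness is expressed without division, as D|x| ≤ c for a natural number D. The error F(m) - θm²
-- starts from the trivial bound m², and D rounds of the contraction bring the coefficient of m² in
-- D|error| down to a constant.

open import Data.Product.Base using (∃-syntax; _×_; _,_; proj₁; proj₂)
open import Data.Sum.Base using (_⊎_; inj₁; inj₂)
open import Relation.Binary.Definitions using (tri<; tri≈; tri>)
open import Relation.Binary.PropositionalEquality
open import Relation.Nullary using (Dec; yes; no; ¬_; contradiction)

-- Orbits of a self-map of {0, ..., k}

module Orbits where

  open import Data.Fin.Base using (Fin; toℕ; fromℕ<)
  open import Data.Fin.Properties using (toℕ-fromℕ<; toℕ<n; toℕ-injective; pigeonhole; injective⇒≤)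
  open import Data.Nat.Base
  open import Data.Nat.GeneralisedArithmetic using (fold)
  open import Data.Nat.Properties

  Closed : ℕ → (ℕ → ℕ) → Set
  Closed k f = ∀ x → x ≤ k → f x ≤ k

  -- The orbit starts at f k, so that covering k means returning to it.
  Covers : ℕ → (ℕ → ℕ) → Set
  Covers k f = ∀ y → y ≤ k → ∃[ i ] fold k f (suc i) ≡ y

  module _ {k} {f : ℕ → ℕ} (closed : Closed k f) where

    orbit : ℕ → ℕ
    orbit i = fold k f (suc i)

    orbit≤ : ∀ i → orbit i ≤ k
    orbit≤ zero    = closed k ≤-refl
    orbit≤ (suc i) = closed (orbit i) (orbit≤ i)

    -- From time `a` on the orbit runs in a loop, so no new value appears from time `b` on.
    reduce : ∀ {a b} → a < b → orbit a ≡ orbit b → ∀ i → ∃[ j ] j < b × orbit j ≡ orbit i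
    reduce {a} {b} a<b eq zero = 0 , ≤-trans (s≤s z≤n) a<b , refl
    reduce {a} {b} a<b eq (suc i) with reduce a<b eq i
    ... | j , j<b , eqⱼ with m≤n⇒m<n∨m≡n j<b
    ...   | inj₁ 1+j<b = suc j , 1+j<b , cong f eqⱼ
    ...   | inj₂ refl  = a , a<b , trans eq (cong f eqⱼ)

    collision : ∃[ a ] ∃[ b ] a < b × b ≤ suc k × orbit a ≡ orbit b
    collision with pigeonhole (n<1+n (suc k)) (λ i → fromℕ< (s≤s (orbit≤ (toℕ i))))
    ... | i , j , i<j , eq = toℕ i , toℕ j , i<j , ≤-pred (toℕ<n j) ,
      trans (sym (toℕ-fromℕ< (s≤s (orbit≤ (toℕ i)))))
            (trans (cong toℕ eq) (toℕ-fromℕ< (s≤s (orbit≤ (toℕ j)))))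

    early : ∀ i → ∃[ j ] j ≤ k × orbit j ≡ orbit i
    early i with collision
    ... | a , b , a<b , b≤1+k , eq with reduce a<b eq i
    ...   | j , j<b , eqⱼ = j , ≤-pred (≤-trans j<b b≤1+k) , eqⱼ

    module _ (covers : Covers k f) where

      -- A repetition at time `b ≤ k` would leave at most `b` distinct values, too few for the
      -- `suc k` points.
      no-collision : ∀ {a b} → a < b → b ≤ k → orbit a ≢ orbit b
      no-collision {a} {b} a<b b≤k eq = <⇒≱ (s≤s b≤k) (injective⇒≤ {f = time} time-injective)
        where
        reach : ∀ (y : Fin (suc k)) → ∃[ j ] j < b × orbit j ≡ toℕ y
        reach y with covers (toℕ y) (≤-pred (toℕ<n y))
        ... | i , eqᵢ with reduce a<b eq i
        ...   | j , j<b , eqⱼ = j , j<b , trans eqⱼ eqᵢ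
        time : Fin (suc k) → Fin b
        time y = fromℕ< (proj₁ (proj₂ (reach y)))
        time-injective : ∀ {x y} → time x ≡ time y → x ≡ y
        time-injective {x} {y} eq′ = toℕ-injective (begin
          toℕ x ≡⟨ proj₂ (proj₂ (reach x)) ⟨
          orbit (proj₁ (reach x)) ≡⟨ cong orbit (trans (sym (toℕ-fromℕ< _)) (trans (cong toℕ eq′) (toℕ-fromℕ< _))) ⟩
          orbit (proj₁ (reach y)) ≡⟨ proj₂ (proj₂ (reach y)) ⟩
          toℕ y ∎)
          where open ≡-Reasoning

      orbit-injective : ∀ {a b} → a ≤ k → b ≤ k → orbit a ≡ orbit b → a ≡ b
      orbit-injective {a} {b} a≤k b≤k eq with <-cmp a b
      ... | tri< a<b _ _ = contradiction eq (no-collision a<b b≤k)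
      ... | tri≈ _ a≡b _ = a≡b
      ... | tri> _ _ b<a = contradiction (sym eq) (no-collision b<a a≤k)

      label : ∀ y → y ≤ k → ∃[ i ] i ≤ k × orbit i ≡ y
      label y y≤k with covers y y≤k
      ... | i , eqᵢ with early i
      ...   | j , j≤k , eqⱼ = j , j≤k , trans eqⱼ eqᵢ

      -- `k` is hit at some time `i ≤ k`; if `i < k`, the next step would repeat `orbit 0 = f k` too
      -- early.
      orbit-return : orbit k ≡ k
      orbit-return with label k ≤-refl
      ... | i , i≤k , eq with m≤n⇒m<n∨m≡n i≤k
      ...   | inj₁ i<k = contradiction (sym (cong f eq)) (no-collision (s≤s z≤n) i<k)
      ...   | inj₂ refl = eq

-- The three-interval exchange and the permutation τ

module Exchange where

  open import Data.Nat.Base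
  open import Data.Nat.DivMod
  open import Data.Nat.GeneralisedArithmetic using (fold)
  open import Data.Nat.Properties
  open Orbits
  open ≡-Reasoning

  opaque
    next : ℕ → ℕ → ℕ
    next k x = suc x % suc k

    next≤ : ∀ k x → next k x ≤ k
    next≤ k x = ≤-pred (m%n<n (suc x) (suc k))

    next-< : ∀ {k x} → x < k → next k x ≡ suc x
    next-< x<k = m<n⇒m%n≡m (s≤s x<k)

    next-last : ∀ k → next k k ≡ 0
    next-last k = n%n≡0 (suc k)

    next-% : ∀ k y → next k (y % suc k) ≡ suc y % suc k
    next-% k y = begin
      (1 + y % suc k) % suc k ≡⟨ %-distribˡ-+ 1 (y % suc k) (suc k) ⟩
      (1 % suc k + y % suc k % suc k) % suc k ≡⟨ cong (λ z → (1 % suc k + z) % suc k) (m%n%n≡m%n y (suc k)) ⟩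
      (1 % suc k + y % suc k) % suc k ≡⟨ %-distribˡ-+ 1 y (suc k) ⟨
      (1 + y) % suc k ∎

  next-orbit : ∀ k {i} → i ≤ k → fold k (next k) (suc i) ≡ i
  next-orbit k {zero}  _     = next-last k
  next-orbit k {suc i} i<k = trans (cong (next k) (next-orbit k (<⇒≤ i<k))) (next-< i<k)

  next-covers : ∀ k → Covers k (next k)
  next-covers k y y≤k = y , next-orbit k y≤k

  -- σ and τ commute up to a 3-cycle on k, p and r.
  record Commutes (k : ℕ) (σ τ : ℕ → ℕ) (p r : ℕ) : Set where
    field
      generic : ∀ {x} → x ≤ k → x ≢ k → x ≢ p → x ≢ r → τ (σ x) ≡ σ (τ x)
      at-r    : τ (σ r) ≡ σ (τ k)
      at-k    : τ (σ k) ≡ σ (τ p)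
      at-p    : τ (σ p) ≡ σ (τ r)

  -- With a = k + 1 - v, c = k + 1 - u and a + b + c = k + 1, this exchanges consecutive
  -- intervals of lengths a, b, c into the order c, b, a.
  opaque
    exchange : ℕ → ℕ → ℕ → ℕ → ℕ
    exchange k u v t with t <? u | t + v ≤? k
    ... | yes _ | yes _ = t + v
    ... | yes _ | no _  = t + v ∸ u
    ... | no _  | _     = t ∸ u

  -- In terms of the interval lengths, `v≤k`, `2+k≤u+v` and `u≤k` say that a, b and c are at least
  -- 1.
  record Triangle (k u v : ℕ) : Set where
    constructor triangle
    field
      1≤u : 1 ≤ u
      1≤v : 1 ≤ v
      u≤k : u ≤ k
      v≤k : v ≤ k
      2+k≤u+v : 2 + k ≤ u + v

  module Time {k u v : ℕ} (tri : Triangle k u v) where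
    open Triangle tri

    T : ℕ → ℕ
    T = exchange k u v

    opaque
      unfolding exchange

      T-low : ∀ {t} → t < u → t + v ≤ k → T t ≡ t + v
      T-low {t} t<u t+v≤k with t <? u | t + v ≤? k
      ... | yes _  | yes _    = refl
      ... | yes _  | no t+v≰k = contradiction t+v≤k t+v≰k
      ... | no t≮u | _        = contradiction t<u t≮u

      T-mid : ∀ {t} → t < u → k < t + v → T t + u ≡ t + v
      T-mid {t} t<u k<t+v with t <? u | t + v ≤? k
      ... | yes _  | yes t+v≤k = contradiction t+v≤k (<⇒≱ k<t+v)
      ... | yes _  | no _      = m∸n+n≡m (≤-trans u≤k (<⇒≤ k<t+v))
      ... | no t≮u | _         = contradiction t<u t≮u

      T-high : ∀ {t} → u ≤ t → T t + u ≡ t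
      T-high {t} u≤t with t <? u | t + v ≤? k
      ... | yes t<u | _ = contradiction u≤t (<⇒≱ t<u)
      ... | no _    | _ = m∸n+n≡m u≤t

      T-closed : Closed k T
      T-closed t t≤k with t <? u | t + v ≤? k
      ... | yes _   | yes t+v≤k = t+v≤k
      ... | yes t<u | no _      = ≤-trans (m≤n+o⇒m∸n≤o (t + v) u (+-monoˡ-≤ v (<⇒≤ t<u))) v≤k
      ... | no _    | _         = ≤-trans (m∸n≤m t u) t≤k

    -- The last points of the first and of the middle interval. With `k` they are the three points
    -- not moved by the same translation as their successors.
    p r : ℕ
    p = k ∸ v
    r = pred u

    p+v≡k : p + v ≡ k
    p+v≡k = m∸n+n≡m v≤k

    1+r≡u : suc r ≡ u
    1+r≡u = suc-pred u {{>-nonZero 1≤u}}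

    r<k : r < k
    r<k = subst (_≤ k) (sym 1+r≡u) u≤k

    p<r : p < r
    p<r = +-cancelʳ-< v p r (subst (_< r + v) (sym p+v≡k)
      (≤-pred (subst (λ z → 2 + k ≤ z + v) (sym 1+r≡u) 2+k≤u+v)))

    T-step : ∀ {t} → t < k → T (suc t) ≡ suc (T t) → T (suc t) ≡ next k (T t)
    T-step {t} t<k eq = trans eq (sym (next-< (subst (_≤ k) eq (T-closed (suc t) t<k))))

    T-p : T p ≡ k
    T-p = trans (T-low (<-≤-trans p<r (≤-trans (n≤1+n r) (≤-reflexive 1+r≡u))) (≤-reflexive p+v≡k)) p+v≡k

    T-r : suc (T r) ≡ v
    T-r = +-cancelʳ-≡ u (suc (T r)) v (begin
      suc (T r + u) ≡⟨ cong suc (T-mid (≤-reflexive 1+r≡u) k<r+v) ⟩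
      suc (r + v) ≡⟨ cong (_+ v) 1+r≡u ⟩
      u + v ≡⟨ +-comm u v ⟩
      v + u ∎)
      where
      k<r+v : k < r + v
      k<r+v = subst (_< r + v) p+v≡k (+-monoˡ-< v p<r)

    commutes : Commutes k T (next k) p r
    commutes = record { generic = generic ; at-r = at-r ; at-k = at-k ; at-p = at-p }
      where
      generic : ∀ {x} → x ≤ k → x ≢ k → x ≢ p → x ≢ r → next k (T x) ≡ T (next k x)
      generic {x} x≤k x≢k x≢p x≢r = trans (sym (T-step x<k step)) (sym (cong T (next-< x<k)))
        where
        x<k : x < k
        x<k = ≤∧≢⇒< x≤k x≢k
        step : T (suc x) ≡ suc (T x)
        step with ≤-<-connex u x
        ... | inj₁ u≤x = +-cancelʳ-≡ u _ _
          (trans (T-high {suc x} (≤-trans u≤x (n≤1+n x))) (cong suc (sym (T-high {x} u≤x))))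
        ... | inj₂ x<u with ≤-<-connex (x + v) k
        ...   | inj₁ x+v≤k = trans (T-low 1+x<u 1+x+v≤k) (cong suc (sym (T-low x<u x+v≤k)))
          where
          1+x<u : suc x < u
          1+x<u = ≤∧≢⇒< x<u (λ eq → x≢r (cong pred eq))
          1+x+v≤k : suc x + v ≤ k
          1+x+v≤k = ≤∧≢⇒< x+v≤k (λ eq → x≢p (trans (sym (m+n∸n≡m x v)) (cong (_∸ v) eq)))
        ...   | inj₂ k<x+v = +-cancelʳ-≡ u _ _
          (trans (T-mid 1+x<u (≤-trans k<x+v (n≤1+n _))) (cong suc (sym (T-mid x<u k<x+v))))
          where
          1+x<u : suc x < u
          1+x<u = ≤∧≢⇒< x<u (λ eq → x≢r (cong pred eq))

      at-r : next k (T r) ≡ T (next k k)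
      at-r = trans (next-< (subst (_≤ k) (sym T-r) v≤k)) (trans T-r
        (sym (trans (cong T (next-last k)) (T-low 1≤u v≤k))))

      at-k : next k (T k) ≡ T (next k p)
      at-k = trans (sym (trans step (sym (next-< (subst (_≤ k) step (T-closed (suc p) p<k))))))
                   (cong T (sym (next-< p<k)))
        where
        p<k : p < k
        p<k = <-trans p<r r<k
        step : T (suc p) ≡ suc (T k)
        step = +-cancelʳ-≡ u _ _ (begin
          T (suc p) + u ≡⟨ T-mid (subst (suc p <_) 1+r≡u (s≤s p<r)) (≤-reflexive (cong suc (sym p+v≡k))) ⟩
          suc (p + v) ≡⟨ cong suc p+v≡k ⟩
          suc k ≡⟨ cong suc (T-high u≤k) ⟨
          suc (T k + u) ∎)

      at-p : next k (T p) ≡ T (next k r)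
      at-p = trans (cong (next k) T-p) (trans (next-last k)
        (sym (trans (cong T (trans (next-< r<k) 1+r≡u)) (+-cancelʳ-≡ u _ _ (T-high ≤-refl)))))

  -- When r ≡ n - 1 modulo k, the residue x < k occurs at offset lag x in the window n, …, n + k - 1;
  -- the point k of ℤ/(k + 1) gets the offset k that follows the window.
  opaque
    lag : ℕ → ℕ → ℕ → ℕ
    lag k r x with x ≟ k | x ≤? r
    ... | yes _ | _     = k
    ... | no _  | yes _ = x + (pred k ∸ r)
    ... | no _  | no _  = x ∸ suc r

    lag-last : ∀ k r → lag k r k ≡ k
    lag-last k r with k ≟ k | k ≤? r
    ... | yes _  | _ = refl
    ... | no k≢k | _ = contradiction refl k≢k

    lag-low : ∀ {p r x} → r ≤ p → x ≤ r → lag (suc p) r x + r ≡ x + p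
    lag-low {p} {r} {x} r≤p x≤r with x ≟ suc p | x ≤? r
    ... | yes refl | _       = contradiction r≤p (<⇒≱ x≤r)
    ... | no _     | no x≰r  = contradiction x≤r x≰r
    ... | no _     | yes _   = trans (+-assoc x (p ∸ r) r) (cong (x +_) (m∸n+n≡m r≤p))

    lag-high : ∀ {p r x} → r < x → x ≤ p → lag (suc p) r x + suc r ≡ x
    lag-high {p} {r} {x} r<x x≤p with x ≟ suc p | x ≤? r
    ... | yes refl | _       = contradiction x≤p 1+n≰n
    ... | no _     | yes x≤r = contradiction r<x (≤⇒≯ x≤r)
    ... | no _     | no _    = m∸n+n≡m r<x

  opaque
    shift : ℕ → ℕ → ℕ → ℕ → ℕ
    shift k r s x = (s + lag k r x) % suc k

    shift-≡ : ∀ k r s x → shift k r s x ≡ (s + lag k r x) % suc k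
    shift-≡ k r s x = refl

  shift-closed : ∀ k r s → Closed k (shift k r s)
  shift-closed k r s x _ = subst (_≤ k) (sym (shift-≡ k r s x)) (≤-pred (m%n<n (s + lag k r x) (suc k)))

  shift-last : ∀ k r s → shift k r s k ≡ (s + k) % suc k
  shift-last k r s = trans (shift-≡ k r s k) (cong (λ z → (s + z) % suc k) (lag-last k r))

  -- Along r + 1, ..., p, 0, ..., r, k, the cyclic order of increasing `lag`, τ advances by `next`.
  -- This order departs from the usual one only after `r`, `p` and `k`, whence the 3-cycle; `r < p`
  -- keeps the three points distinct.
  shift-commutes : ∀ {p r} s → r < p → Commutes (suc p) (next (suc p)) (shift (suc p) r s) p r
  shift-commutes {p} {r} s r<p = record
    { generic = λ {x} x≤k x≢k x≢p x≢r →
        let x<k = ≤∧≢⇒< x≤k x≢k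
            x<p = ≤∧≢⇒< (≤-pred x<k) x≢p
        in trans (cong τ (next-< x<k)) (advance {x} {suc x} (lag-suc x<p x≢r))
    ; at-r = trans (cong τ (next-< (<-trans r<p (n<1+n p)))) (sym (trans (cong (next k) (shift-≡ k r s k)) (trans (next-% k (s + lag k r k)) wrap)))
    ; at-k = trans (cong τ (next-last k)) (advance {p} {0} (+-cancelʳ-≡ r _ _ (begin
        lag k r 0 + r ≡⟨ lag-low (<⇒≤ r<p) z≤n ⟩
        p ≡⟨ lag-high r<p ≤-refl ⟨
        lag k r p + suc r ≡⟨ +-suc (lag k r p) r ⟩
        suc (lag k r p) + r ∎)))
    ; at-p = trans (cong τ (next-< (n<1+n p))) (advance {r} {k} (trans (lag-last k r) (cong suc (sym lag-r))))
    }
    where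
    k = suc p
    τ = shift k r s
    advance : ∀ {x y} → lag k r y ≡ suc (lag k r x) → τ y ≡ next k (τ x)
    advance {x} {y} eq = begin
      τ y ≡⟨ shift-≡ k r s y ⟩
      (s + lag k r y) % suc k ≡⟨ cong (_% suc k) (trans (cong (s +_) eq) (+-suc s (lag k r x))) ⟩
      suc (s + lag k r x) % suc k ≡⟨ next-% k (s + lag k r x) ⟨
      next k ((s + lag k r x) % suc k) ≡⟨ cong (next k) (shift-≡ k r s x) ⟨
      next k (τ x) ∎
    lag-r : lag k r r ≡ p
    lag-r = +-cancelʳ-≡ r _ _ (trans (lag-low (<⇒≤ r<p) ≤-refl) (+-comm r p))
    lag-suc : ∀ {x} → x < p → x ≢ r → lag k r (suc x) ≡ suc (lag k r x)
    lag-suc {x} x<p x≢r with ≤-<-connex x r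
    ... | inj₁ x≤r = +-cancelʳ-≡ r _ _ (trans (lag-low (<⇒≤ r<p) (≤∧≢⇒< x≤r x≢r))
                                             (cong suc (sym (lag-low (<⇒≤ r<p) x≤r))))
    ... | inj₂ r<x = +-cancelʳ-≡ (suc r) _ _ (trans (lag-high (≤-trans r<x (n≤1+n x)) x<p)
                                                   (cong suc (sym (lag-high r<x (<⇒≤ x<p)))))
    wrap : suc (s + lag k r k) % suc k ≡ τ (suc r)
    wrap = begin
      suc (s + lag k r k) % suc k ≡⟨ cong (λ z → suc (s + z) % suc k) (lag-last k r) ⟩
      suc (s + k) % suc k ≡⟨ cong (_% suc k) (+-suc s k) ⟨
      (s + suc k) % suc k ≡⟨ [m+n]%n≡m%n s (suc k) ⟩
      s % suc k ≡⟨ cong (_% suc k) (+-identityʳ s) ⟨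
      (s + 0) % suc k ≡⟨ cong (λ z → (s + z) % suc k) (+-cancelʳ-≡ (suc r) _ _ (lag-high (n<1+n r) r<p)) ⟨
      (s + lag k r (suc r)) % suc k ≡⟨ shift-≡ k r s (suc r) ⟨
      τ (suc r) ∎

-- Duality between τ and the exchange, and the coprimality criterion

module Duality where

  open import Data.Nat.Base
  open import Data.Nat.Coprimality using (Coprime; coprime-Bézout; coprime-+) renaming (sym to coprime-sym)
  open import Data.Nat.Divisibility using (m%n≡0⇒n∣m; ∣1⇒≡1; 0∣⇒≡0)
  open import Data.Nat.DivMod
  open import Data.Nat.GCD using (module Bézout)
  open import Data.Nat.GeneralisedArithmetic using (fold)
  open import Data.Nat.Properties
  open import Data.Nat.Solver using (module +-*-Solver)
  open Orbits
  open Exchange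
  open ≡-Reasoning
  open +-*-Solver

  InjectiveUpTo : ℕ → (ℕ → ℕ) → Set
  InjectiveUpTo k h = ∀ {x y} → x ≤ k → y ≤ k → h x ≡ h y → x ≡ y

  fold-closed : ∀ {k f} → Closed k f → ∀ i → fold k f i ≤ k
  fold-closed closed zero    = ≤-refl
  fold-closed {k} {f} closed (suc i) = closed (fold k f i) (fold-closed closed i)

  module _ {k} {f : ℕ → ℕ} (g h : ℕ → ℕ) (closed : Closed k f) (h-last : h k ≡ k)
           (conj : ∀ {x} → x ≤ k → h (f x) ≡ g (h x)) where

    fold-conjugate : ∀ i → h (fold k f i) ≡ fold k g i
    fold-conjugate zero    = h-last
    fold-conjugate (suc i) = trans (conj (fold-closed closed i)) (cong g (fold-conjugate i))

    covers-pull : Closed k h → InjectiveUpTo k h → Covers k g → Covers k f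
    covers-pull h-closed injective covers y y≤k with covers (h y) (h-closed y y≤k)
    ... | i , eq = i , injective (fold-closed closed (suc i)) y≤k (trans (fold-conjugate (suc i)) eq)

    covers-push : (∀ y → y ≤ k → ∃[ x ] x ≤ k × h x ≡ y) → Covers k f → Covers k g
    covers-push surjective covers y y≤k with surjective y y≤k
    ... | x , x≤k , hx≡y with covers x x≤k
    ...   | i , eq = i , trans (sym (fold-conjugate (suc i))) (trans (cong h eq) hx≡y)

  module Label {k} {f : ℕ → ℕ} (closed : Closed k f) (covers : Covers k f) where

    position : ℕ → ℕ
    position = orbit closed

    position-injective : InjectiveUpTo k position
    position-injective = orbit-injective closed covers

    position-next : ∀ {i} → i ≤ k → position (next k i) ≡ f (position i)
    position-next {i} i≤k with m≤n⇒m<n∨m≡n i≤k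
    ... | inj₁ i<k  = cong position (next-< i<k)
    ... | inj₂ refl = trans (cong position (next-last k)) (cong f (sym (orbit-return closed covers)))

    opaque
      time : ℕ → ℕ
      time y with y ≤? k
      ... | yes y≤k = proj₁ (label closed covers y y≤k)
      ... | no _    = y

      time≤ : Closed k time
      time≤ y y≤k with y ≤? k
      ... | yes y≤k′ = proj₁ (proj₂ (label closed covers y y≤k′))
      ... | no y≰k   = contradiction y≤k y≰k

      position-time : ∀ {y} → y ≤ k → position (time y) ≡ y
      position-time {y} y≤k with y ≤? k
      ... | yes y≤k′ = proj₂ (proj₂ (label closed covers y y≤k′))
      ... | no y≰k   = contradiction y≤k y≰k

    time-position : ∀ {i} → i ≤ k → time (position i) ≡ i
    time-position {i} i≤k = position-injective (time≤ _ (orbit≤ closed i)) i≤k (position-time (orbit≤ closed i))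

    time-injective : InjectiveUpTo k time
    time-injective {x} {y} x≤k y≤k eq =
      trans (sym (position-time x≤k)) (trans (cong position eq) (position-time y≤k))

    time-last : time k ≡ k
    time-last = trans (cong time (sym (orbit-return closed covers))) (time-position ≤-refl)

    time-step : ∀ {y} → y ≤ k → time (f y) ≡ next k (time y)
    time-step {y} y≤k = begin
      time (f y) ≡⟨ cong (λ z → time (f z)) (position-time y≤k) ⟨
      time (f (position (time y))) ≡⟨ cong time (position-next (time≤ y y≤k)) ⟨
      time (position (next k (time y))) ≡⟨ time-position (next≤ k (time y)) ⟩
      next k (time y) ∎

  -- `Y` relabels the points so that the pair (`next`, `shift`) becomes (`exchange`, `next`). The
  -- points `r` and `p` of the 3-cycle go to the ends `u - 1` and `k - v` of the intervals, which
  -- ties the two sets of parameters together.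
  record Match (p r s u v : ℕ) : Set where
    k : ℕ
    k = suc p
    field
      Y         : ℕ → ℕ
      closed    : Closed k Y
      injective : InjectiveUpTo k Y
      Y-last    : Y k ≡ k
      Y-next    : ∀ {x} → x ≤ k → Y (next k x) ≡ exchange k u v (Y x)
      Y-shift   : ∀ {x} → x ≤ k → Y (shift k r s x) ≡ next k (Y x)
      Y-r       : suc (Y r) ≡ u
      Y-p       : Y p + v ≡ k

    shift-covers : Covers k (shift k r s)
    shift-covers = covers-pull (next k) Y (shift-closed k r s) Y-last Y-shift closed injective (next-covers k)

    -- As `next k` is a cycle, `Y` is determined by `u` and `v` alone; `shift-orbit` recovers it
    -- likewise from `r` and `s`. The two uniqueness lemmas rest on this.
    Y-orbit : ∀ {x} → x ≤ k → Y x ≡ fold k (exchange k u v) (suc x)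
    Y-orbit {x} x≤k = trans (cong Y (sym (next-orbit k x≤k)))
      (fold-conjugate (exchange k u v) Y (λ y _ → next≤ k y) Y-last Y-next (suc x))

    shift-orbit : ∀ {x} → x ≤ k → fold k (shift k r s) (suc (Y x)) ≡ x
    shift-orbit {x} x≤k = injective (fold-closed (shift-closed k r s) (suc (Y x))) x≤k
      (trans (fold-conjugate (next k) Y (shift-closed k r s) Y-last Y-shift (suc (Y x))) (next-orbit k (closed x x≤k)))

  -- Since `k` is -1 modulo `suc k`, adding `c * k` cancels `c`.
  %-cancelˡ : ∀ {k} c {a b} → a ≤ k → b ≤ k → (c + a) % suc k ≡ (c + b) % suc k → a ≡ b
  %-cancelˡ {k} c {a} {b} a≤k b≤k eq = begin
    a ≡⟨ m<n⇒m%n≡m (s≤s a≤k) ⟨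
    a % m ≡⟨ shifted a ⟨
    ((c * k) % m + (c + a) % m) % m ≡⟨ cong (λ z → ((c * k) % m + z) % m) eq ⟩
    ((c * k) % m + (c + b) % m) % m ≡⟨ shifted b ⟩
    b % m ≡⟨ m<n⇒m%n≡m (s≤s b≤k) ⟩
    b ∎
    where
    m = suc k
    shifted : ∀ x → ((c * k) % m + (c + x) % m) % m ≡ x % m
    shifted x = begin
      ((c * k) % m + (c + x) % m) % m ≡⟨ %-distribˡ-+ (c * k) (c + x) m ⟨
      (c * k + (c + x)) % m ≡⟨ cong (_% m) (solve 3 (λ c k x → c :* k :+ (c :+ x) := x :+ c :* (con 1 :+ k)) refl c k x) ⟩
      (x + c * m) % m ≡⟨ [m+kn]%n≡m%n x c m ⟩
      x % m ∎

  module _ {p r s u v r′ s′ u′ v′} (M : Match p r s u v) (M′ : Match p r′ s′ u′ v′) where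
    private
      module M = Match M
      module M′ = Match M′
      k = suc p

    Match-uniqueˡ : r ≤ k → r′ ≤ k → s ≤ k → s′ ≤ k → u ≡ u′ → v ≡ v′ → r ≡ r′ × s ≡ s′
    Match-uniqueˡ r≤k r′≤k s≤k s′≤k refl refl = r≡r′ , s≡s′
      where
      Y≡Y′ : ∀ {x} → x ≤ k → M.Y x ≡ M′.Y x
      Y≡Y′ x≤k = trans (M.Y-orbit x≤k) (sym (M′.Y-orbit x≤k))
      r≡r′ : r ≡ r′
      r≡r′ = M.injective r≤k r′≤k (suc-injective (trans M.Y-r (trans (sym M′.Y-r) (cong suc (sym (Y≡Y′ r′≤k))))))
      same : shift k r s k ≡ shift k r′ s′ k
      same = M.injective (shift-closed k r s k ≤-refl) (shift-closed k r′ s′ k ≤-refl) (begin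
        M.Y (shift k r s k) ≡⟨ M.Y-shift ≤-refl ⟩
        next k (M.Y k) ≡⟨ cong (next k) (Y≡Y′ ≤-refl) ⟩
        next k (M′.Y k) ≡⟨ M′.Y-shift ≤-refl ⟨
        M′.Y (shift k r′ s′ k) ≡⟨ Y≡Y′ (shift-closed k r′ s′ k ≤-refl) ⟨
        M.Y (shift k r′ s′ k) ∎)
      s≡s′ : s ≡ s′
      s≡s′ = %-cancelˡ k s≤k s′≤k (begin
        (k + s) % suc k ≡⟨ cong (_% suc k) (+-comm k s) ⟩
        (s + k) % suc k ≡⟨ shift-last k r s ⟨
        shift k r s k ≡⟨ same ⟩
        shift k r′ s′ k ≡⟨ shift-last k r′ s′ ⟩
        (s′ + k) % suc k ≡⟨ cong (_% suc k) (+-comm s′ k) ⟩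
        (k + s′) % suc k ∎)

    Match-uniqueʳ : r ≤ k → r ≡ r′ → s ≡ s′ → u ≡ u′ × v ≡ v′
    Match-uniqueʳ r≤k refl refl =
      trans (sym M.Y-r) (trans (cong suc (Y≡Y′ r≤k)) M′.Y-r) ,
      +-cancelˡ-≡ (M.Y p) v v′ (trans M.Y-p (trans (sym M′.Y-p) (cong (_+ v′) (sym (Y≡Y′ (n≤1+n p))))))
      where
      Y≡Y′ : ∀ {x} → x ≤ k → M.Y x ≡ M′.Y x
      Y≡Y′ {x} x≤k = begin
        M.Y x ≡⟨ next-orbit k (M.closed x x≤k) ⟨
        fold k (next k) (suc (M.Y x)) ≡⟨ fold-conjugate (next k) M′.Y (shift-closed k r s) M′.Y-last M′.Y-shift (suc (M.Y x)) ⟨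
        M′.Y (fold k (shift k r s) (suc (M.Y x))) ≡⟨ cong M′.Y (M.shift-orbit x≤k) ⟩
        M′.Y x ∎

  module FromExchange {p u v : ℕ} (tri : Triangle (suc p) u v) (covers : Covers (suc p) (exchange (suc p) u v)) where
    open Time tri using (T; T-closed; T-p) renaming (p to a; r to b; p<r to a<b; r<k to b<k; p+v≡k to a+v≡k; 1+r≡u to 1+b≡u; commutes to T-commutes)
    open Label T-closed covers renaming (position to Y; time to X)

    private
      k = suc p

    -- Both values are forced: `Y r` must be the end `b` of the middle interval, and `τ k`, which is
    -- `s - 1`, must be the point labelled 0.
    r s : ℕ
    r = X b
    s = suc (X 0)

    a<k : a < k
    a<k = <-trans a<b b<k

    Y-r : Y r ≡ b
    Y-r = position-time (<⇒≤ b<k)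

    Y-k : Y k ≡ k
    Y-k = orbit-return T-closed covers

    -- `T a = k` says that `a` directly precedes `k` along the orbit, and `k` is reached at time
    -- `k = suc p`.
    Y-p : Y p ≡ a
    Y-p with m≤n⇒m<n∨m≡n (time≤ a (<⇒≤ a<k))
    ... | inj₁ Xa<k = trans (cong Y (sym Xa≡p)) (position-time (<⇒≤ a<k))
      where
      Xa≡p : X a ≡ p
      Xa≡p = suc-injective (position-injective Xa<k ≤-refl (begin
        T (Y (X a)) ≡⟨ cong T (position-time (<⇒≤ a<k)) ⟩
        T a ≡⟨ T-p ⟩
        k ≡⟨ Y-k ⟨
        Y k ∎))
    ... | inj₂ Xa≡k = contradiction (trans (sym (position-time (<⇒≤ a<k))) (trans (cong Y Xa≡k) Y-k)) (<⇒≢ a<k)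

    r<p : r < p
    r<p = ≤∧≢⇒< (≤-pred (≤∧≢⇒< (time≤ b (<⇒≤ b<k))
      (λ eq → <⇒≢ b<k (trans (sym Y-r) (trans (cong Y eq) Y-k)))))
      (λ eq → <⇒≢ a<b (trans (sym Y-p) (trans (cong Y (sym eq)) Y-r)))

    private
      τ : ℕ → ℕ
      τ = shift k r s
      module τC = Commutes (shift-commutes s r<p)
      module TC = Commutes T-commutes

      Good : ℕ → Set
      Good x = Y (τ x) ≡ next k (Y x)

      -- The pairs (`next`, τ) and (`T`, `next`) satisfy the same commutation relation at points
      -- that correspond under `Y`, so `Good` propagates from one point to another.
      transfer : ∀ {x w} → x ≤ k → w ≤ k → τ (next k x) ≡ next k (τ w) → next k (T (Y x)) ≡ T (next k (Y w)) →
                 Good w → Good (next k x)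
      transfer {x} {w} x≤k w≤k eq₁ eq₂ good = begin
        Y (τ (next k x)) ≡⟨ cong Y eq₁ ⟩
        Y (next k (τ w)) ≡⟨ position-next {τ w} (shift-closed k r s w w≤k) ⟩
        T (Y (τ w)) ≡⟨ cong T good ⟩
        T (next k (Y w)) ≡⟨ eq₂ ⟨
        next k (T (Y x)) ≡⟨ cong (next k) (position-next {x} x≤k) ⟨
        next k (Y (next k x)) ∎

      p≤k : p ≤ k
      p≤k = n≤1+n p
      r≤k : r ≤ k
      r≤k = ≤-trans (<⇒≤ r<p) p≤k

      good-k : Good k
      good-k = begin
        Y (τ k) ≡⟨ cong Y (shift-last k r s) ⟩
        Y ((s + k) % suc k) ≡⟨ cong (λ z → Y (z % suc k)) (+-suc (X 0) k) ⟨
        Y ((X 0 + suc k) % suc k) ≡⟨ cong Y ([m+n]%n≡m%n (X 0) (suc k)) ⟩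
        Y (X 0 % suc k) ≡⟨ cong Y (m<n⇒m%n≡m (s≤s (time≤ 0 z≤n))) ⟩
        Y (X 0) ≡⟨ position-time z≤n ⟩
        0 ≡⟨ next-last k ⟨
        next k k ≡⟨ cong (next k) Y-k ⟨
        next k (Y k) ∎

      good-1+r : Good (suc r)
      good-1+r = subst Good (next-< (<-trans r<p (n<1+n p)))
        (transfer r≤k ≤-refl τC.at-r
          (trans (cong (λ z → next k (T z)) Y-r) (trans TC.at-r (cong (λ z → T (next k z)) (sym Y-k)))) good-k)

      good-suc : ∀ {x} → x < p → x ≢ r → Good x → Good (suc x)
      good-suc {x} x<p x≢r good = subst Good (next-< x<k)
        (transfer x≤k x≤k (τC.generic x≤k x≢k x≢p x≢r)
          (TC.generic (orbit≤ T-closed x)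
            (λ eq → x≢k (position-injective x≤k ≤-refl (trans eq (sym Y-k))))
            (λ eq → x≢p (position-injective x≤k p≤k (trans eq (sym Y-p))))
            (λ eq → x≢r (position-injective x≤k r≤k (trans eq (sym Y-r))))) good)
        where
        x<k : x < k
        x<k = <-trans x<p (n<1+n p)
        x≤k : x ≤ k
        x≤k = <⇒≤ x<k
        x≢k : x ≢ k
        x≢k = <⇒≢ x<k
        x≢p : x ≢ p
        x≢p = <⇒≢ x<p

      good-high : ∀ x → r < x → x ≤ p → Good x
      good-high (suc x) r<1+x 1+x≤p with m≤n⇒m<n∨m≡n (≤-pred r<1+x)
      ... | inj₁ r<x  = good-suc 1+x≤p (λ eq → <⇒≢ r<x (sym eq)) (good-high x r<x (<⇒≤ 1+x≤p))
      ... | inj₂ refl = good-1+r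

      good-0 : Good 0
      good-0 = subst Good (next-last k)
        (transfer ≤-refl p≤k τC.at-k
          (trans (cong (λ z → next k (T z)) Y-k) (trans TC.at-k (cong (λ z → T (next k z)) (sym Y-p))))
          (good-high p r<p ≤-refl))

      good-low : ∀ x → x ≤ r → Good x
      good-low zero    _   = good-0
      good-low (suc x) x<r = good-suc (<-trans x<r r<p) (<⇒≢ x<r) (good-low x (<⇒≤ x<r))

      good : ∀ {x} → x ≤ k → Good x
      good {x} x≤k with m≤n⇒m<n∨m≡n x≤k | ≤-<-connex x r
      ... | inj₂ refl | _        = good-k
      ... | inj₁ x<k  | inj₁ x≤r = good-low x x≤r
      ... | inj₁ x<k  | inj₂ r<x = good-high x r<x (≤-pred x<k)

    s≤k : s ≤ k
    s≤k = ≤∧≢⇒< (time≤ 0 z≤n) λ eq → 0≢1+n (trans (sym (position-time z≤n)) (trans (cong Y eq) Y-k))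

    match : Match p r s u v
    match = record
      { Y = Y ; closed = λ x _ → orbit≤ T-closed x ; injective = position-injective ; Y-last = Y-k
      ; Y-next = position-next ; Y-shift = good ; Y-r = trans (cong suc Y-r) 1+b≡u
      ; Y-p = trans (cong (_+ v) Y-p) a+v≡k }

  module FromShift {p r s : ℕ} (r<p : r < p) (covers : Covers (suc p) (shift (suc p) r s)) where
    private
      k = suc p
      τ = shift k r s
    open Label (shift-closed k r s) covers renaming (position to X; time to Y)
    private
      module τC = Commutes (shift-commutes s r<p)
      R a : ℕ
      R = Y r
      a = Y p
      p≤k : p ≤ k
      p≤k = n≤1+n p
      r≤k : r ≤ k
      r≤k = ≤-trans (<⇒≤ r<p) p≤k

      below : ∀ {x} → x < k → Y x < k
      below {x} x<k = ≤∧≢⇒< (time≤ x (<⇒≤ x<k))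
        (λ eq → <⇒≢ x<k (time-injective (<⇒≤ x<k) ≤-refl (trans eq (sym time-last))))

    R<k : R < k
    R<k = below (≤-trans r<p p≤k)

    a<k : a < k
    a<k = below (n<1+n p)

    -- The rotation of the points, seen in the time labels of τ; it will turn out to be the
    -- exchange.
    σ : ℕ → ℕ
    σ t = Y (next k (X t))

    private
      σ-Y : ∀ {x} → x ≤ k → σ (Y x) ≡ Y (next k x)
      σ-Y x≤k = cong (λ z → Y (next k z)) (position-time x≤k)

      commute : ∀ {x w} → x ≤ k → w ≤ k → τ (next k x) ≡ next k (τ w) → next k (σ (Y x)) ≡ σ (next k (Y w))
      commute {x} {w} x≤k w≤k eq = begin
        next k (σ (Y x)) ≡⟨ cong (next k) (σ-Y x≤k) ⟩
        next k (Y (next k x)) ≡⟨ time-step (next≤ k x) ⟨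
        Y (τ (next k x)) ≡⟨ cong Y eq ⟩
        Y (next k (τ w)) ≡⟨ σ-Y (shift-closed k r s w w≤k) ⟨
        σ (Y (τ w)) ≡⟨ cong σ (time-step w≤k) ⟩
        σ (next k (Y w)) ∎

      σ-a : σ a ≡ k
      σ-a = trans (σ-Y p≤k) (trans (cong Y (next-< (n<1+n p))) time-last)

      σ-1+R : σ (suc R) ≡ 0
      σ-1+R = begin
        σ (suc R) ≡⟨ cong σ (next-< R<k) ⟨
        σ (next k R) ≡⟨ commute p≤k r≤k τC.at-p ⟨
        next k (σ a) ≡⟨ cong (next k) σ-a ⟩
        next k k ≡⟨ next-last k ⟩
        0 ∎

      σ-1+a : σ (suc a) ≡ next k (σ k)
      σ-1+a = begin
        σ (suc a) ≡⟨ cong σ (next-< a<k) ⟨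
        σ (next k a) ≡⟨ commute ≤-refl p≤k τC.at-k ⟨
        next k (σ (Y k)) ≡⟨ cong (λ z → next k (σ z)) time-last ⟩
        next k (σ k) ∎

      σ-0 : σ 0 ≡ next k (σ R)
      σ-0 = begin
        σ 0 ≡⟨ cong σ (next-last k) ⟨
        σ (next k k) ≡⟨ cong (λ z → σ (next k z)) time-last ⟨
        σ (next k (Y k)) ≡⟨ commute r≤k ≤-refl τC.at-r ⟨
        next k (σ R) ∎

      σ-suc : ∀ {t} → t < k → t ≢ a → t ≢ R → σ (suc t) ≡ next k (σ t)
      σ-suc {t} t<k t≢a t≢R = begin
        σ (suc t) ≡⟨ cong σ (next-< t<k) ⟨
        σ (next k t) ≡⟨ cong (λ z → σ (next k z)) Yx≡t ⟨
        σ (next k (Y x)) ≡⟨ commute x≤k x≤k (τC.generic x≤k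
                                   (λ eq → <⇒≢ t<k (trans (sym Yx≡t) (trans (cong Y eq) time-last)))
                                   (λ eq → t≢a (trans (sym Yx≡t) (cong Y eq)))
                                   (λ eq → t≢R (trans (sym Yx≡t) (cong Y eq)))) ⟨
        next k (σ (Y x)) ≡⟨ cong (λ z → next k (σ z)) Yx≡t ⟩
        next k (σ t) ∎
        where
        x = X t
        x≤k : x ≤ k
        x≤k = orbit≤ (shift-closed k r s) t
        Yx≡t : Y x ≡ t
        Yx≡t = time-position (<⇒≤ t<k)

      -- Within a stretch of times free of a and R, σ is a translation as long as it stays below k.
      σ-run : ∀ {t₀ c} → σ t₀ ≡ c → ∀ i → t₀ + i ≤ k → c + i ≤ k →
              (∀ j → j < i → t₀ + j ≢ a × t₀ + j ≢ R) → σ (t₀ + i) ≡ c + i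
      σ-run {t₀} {c} start zero _ _ _ = trans (cong σ (+-identityʳ t₀)) (trans start (sym (+-identityʳ c)))
      σ-run {t₀} {c} start (suc i) t≤k c≤k clear = begin
        σ (t₀ + suc i) ≡⟨ cong σ (+-suc t₀ i) ⟩
        σ (suc (t₀ + i)) ≡⟨ σ-suc t<k (proj₁ (clear i ≤-refl)) (proj₂ (clear i ≤-refl)) ⟩
        next k (σ (t₀ + i)) ≡⟨ cong (next k) (σ-run start i (<⇒≤ t<k) (<⇒≤ c<k) (λ j j<i → clear j (<-trans j<i (n<1+n i)))) ⟩
        next k (c + i) ≡⟨ next-< c<k ⟩
        suc (c + i) ≡⟨ +-suc c i ⟨
        c + suc i ∎
        where
        t<k : t₀ + i < k
        t<k = subst (_≤ k) (+-suc t₀ i) t≤k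
        c<k : c + i < k
        c<k = subst (_≤ k) (+-suc c i) c≤k

      a≢R : a ≢ R
      a≢R eq = <⇒≢ r<p (time-injective r≤k p≤k (sym eq))

    -- If `R < a`, the run starting with `σ (suc R) = 0` would reach `a` at a value below `k`,
    -- against `σ a = k`.
    a<R : a < R
    a<R with <-cmp a R
    ... | tri< a<R _ _ = a<R
    ... | tri≈ _ a≡R _ = contradiction a≡R a≢R
    ... | tri> _ _ R<a = contradiction (trans (sym σa≡i) σ-a) (<⇒≢ i<k)
      where
      i = a ∸ suc R
      i+≡a : suc R + i ≡ a
      i+≡a = m+[n∸m]≡n R<a
      i<k : i < k
      i<k = ≤-<-trans (m∸n≤m a (suc R)) a<k
      σa≡i : σ a ≡ i
      σa≡i = trans (cong σ (sym i+≡a)) (σ-run σ-1+R i (subst (_≤ k) (sym i+≡a) (<⇒≤ a<k)) (<⇒≤ i<k)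
        (λ j j<i → (λ eq → <⇒≢ (subst (suc R + j <_) i+≡a (+-monoʳ-< (suc R) j<i)) eq) ,
                   (λ eq → m+1+n≢m R (trans (+-suc R j) eq))))

    private
      beyond : ∀ {t₀ j} → R < t₀ → t₀ + j ≢ a × t₀ + j ≢ R
      beyond {t₀} {j} R<t₀ = (λ eq → <⇒≢ (<-trans a<R (<-≤-trans R<t₀ (m≤m+n t₀ j))) (sym eq)) ,
                             (λ eq → <⇒≢ (<-≤-trans R<t₀ (m≤m+n t₀ j)) (sym eq))

    -- The intervals are determined from the right: `σ (suc R) = 0` starts the last one, its end
    -- value `σ k` starts the middle one, and the end value `σ R` of that starts the first.
    σ-high : ∀ {t} → R < t → t ≤ k → σ t + suc R ≡ t
    σ-high {t} R<t t≤k = trans (cong (_+ suc R) σt≡i) (m∸n+n≡m R<t)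
      where
      i = t ∸ suc R
      i+≡t : suc R + i ≡ t
      i+≡t = m+[n∸m]≡n R<t
      σt≡i : σ t ≡ i
      σt≡i = trans (cong σ (sym i+≡t)) (σ-run σ-1+R i (subst (_≤ k) (sym i+≡t) t≤k) (≤-trans (m∸n≤m t (suc R)) t≤k)
        (λ j _ → beyond (n<1+n R)))

    σ-mid : ∀ {t} → a < t → t ≤ R → σ t + suc R ≡ t + (k ∸ a)
    σ-mid {t} a<t t≤R = begin
      σ t + suc R ≡⟨ cong (_+ suc R) σt ⟩
      suc (σ k) + i + suc R ≡⟨ solve 3 (λ s i R → con 1 :+ s :+ i :+ (con 1 :+ R) := (s :+ (con 1 :+ R)) :+ (con 1 :+ i)) refl (σ k) i R ⟩
      (σ k + suc R) + suc i ≡⟨ cong (_+ suc i) (σ-high R<k ≤-refl) ⟩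
      k + suc i ≡⟨ cong (_+ suc i) (m+[n∸m]≡n (<⇒≤ a<k)) ⟨
      a + (k ∸ a) + suc i ≡⟨ solve 3 (λ a c i → a :+ c :+ (con 1 :+ i) := (con 1 :+ a :+ i) :+ c) refl a (k ∸ a) i ⟩
      suc a + i + (k ∸ a) ≡⟨ cong (_+ (k ∸ a)) i+≡t ⟩
      t + (k ∸ a) ∎
      where
      i = t ∸ suc a
      i+≡t : suc a + i ≡ t
      i+≡t = m+[n∸m]≡n a<t
      σk<k : σ k < k
      σk<k = ≤-trans (m≤m+n (suc (σ k)) R) (≤-reflexive (trans (sym (+-suc (σ k) R)) (σ-high R<k ≤-refl)))
      bound : suc (σ k) + i ≤ k
      bound = subst (suc (σ k) + i ≤_) (trans (sym (+-suc (σ k) R)) (σ-high R<k ≤-refl))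
        (+-monoʳ-≤ (suc (σ k)) (≤-trans (m∸n≤m t (suc a)) t≤R))
      σt : σ t ≡ suc (σ k) + i
      σt = trans (cong σ (sym i+≡t)) (σ-run (trans σ-1+a (next-< σk<k)) i
        (subst (_≤ k) (sym i+≡t) (≤-trans t≤R (<⇒≤ R<k))) bound
        (λ j j<i → (λ eq → m+1+n≢m a (trans (+-suc a j) eq)) ,
                   (λ eq → <⇒≢ (<-≤-trans (subst (suc a + j <_) i+≡t (+-monoʳ-< (suc a) j<i)) t≤R) eq)))

    σ-low : ∀ {t} → t ≤ a → σ t ≡ t + (k ∸ a)
    σ-low {t} t≤a = trans (σ-run start t (≤-trans t≤a (<⇒≤ a<k))
        (≤-trans (+-monoʳ-≤ (k ∸ a) t≤a) (≤-reflexive (m∸n+n≡m (<⇒≤ a<k))))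
        (λ j j<t → <⇒≢ (<-≤-trans j<t t≤a) , <⇒≢ (<-trans (<-≤-trans j<t t≤a) a<R)))
      (+-comm (k ∸ a) t)
      where
      suc-σ-R : suc (σ R) ≡ k ∸ a
      suc-σ-R = +-cancelʳ-≡ R _ _ (trans (sym (+-suc (σ R) R)) (trans (σ-mid a<R ≤-refl) (+-comm R (k ∸ a))))
      start : σ 0 ≡ k ∸ a
      start = trans σ-0 (trans (next-< (subst (_≤ k) (sym suc-σ-R) (m∸n≤m k a))) suc-σ-R)

    u v : ℕ
    u = suc R
    v = k ∸ a

    tri : Triangle k u v
    tri = triangle (s≤s z≤n) (m<n⇒0<n∸m a<k) R<k (m∸n≤m k a)
      (subst (_≤ u + v) (cong (2 +_) (m+[n∸m]≡n (<⇒≤ a<k)))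
        (subst (suc (suc a) + v ≤_) refl (+-monoˡ-≤ v (s≤s a<R))))

    open Time tri using (T; T-low; T-mid; T-high; T-closed)

    σ≡T : ∀ {t} → t ≤ k → σ t ≡ T t
    σ≡T {t} t≤k with ≤-<-connex t a | ≤-<-connex t R
    ... | inj₁ t≤a | _ = trans (σ-low t≤a) (sym (T-low (s≤s (≤-trans t≤a (<⇒≤ a<R)))
      (≤-trans (+-monoˡ-≤ v t≤a) (≤-reflexive (m+[n∸m]≡n (<⇒≤ a<k))))))
    ... | inj₂ a<t | inj₁ t≤R = +-cancelʳ-≡ u _ _ (trans (σ-mid a<t t≤R) (sym (T-mid (s≤s t≤R)
      (subst (_< t + v) (m+[n∸m]≡n (<⇒≤ a<k)) (+-monoˡ-< v a<t)))))
    ... | inj₂ a<t | inj₂ R<t = +-cancelʳ-≡ u _ _ (trans (σ-high R<t t≤k) (sym (T-high R<t)))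

    match : Match p r s u v
    match = record
      { Y = Y ; closed = time≤ ; injective = time-injective ; Y-last = time-last
      ; Y-next = λ {x} x≤k → trans (sym (σ-Y x≤k)) (σ≡T (time≤ x x≤k))
      ; Y-shift = time-step ; Y-r = refl ; Y-p = m+[n∸m]≡n (<⇒≤ a<k) }

    exchange-covers : Covers k T
    exchange-covers = covers-push T Y (λ y _ → next≤ k y) time-last (Match.Y-next match)
      (λ y y≤k → X y , orbit≤ (shift-closed k r s) y , time-position y≤k) (next-covers k)

  module _ {k u v} (tri : Triangle k u v) where
    open Triangle tri
    open Time tri using (T; T-low; T-mid; T-high; T-closed)

    -- `T` moves each point by `v`, `v - u` or `-u`, so residues modulo a common divisor are
    -- constant along an orbit. If the orbit covers, 0 and 1 are congruent.
    covers⇒coprime : Covers k T → Coprime u v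
    covers⇒coprime covers {zero}      (0∣u , _)   = contradiction (0∣⇒≡0 0∣u) (m<n⇒n≢0 1≤u)
    covers⇒coprime covers {d@(suc _)} (d∣u , d∣v) = ∣1⇒≡1 (m%n≡0⇒n∣m 1 d (residue 1 (≤-trans 1≤u u≤k)))
      where
      T-residue : ∀ t → T t % d ≡ t % d
      T-residue t with ≤-<-connex u t | ≤-<-connex (t + v) k
      ... | inj₁ u≤t | _ = trans (sym (%-remove-+ʳ (T t) d∣u)) (cong (_% d) (T-high u≤t))
      ... | inj₂ t<u | inj₁ t+v≤k = trans (cong (_% d) (T-low t<u t+v≤k)) (%-remove-+ʳ t d∣v)
      ... | inj₂ t<u | inj₂ k<t+v = trans (sym (%-remove-+ʳ (T t) d∣u)) (trans (cong (_% d) (T-mid t<u k<t+v)) (%-remove-+ʳ t d∣v))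
      fold-residue : ∀ i → fold k T i % d ≡ k % d
      fold-residue zero    = refl
      fold-residue (suc i) = trans (T-residue (fold k T i)) (fold-residue i)
      residue : ∀ y → y ≤ k → y % d ≡ 0 % d
      residue y y≤k with covers y y≤k | covers 0 z≤n
      ... | i , eqᵢ | j , eqⱼ = trans (cong (_% d) (sym eqᵢ)) (trans (fold-residue (suc i))
                                  (trans (sym (fold-residue (suc j))) (cong (_% d) eqⱼ)))

    private
      L : ℕ
      L = u + v

      instance
        L-nonZero : NonZero L
        L-nonZero = >-nonZero (≤-trans 1≤u (m≤m+n u v))

      ρ : ℕ → ℕ
      ρ y = (y + v) % L

      ρ-low : ∀ {t} → t < u → ρ t ≡ t + v
      ρ-low t<u = m<n⇒m%n≡m (+-monoˡ-< v t<u)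

      ρ-high : ∀ {t} → u ≤ t → t < L → ρ t + u ≡ t
      ρ-high {t} u≤t t<L = trans (cong (_+ u) ρt≡i) (m∸n+n≡m u≤t)
        where
        i = t ∸ u
        i+L≡t+v : i + L ≡ t + v
        i+L≡t+v = trans (sym (+-assoc i u v)) (cong (_+ v) (m∸n+n≡m u≤t))
        ρt≡i : ρ t ≡ i
        ρt≡i = begin
          (t + v) % L ≡⟨ cong (_% L) i+L≡t+v ⟨
          (i + L) % L ≡⟨ [m+n]%n≡m%n i L ⟩
          i % L ≡⟨ m<n⇒m%n≡m (≤-<-trans (m∸n≤m t u) t<L) ⟩
          i ∎

      k<L : k < L
      k<L = ≤-trans (n≤1+n (suc k)) 2+k≤u+v

      T≡ρ : ∀ {t} → t ≤ k → ρ t ≤ k → T t ≡ ρ t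
      T≡ρ {t} t≤k ρt≤k with ≤-<-connex u t
      ... | inj₁ u≤t = +-cancelʳ-≡ u _ _ (trans (T-high u≤t) (sym (ρ-high u≤t (≤-<-trans t≤k k<L))))
      ... | inj₂ t<u = trans (T-low t<u (subst (_≤ k) (ρ-low t<u) ρt≤k)) (sym (ρ-low t<u))

      T≡ρ² : ∀ {t} → t ≤ k → k < ρ t → T t ≡ ρ (ρ t)
      T≡ρ² {t} t≤k k<ρt with ≤-<-connex u t
      ... | inj₁ u≤t = contradiction (≤-trans (m≤m+n (ρ t) u) (≤-trans (≤-reflexive (ρ-high u≤t (≤-<-trans t≤k k<L))) t≤k)) (<⇒≱ k<ρt)
      ... | inj₂ t<u = +-cancelʳ-≡ u _ _ (begin
        T t + u ≡⟨ T-mid t<u (subst (k <_) (ρ-low t<u) k<ρt) ⟩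
        t + v ≡⟨ ρ-low t<u ⟨
        ρ t ≡⟨ ρ-high (≤-trans u≤k (<⇒≤ k<ρt)) (m%n<n (t + v) L) ⟨
        ρ (ρ t) + u ∎)

      -- T is the first return of the rotation ρ of ℤ/(u + v) to [0, k].
      first-return : ∀ j → (∃[ i ] fold k ρ (suc j) ≡ fold k T (suc i)) ⊎
                           (∃[ i ] fold k ρ (suc j) ≡ ρ (fold k T i) × k < fold k ρ (suc j))
      first-return zero = inj₁ (0 , sym (T≡ρ ≤-refl
        (≤-trans (m≤m+n (ρ k) u) (≤-reflexive (ρ-high u≤k k<L)))))
      first-return (suc j) with first-return j
      ... | inj₂ (i , eq , k<) = inj₁ (i , trans (cong ρ eq)
              (sym (T≡ρ² (fold-closed T-closed i) (subst (k <_) eq k<))))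
      ... | inj₁ (i , eq) with ≤-<-connex (fold k ρ (2 + j)) k
      ...   | inj₁ ≤k = inj₁ (suc i , trans (cong ρ eq)
              (sym (T≡ρ (fold-closed T-closed (suc i)) (subst (_≤ k) (cong ρ eq) ≤k))))
      ...   | inj₂ k< = inj₂ (suc i , cong ρ eq , k<)

      ρ-fold : ∀ j → fold k ρ j % L ≡ (k + j * v) % L
      ρ-fold zero    = cong (_% L) (sym (+-identityʳ k))
      ρ-fold (suc j) = begin
        (fold k ρ j + v) % L % L ≡⟨ m%n%n≡m%n (fold k ρ j + v) L ⟩
        (fold k ρ j + v) % L ≡⟨ %-distribˡ-+ (fold k ρ j) v L ⟩
        (fold k ρ j % L + v % L) % L ≡⟨ cong (λ z → (z + v % L) % L) (ρ-fold j) ⟩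
        ((k + j * v) % L + v % L) % L ≡⟨ %-distribˡ-+ (k + j * v) v L ⟨
        (k + j * v + v) % L ≡⟨ cong (_% L) (trans (+-assoc k (j * v) v) (cong (k +_) (+-comm (j * v) v))) ⟩
        (k + suc j * v) % L ∎

      inverse : Coprime u v → ∃[ x ] ∃[ q ] x * v ≡ 1 + q * L
      inverse coprime with coprime-Bézout (coprime-sym (coprime-+ coprime))
      ... | Bézout.+- x y eq = x , y , trans (sym eq) (cong (λ z → 1 + y * z) (+-comm v u))
      -- Here `x * v` is -1 modulo `L`, so `x` is multiplied by `L - 1 = 1 + l`, again -1.
      ... | Bézout.-+ x (suc y) eq = x * (1 + l) , l + y * (1 + l) , +-cancelˡ-≡ (1 + l) _ _ (begin
        1 + l + x * (1 + l) * v ≡⟨ solve 3 (λ l x v → con 1 :+ l :+ x :* (con 1 :+ l) :* v := (con 1 :+ x :* v) :* (con 1 :+ l)) refl l x v ⟩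
        (1 + x * v) * (1 + l) ≡⟨ cong (_* (1 + l)) (trans eq (cong (λ z → suc y * z) (trans (+-comm v u) (sym 2+l≡L)))) ⟩
        suc y * (2 + l) * (1 + l) ≡⟨ solve 2 (λ l y → (con 1 :+ y) :* (con 2 :+ l) :* (con 1 :+ l) := con 1 :+ l :+ (con 1 :+ (l :+ y :* (con 1 :+ l)) :* (con 2 :+ l))) refl l y ⟩
        1 + l + (1 + (l + y * (1 + l)) * (2 + l)) ≡⟨ cong (λ z → 1 + l + (1 + (l + y * (1 + l)) * z)) 2+l≡L ⟩
        1 + l + (1 + (l + y * (1 + l)) * L) ∎)
        where
        l = L ∸ 2
        2+l≡L : 2 + l ≡ L
        2+l≡L = m+[n∸m]≡n (+-mono-≤ 1≤u 1≤v)

    coprime⇒covers : Coprime u v → Covers k T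
    coprime⇒covers coprime y y≤k with inverse coprime
    ... | x , q , xv≡1+qL = conclude (first-return (pred j))
      where
      -- As `x * v` is 1 modulo `L`, `j` steps of ρ lead from `k` to `k + (y + d) = y + L`. The
      -- summand `L` makes `j` positive.
      d j : ℕ
      d = L ∸ k
      j = x * (y + d) + L
      1+j≡ : suc (pred j) ≡ j
      1+j≡ = suc-pred j {{>-nonZero (≤-trans (>-nonZero⁻¹ L) (m≤n+m L (x * (y + d))))}}
      target : fold k ρ (suc (pred j)) ≡ y
      target = begin
        fold k ρ (suc (pred j)) ≡⟨ m%n%n≡m%n (fold k ρ (pred j) + v) L ⟨
        fold k ρ (suc (pred j)) % L ≡⟨ ρ-fold (suc (pred j)) ⟩
        (k + suc (pred j) * v) % L ≡⟨ cong (λ z → (k + z * v) % L) 1+j≡ ⟩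
        (k + j * v) % L ≡⟨ cong (_% L) (solve 6 (λ k x y d L v → k :+ (x :* (y :+ d) :+ L) :* v := (k :+ (y :+ d) :* (x :* v)) :+ v :* L) refl k x y d L v) ⟩
        (k + (y + d) * (x * v) + v * L) % L ≡⟨ [m+kn]%n≡m%n (k + (y + d) * (x * v)) v L ⟩
        (k + (y + d) * (x * v)) % L ≡⟨ cong (λ z → (k + (y + d) * z) % L) xv≡1+qL ⟩
        (k + (y + d) * (1 + q * L)) % L ≡⟨ cong (_% L) (solve 5 (λ k y d q L → k :+ (y :+ d) :* (con 1 :+ q :* L) := y :+ (k :+ d) :+ (y :+ d) :* q :* L) refl k y d q L) ⟩
        (y + (k + d) + (y + d) * q * L) % L ≡⟨ [m+kn]%n≡m%n (y + (k + d)) ((y + d) * q) L ⟩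
        (y + (k + d)) % L ≡⟨ cong (λ z → (y + z) % L) (m+[n∸m]≡n (<⇒≤ k<L)) ⟩
        (y + L) % L ≡⟨ [m+n]%n≡m%n y L ⟩
        y % L ≡⟨ m<n⇒m%n≡m (≤-<-trans y≤k k<L) ⟩
        y ∎
      conclude : (∃[ i ] fold k ρ (suc (pred j)) ≡ fold k T (suc i)) ⊎
               (∃[ i ] fold k ρ (suc (pred j)) ≡ ρ (fold k T i) × k < fold k ρ (suc (pred j))) →
               ∃[ i ] fold k T (suc i) ≡ y
      conclude (inj₁ (i , eq))     = i , trans (sym eq) target
      conclude (inj₂ (i , _ , k<)) = contradiction y≤k (<⇒≱ (subst (k <_) target k<))

-- Finite rational sums

module Sums where

  open import Algebra.Bundles using (CommutativeRing)
  open import Data.Fin.Base using (toℕ)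
  open import Data.Fin.Properties using (toℕ<n)
  open import Data.Nat.Base as ℕ using (ℕ; zero; suc)
  import Data.Nat.Properties as ℕ
  open import Data.Rational.Base
  open import Data.Rational.Properties
  open import Data.Rational.Solver using (module +-*-Solver)
  open import Algebra.Properties.Semiring.Sum
    (CommutativeRing.semiring +-*-commutativeRing)
    using (sum; sum-cong-≗; sum-replicate-zero; ∑-distrib-+; *-distribˡ-sum)
  open +-*-Solver using (solve; _:=_; _:+_; _:-_)

  sumTo : ℕ → (ℕ → ℚ) → ℚ
  sumTo n f = sum {n} (λ i → f (toℕ i))

  sumTo-cong : ∀ n {f g} → (∀ i → i ℕ.< n → f i ≡ g i) → sumTo n f ≡ sumTo n g
  sumTo-cong n eq = sum-cong-≗ (λ i → eq (toℕ i) (toℕ<n i))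

  sumTo-zero : ∀ n {f} → (∀ i → i ℕ.< n → f i ≡ 0ℚ) → sumTo n f ≡ 0ℚ
  sumTo-zero n eq = trans (sumTo-cong n eq) (sum-replicate-zero n)

  sumTo-+ : ∀ n f g → sumTo n (λ i → f i + g i) ≡ sumTo n f + sumTo n g
  sumTo-+ n f g = ∑-distrib-+ {n} (λ i → f (toℕ i)) (λ i → g (toℕ i))

  sumTo-* : ∀ n c f → sumTo n (λ i → c * f i) ≡ c * sumTo n f
  sumTo-* n c f = sym (*-distribˡ-sum {n} c (λ i → f (toℕ i)))

  sumTo-neg : ∀ n f → sumTo n (λ i → - f i) ≡ - sumTo n f
  sumTo-neg zero    f = refl
  sumTo-neg (suc n) f = trans (cong (λ z → - f 0 + z) (sumTo-neg n (λ i → f (suc i))))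
    (sym (neg-distrib-+ (f 0) (sumTo n (λ i → f (suc i)))))

  sumTo-- : ∀ n f g → sumTo n (λ i → f i - g i) ≡ sumTo n f - sumTo n g
  sumTo-- n f g = trans (sumTo-+ n f (λ i → - g i)) (cong (sumTo n f +_) (sumTo-neg n g))

  sumTo-split : ∀ m n f → sumTo (m ℕ.+ n) f ≡ sumTo m f + sumTo n (λ i → f (m ℕ.+ i))
  sumTo-split zero    n f = sym (+-identityˡ (sumTo n f))
  sumTo-split (suc m) n f = trans (cong (f 0 +_) (sumTo-split m n (λ i → f (suc i))))
    (sym (+-assoc (f 0) (sumTo m (λ i → f (suc i))) (sumTo n (λ i → f (suc m ℕ.+ i)))))

  sumTo-snoc : ∀ n f → sumTo (suc n) f ≡ sumTo n f + f n
  sumTo-snoc zero    f = +-comm (f 0) 0ℚ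
  sumTo-snoc (suc n) f = trans (cong (f 0 +_) (sumTo-snoc n (λ i → f (suc i))))
    (sym (+-assoc (f 0) (sumTo n (λ i → f (suc i))) (f (suc n))))

  sumTo-shift : ∀ n f i → sumTo n (λ d → f (suc i ℕ.+ d)) + f i ≡ sumTo n (λ d → f (i ℕ.+ d)) + f (i ℕ.+ n)
  sumTo-shift n f i = begin
    sumTo n (λ d → f (suc i ℕ.+ d)) + f i
      ≡⟨ +-comm (sumTo n (λ d → f (suc i ℕ.+ d))) (f i) ⟩
    f i + sumTo n (λ d → f (suc i ℕ.+ d))
      ≡⟨ cong₂ _+_ (cong f (sym (ℕ.+-identityʳ i))) (sumTo-cong n (λ d _ → cong f (sym (ℕ.+-suc i d)))) ⟩
    sumTo (suc n) (λ d → f (i ℕ.+ d))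
      ≡⟨ sumTo-snoc n (λ d → f (i ℕ.+ d)) ⟩
    sumTo n (λ d → f (i ℕ.+ d)) + f (i ℕ.+ n) ∎
    where open ≡-Reasoning

  sumTo-periodic : ∀ n f → (∀ i → f (i ℕ.+ n) ≡ f i) → ∀ i → sumTo n (λ d → f (i ℕ.+ d)) ≡ sumTo n f
  sumTo-periodic n f periodic zero    = refl
  sumTo-periodic n f periodic (suc i) = trans
    (+-cancelʳ (f i) _ _ (trans (sumTo-shift n f i) (cong (sumTo n (λ d → f (i ℕ.+ d)) +_) (periodic i))))
    (sumTo-periodic n f periodic i)
    where
    +-cancelʳ : ∀ z x y → x + z ≡ y + z → x ≡ y
    +-cancelʳ z x y eq = trans (undo x z) (trans (cong (_- z) eq) (sym (undo y z)))
      where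
      undo : ∀ x z → x ≡ x + z - z
      undo = solve 2 (λ x z → x := x :+ z :- z) refl

-- Trivial kernels, and the rows of the band matrix on padded vectors

module Nullity where

  open import Algebra.Bundles using (CommutativeRing)
  open import Data.Bool.Base using (true; false; T)
  open import Data.Unit.Base using (tt)
  open import Data.Fin.Base using (zero; toℕ; fromℕ<)
  open import Data.Fin.Properties using (toℕ<n; toℕ-fromℕ<; fromℕ<-toℕ)
  open import Data.Nat.Base as ℕ using (ℕ; zero; suc)
  import Data.Nat.Properties as ℕ
  import Data.Nat.Solver as ℕ
  open import Data.Rational.Base
  open import Data.Rational.Properties
  open import Data.Rational.Solver using (module +-*-Solver)
  open import Data.Vec.Functional using (Vector)
  open import Algebra.Properties.Semiring.Sum
    (CommutativeRing.semiring +-*-commutativeRing)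
    using (sum-cong-≗; sum-replicate-zero)
  open ℕ.+-*-Solver using () renaming (solve to solveℕ; _:+_ to _⊕_; _:=_ to _⊜_; con to conℕ)
  open +-*-Solver using (solve; _:=_; _:+_; _:*_; _:-_; :-_; con)
  open import Defs
  open Sums
  open ≡-Reasoning

  TrivialKernel : ∀ {m n} → Matrix m n → Set
  TrivialKernel A = ∀ x → Kernel A x → ∀ i → x i ≡ 0ℚ

  basis0⇒trivial : ∀ {m n} (A : Matrix m n) → HasBasis (Kernel A) 0 → TrivialKernel A
  basis0⇒trivial A (b , isBasis) x Ax≡0 i = proj₂ (IsBasis.spanning isBasis x Ax≡0) i

  -- The vectors of a nonempty basis would all vanish, and so would their sum, whose coefficients
  -- are 1.
  trivial⇒basis0 : ∀ {m n d} (A : Matrix m n) → TrivialKernel A → HasBasis (Kernel A) d → d ≡ 0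
  trivial⇒basis0 {d = zero}  A trivial _ = refl
  trivial⇒basis0 {d = suc d} A trivial (b , isBasis) = contradiction
    (independent (λ _ → 1ℚ) (λ i → trans (sum-cong-≗ (λ j →
      trans (*-identityˡ (b j i)) (trivial (b j) (contained j) i))) (sum-replicate-zero (suc d))) zero)
    λ ()
    where open IsBasis isBasis

  nullity≡0⇒trivial : ∀ {m n} (A : Matrix m n) → nullity A ≡ 0 → TrivialKernel A
  nullity≡0⇒trivial A eq = basis0⇒trivial A (subst (HasBasis (Kernel A)) eq (proj₂ (kernelBasis A)))

  trivial⇒nullity≡0 : ∀ {m n} (A : Matrix m n) → TrivialKernel A → nullity A ≡ 0
  trivial⇒nullity≡0 A trivial = trivial⇒basis0 A trivial (proj₂ (kernelBasis A))

  near : ∀ {k d} → 1 ℕ.≤ d → d ℕ.≤ k → diagonalEntry k d ≡ 1ℚ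
  near {k} {suc d} _ d≤k with suc d ℕ.≤ᵇ k in eq
  ... | true  = refl
  ... | false = contradiction (ℕ.≤⇒≤ᵇ d≤k) (subst (λ b → ¬ T b) (sym eq) λ ())

  far : ∀ {k d} → k ℕ.< d → diagonalEntry k d ≡ 0ℚ
  far {k} {suc d} k<d with suc d ℕ.≤ᵇ k in eq
  ... | false = refl
  ... | true  = contradiction (ℕ.≤ᵇ⇒≤ (suc d) k (subst T (sym eq) tt)) (ℕ.<⇒≱ k<d)

  window : ℕ → (ℕ → ℚ) → ℕ → ℚ
  window k y a = sumTo k (λ d → y (a ℕ.+ d))

  entry : ℕ → ℕ → ℕ → ℚ
  entry k a l = diagonalEntry k (l ℕ.∸ a) - diagonalEntry k (a ℕ.∸ l)

  -- The row with diagonal position `i + k` has `k` entries -1 to the left of it, `k` entries 1 to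
  -- the right, and 0 elsewhere. After padding by `k` zeros this is row `i` of the matrix.
  row-windows : ∀ k y i t → sumTo (i ℕ.+ (k ℕ.+ (1 ℕ.+ (k ℕ.+ t)))) (λ l → entry k (i ℕ.+ k) l * y l) ≡
                window k y (suc (i ℕ.+ k)) - window k y i
  row-windows k y i t = begin
    sumTo (i ℕ.+ (k ℕ.+ (1 ℕ.+ (k ℕ.+ t)))) g
      ≡⟨ sumTo-split i _ g ⟩
    sumTo i g + sumTo (k ℕ.+ (1 ℕ.+ (k ℕ.+ t))) (λ d → g (i ℕ.+ d))
      ≡⟨ cong₂ _+_ (sumTo-zero i before) (sumTo-split k _ (λ d → g (i ℕ.+ d))) ⟩
    0ℚ + (sumTo k (λ d → g (i ℕ.+ d)) + (g (i ℕ.+ (k ℕ.+ 0)) + sumTo (k ℕ.+ t) (λ d → g (i ℕ.+ (k ℕ.+ suc d)))))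
      ≡⟨ cong₂ (λ a b → 0ℚ + (a + (g (i ℕ.+ (k ℕ.+ 0)) + b))) lower (sumTo-split k t (λ d → g (i ℕ.+ (k ℕ.+ suc d)))) ⟩
    0ℚ + (- window k y i + (g (i ℕ.+ (k ℕ.+ 0)) + (sumTo k (λ d → g (i ℕ.+ (k ℕ.+ suc d))) +
      sumTo t (λ d → g (i ℕ.+ (k ℕ.+ suc (k ℕ.+ d)))))))
      ≡⟨ cong₂ (λ a b → 0ℚ + (- window k y i + (a + b))) diagonal (cong₂ _+_ upper (sumTo-zero t after)) ⟩
    0ℚ + (- window k y i + (0ℚ + (window k y (suc (i ℕ.+ k)) + 0ℚ)))
      ≡⟨ solve 2 (λ a b → con 0ℚ :+ (:- a :+ (con 0ℚ :+ (b :+ con 0ℚ))) := b :- a) refl (window k y i) (window k y (suc (i ℕ.+ k))) ⟩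
    window k y (suc (i ℕ.+ k)) - window k y i ∎
    where
    g : ℕ → ℚ
    g l = entry k (i ℕ.+ k) l * y l

    entry-lower : ∀ {l} → l ℕ.≤ i ℕ.+ k → entry k (i ℕ.+ k) l ≡ 0ℚ - diagonalEntry k (i ℕ.+ k ℕ.∸ l)
    entry-lower {l} l≤ = cong (λ z → diagonalEntry k z - diagonalEntry k (i ℕ.+ k ℕ.∸ l)) (ℕ.m≤n⇒m∸n≡0 l≤)

    entry-upper : ∀ d → entry k (i ℕ.+ k) (i ℕ.+ (k ℕ.+ suc d)) ≡ diagonalEntry k (suc d) - 0ℚ
    entry-upper d = cong₂ (λ a b → diagonalEntry k a - diagonalEntry k b)
      (trans (cong (ℕ._∸ (i ℕ.+ k)) (sym (ℕ.+-assoc i k (suc d)))) (ℕ.m+n∸m≡n (i ℕ.+ k) (suc d)))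
      (ℕ.m≤n⇒m∸n≡0 (ℕ.+-monoʳ-≤ i (ℕ.m≤m+n k (suc d))))

    before : ∀ l → l ℕ.< i → g l ≡ 0ℚ
    before l l<i = trans (cong (_* y l) (trans (entry-lower (ℕ.≤-trans (ℕ.<⇒≤ l<i) (ℕ.m≤m+n i k)))
      (cong (λ z → 0ℚ - z) (far (ℕ.m+n≤o⇒m≤o∸n (suc k) (ℕ.≤-trans (ℕ.≤-reflexive (sym (ℕ.+-suc k l)))
        (ℕ.≤-trans (ℕ.+-monoʳ-≤ k l<i) (ℕ.≤-reflexive (ℕ.+-comm k i))))))))) (*-zeroˡ (y l))

    lower : sumTo k (λ d → g (i ℕ.+ d)) ≡ - window k y i
    lower = trans (sumTo-cong k (λ d d<k → trans (cong (_* y (i ℕ.+ d))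
        (trans (entry-lower (ℕ.+-monoʳ-≤ i (ℕ.<⇒≤ d<k))) (cong (λ z → 0ℚ - z)
          (near (ℕ.m+n≤o⇒m≤o∸n 1 (ℕ.≤-trans (ℕ.≤-reflexive (sym (ℕ.+-suc i d))) (ℕ.+-monoʳ-≤ i d<k)))
                (ℕ.≤-trans (ℕ.≤-reflexive (ℕ.[m+n]∸[m+o]≡n∸o i k d)) (ℕ.m∸n≤m k d))))))
        (solve 1 (λ y → (con 0ℚ :- con 1ℚ) :* y := :- y) refl (y (i ℕ.+ d)))))
      (sumTo-neg k (λ d → y (i ℕ.+ d)))

    diagonal : g (i ℕ.+ (k ℕ.+ 0)) ≡ 0ℚ
    diagonal = trans (cong (_* y (i ℕ.+ (k ℕ.+ 0))) (trans
        (cong (λ z → entry k (i ℕ.+ k) (i ℕ.+ z)) (ℕ.+-identityʳ k))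
        (cong (λ z → diagonalEntry k z - diagonalEntry k z) (ℕ.n∸n≡0 (i ℕ.+ k)))))
      (*-zeroˡ (y (i ℕ.+ (k ℕ.+ 0))))

    upper : sumTo k (λ d → g (i ℕ.+ (k ℕ.+ suc d))) ≡ window k y (suc (i ℕ.+ k))
    upper = sumTo-cong k λ d d<k → trans
      (cong (_* y (i ℕ.+ (k ℕ.+ suc d))) (trans (entry-upper d) (cong (_- 0ℚ) (near (ℕ.s≤s ℕ.z≤n) d<k))))
      (trans (*-identityˡ _) (cong y (trans (sym (ℕ.+-assoc i k (suc d))) (ℕ.+-suc (i ℕ.+ k) d))))

    after : ∀ e → e ℕ.< t → g (i ℕ.+ (k ℕ.+ suc (k ℕ.+ e))) ≡ 0ℚ
    after e _ = trans (cong (_* y (i ℕ.+ (k ℕ.+ suc (k ℕ.+ e)))) (trans (entry-upper (k ℕ.+ e))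
      (cong (_- 0ℚ) (far (ℕ.s≤s (ℕ.m≤m+n k e)))))) (*-zeroˡ (y (i ℕ.+ (k ℕ.+ suc (k ℕ.+ e)))))

  record Padded (n k : ℕ) (y : ℕ → ℚ) : Set where
    field
      left  : ∀ l → l ℕ.< k → y l ≡ 0ℚ
      right : ∀ l → l ℕ.< k → y (k ℕ.+ (n ℕ.+ l)) ≡ 0ℚ

  -- Padding completes the rows that the borders of the matrix cut off, so all rows take the same
  -- form.
  row-padded : ∀ {n k y} → Padded n k y → ∀ i →
               toeplitz n k i ∙ (λ j → y (k ℕ.+ toℕ j)) ≡ window k y (suc (toℕ i ℕ.+ k)) - window k y (toℕ i)
  row-padded {n} {k} {y} padded i = begin
    toeplitz n k i ∙ (λ j → y (k ℕ.+ toℕ j))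
      ≡⟨ sumTo-cong n (λ j _ → cong (_* y (k ℕ.+ j)) (shifted j)) ⟩
    sumTo n (λ l → g (k ℕ.+ l))
      ≡⟨ solve 1 (λ a → a := con 0ℚ :+ (a :+ con 0ℚ)) refl (sumTo n (λ l → g (k ℕ.+ l))) ⟩
    0ℚ + (sumTo n (λ l → g (k ℕ.+ l)) + 0ℚ)
      ≡⟨ cong₂ (λ a b → a + (sumTo n (λ l → g (k ℕ.+ l)) + b))
           (sumTo-zero k (λ l l<k → vanish l (left l l<k)))
           (sumTo-zero k (λ l l<k → vanish (k ℕ.+ (n ℕ.+ l)) (right l l<k))) ⟨
    sumTo k g + (sumTo n (λ l → g (k ℕ.+ l)) + sumTo k (λ l → g (k ℕ.+ (n ℕ.+ l))))
      ≡⟨ cong (sumTo k g +_) (sumTo-split n k (λ l → g (k ℕ.+ l))) ⟨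
    sumTo k g + sumTo (n ℕ.+ k) (λ l → g (k ℕ.+ l))
      ≡⟨ sumTo-split k (n ℕ.+ k) g ⟨
    sumTo (k ℕ.+ (n ℕ.+ k)) g
      ≡⟨ cong (λ z → sumTo z g) size ⟩
    sumTo (i′ ℕ.+ (k ℕ.+ (1 ℕ.+ (k ℕ.+ t)))) g
      ≡⟨ row-windows k y i′ t ⟩
    window k y (suc (i′ ℕ.+ k)) - window k y i′ ∎
    where
    open Padded padded
    i′ t : ℕ
    i′ = toℕ i
    t = n ℕ.∸ suc i′
    g : ℕ → ℚ
    g l = entry k (i′ ℕ.+ k) l * y l
    vanish : ∀ l → y l ≡ 0ℚ → g l ≡ 0ℚ
    vanish l eq = trans (cong (entry k (i′ ℕ.+ k) l *_) eq) (*-zeroʳ (entry k (i′ ℕ.+ k) l))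
    shifted : ∀ j → diagonalEntry k (j ℕ.∸ i′) - diagonalEntry k (i′ ℕ.∸ j) ≡ entry k (i′ ℕ.+ k) (k ℕ.+ j)
    shifted j = cong₂ (λ a b → diagonalEntry k a - diagonalEntry k b)
      (trans (sym (ℕ.[m+n]∸[m+o]≡n∸o k j i′)) (cong (k ℕ.+ j ℕ.∸_) (ℕ.+-comm k i′)))
      (trans (sym (ℕ.[m+n]∸[m+o]≡n∸o k i′ j)) (cong (ℕ._∸ (k ℕ.+ j)) (ℕ.+-comm k i′)))
    size : k ℕ.+ (n ℕ.+ k) ≡ i′ ℕ.+ (k ℕ.+ (1 ℕ.+ (k ℕ.+ t)))
    size = trans (cong (λ z → k ℕ.+ (z ℕ.+ k)) (sym (ℕ.m+[n∸m]≡n (toℕ<n i))))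
      (solveℕ 3 (λ k i t → k ⊕ ((conℕ 1 ⊕ i ⊕ t) ⊕ k) ⊜ i ⊕ (k ⊕ (conℕ 1 ⊕ (k ⊕ t)))) refl k i′ t)

  extend : ∀ {n} → ℕ → Vector ℚ n → ℕ → ℚ
  extend {n} k x l with k ℕ.≤? l | l ℕ.∸ k ℕ.<? n
  ... | no _  | _      = 0ℚ
  ... | yes _ | no _   = 0ℚ
  ... | yes _ | yes l< = x (fromℕ< l<)

  extend-padded : ∀ {n} k (x : Vector ℚ n) → Padded n k (extend k x)
  extend-padded {n} k x = record { left = left ; right = right }
    where
    left : ∀ l → l ℕ.< k → extend k x l ≡ 0ℚ
    left l l<k with k ℕ.≤? l | l ℕ.∸ k ℕ.<? n
    ... | no _    | _ = refl
    ... | yes k≤l | _ = contradiction k≤l (ℕ.<⇒≱ l<k)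
    right : ∀ l → l ℕ.< k → extend k x (k ℕ.+ (n ℕ.+ l)) ≡ 0ℚ
    right l _ with k ℕ.≤? k ℕ.+ (n ℕ.+ l) | k ℕ.+ (n ℕ.+ l) ℕ.∸ k ℕ.<? n
    ... | no _  | _      = refl
    ... | yes _ | no _   = refl
    ... | yes _ | yes l< = contradiction (subst (ℕ._< n) (ℕ.m+n∸m≡n k (n ℕ.+ l)) l<) (ℕ.≤⇒≯ (ℕ.m≤m+n n l))

  extend-inner : ∀ {n} k (x : Vector ℚ n) j → extend k x (k ℕ.+ toℕ j) ≡ x j
  extend-inner {n} k x j with k ℕ.≤? k ℕ.+ toℕ j | k ℕ.+ toℕ j ℕ.∸ k ℕ.<? n
  ... | no k≰ | _     = contradiction (ℕ.m≤m+n k (toℕ j)) k≰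
  ... | yes _ | no ≮n = contradiction (subst (ℕ._< n) (sym (ℕ.m+n∸m≡n k (toℕ j))) (toℕ<n j)) ≮n
  ... | yes _ | yes l< = cong x (trans (fromℕ<-cong l< (toℕ<n j) (ℕ.m+n∸m≡n k (toℕ j))) (fromℕ<-toℕ j (toℕ<n j)))
    where
    fromℕ<-cong : ∀ {a b n} (a<n : a ℕ.< n) (b<n : b ℕ.< n) → a ≡ b → fromℕ< a<n ≡ fromℕ< b<n
    fromℕ<-cong a<n b<n refl = cong (λ p → fromℕ< p) (ℕ.≤-irrelevant a<n b<n)

-- Vanishing nullity and the orbit of τ

module Graph where

  open import Algebra.Bundles using (CommutativeRing)
  open import Data.Fin.Base using (toℕ; fromℕ<)
  open import Data.Fin.Properties using (toℕ<n; toℕ-fromℕ<)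
  open import Data.Nat.Base as ℕ using (ℕ; zero; suc)
  open import Data.Nat.DivMod as ℕ using (_%_)
  open import Data.Nat.Induction using (<-rec)
  import Data.Nat.Properties as ℕ
  import Data.Nat.Solver as ℕ
  open import Data.Nat.GeneralisedArithmetic using (fold)
  open import Data.Rational.Base
  open import Data.Rational.Properties
  open import Data.Rational.Solver using (module +-*-Solver)
  open import Data.Vec.Functional using (Vector)
  open import Algebra.Properties.Semiring.Sum
    (CommutativeRing.semiring +-*-commutativeRing)
    using (sum-cong-≗)
  open ℕ.+-*-Solver using () renaming (solve to solveℕ; _:+_ to _⊕_; _:=_ to _⊜_; con to conℕ)
  open +-*-Solver using (solve; _:=_; _:+_; _:-_; :-_; con)
  open import Defs
  open Orbits
  open Exchange
  open Duality
  open Sums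
  open Nullity
  open ≡-Reasoning

  p-q≡0⇒p≡q : ∀ {p q} → p - q ≡ 0ℚ → p ≡ q
  p-q≡0⇒p≡q {p} {q} eq = trans (undo p q) (trans (cong (_+ q) eq) (+-identityˡ q))
    where
    undo : ∀ p q → p ≡ p - q + q
    undo = solve 2 (λ p q → p := p :- q :+ q) refl

  module _ (p n : ℕ) (0<n : 0 ℕ.< n) where
    k m : ℕ
    k = suc p
    m = suc k

    -- The residues of `n - 1`, with subtraction avoided by `p = k - 1` and `k = m - 1`.
    r s : ℕ
    r = (n ℕ.+ p) % k
    s = (n ℕ.+ k) % m

    τ : ℕ → ℕ
    τ = shift k r s

    r≤p : r ℕ.≤ p
    r≤p = ℕ.≤-pred (ℕ.m%n<n (n ℕ.+ p) k)

    lag-< : ∀ {x} → x ℕ.< k → lag k r x ℕ.< k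
    lag-< {x} x<k with ℕ.≤-<-connex x r
    ... | inj₁ x≤r = ℕ.s≤s (ℕ.+-cancelʳ-≤ r _ _ (ℕ.≤-trans (ℕ.≤-reflexive (lag-low r≤p x≤r))
                       (ℕ.≤-trans (ℕ.+-monoˡ-≤ p x≤r) (ℕ.≤-reflexive (ℕ.+-comm r p)))))
    ... | inj₂ r<x = ℕ.≤-<-trans (ℕ.≤-trans (ℕ.m≤m+n _ (suc r)) (ℕ.≤-reflexive (lag-high r<x (ℕ.≤-pred x<k)))) x<k

    lag-surjective : ∀ {l} → l ℕ.< k → ∃[ x ] x ℕ.< k × lag k r x ≡ l
    lag-surjective {l} l<k with ℕ.≤-<-connex k (suc r ℕ.+ l)
    ... | inj₂ x<k = suc r ℕ.+ l , x<k , ℕ.+-cancelʳ-≡ (suc r) _ _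
      (trans (lag-high (ℕ.s≤s (ℕ.m≤m+n r l)) (ℕ.≤-pred x<k)) (ℕ.+-comm (suc r) l))
    ... | inj₁ k≤ = x , ℕ.s≤s (ℕ.≤-trans x≤r r≤p) , ℕ.+-cancelʳ-≡ r _ _
      (trans (lag-low r≤p x≤r) (trans x+p≡ (ℕ.+-comm r l)))
      where
      x : ℕ
      x = suc r ℕ.+ l ℕ.∸ k
      x+p≡ : x ℕ.+ p ≡ r ℕ.+ l
      x+p≡ = ℕ.suc-injective (trans (sym (ℕ.+-suc x p)) (ℕ.m∸n+n≡m k≤))
      x≤r : x ℕ.≤ r
      x≤r = ℕ.+-cancelʳ-≤ p x r (ℕ.≤-trans (ℕ.≤-reflexive x+p≡) (ℕ.+-monoʳ-≤ r (ℕ.≤-pred l<k)))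

    -- The right padding occupies the indices `k + (n + l)` with `l < k`. The one congruent to `x`
    -- modulo `k` is congruent to `τ x` modulo `m`, by `window-m`, so a zero there will say
    -- `b (τ x) = b x`.
    window-k : ∀ {x} → x ℕ.< k → (k ℕ.+ (n ℕ.+ lag k r x)) % k ≡ x
    window-k {x} x<k = begin
      (k ℕ.+ (n ℕ.+ l)) % k ≡⟨ cong (_% k) (solveℕ 3 (λ p n l → (conℕ 1 ⊕ p) ⊕ (n ⊕ l) ⊜ conℕ 1 ⊕ l ⊕ (n ⊕ p)) refl p n l) ⟩
      (suc l ℕ.+ (n ℕ.+ p)) % k ≡⟨ cong (λ z → (suc l ℕ.+ z) % k) (ℕ.m≡m%n+[m/n]*n (n ℕ.+ p) k) ⟩
      (suc l ℕ.+ (r ℕ.+ (n ℕ.+ p) ℕ./ k ℕ.* k)) % k ≡⟨ cong (_% k) (ℕ.+-assoc (suc l) r _) ⟨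
      (suc l ℕ.+ r ℕ.+ (n ℕ.+ p) ℕ./ k ℕ.* k) % k ≡⟨ ℕ.[m+kn]%n≡m%n (suc l ℕ.+ r) ((n ℕ.+ p) ℕ./ k) k ⟩
      (suc l ℕ.+ r) % k ≡⟨ main ⟩
      x ∎
      where
      l : ℕ
      l = lag k r x
      main : (suc l ℕ.+ r) % k ≡ x
      main with ℕ.≤-<-connex x r
      ... | inj₁ x≤r = trans (cong (_% k) (trans (cong suc (lag-low r≤p x≤r)) (sym (ℕ.+-suc x p))))
                         (trans (ℕ.[m+n]%n≡m%n x k) (ℕ.m<n⇒m%n≡m x<k))
      ... | inj₂ r<x = trans (cong (_% k) (trans (sym (ℕ.+-suc l r)) (lag-high r<x (ℕ.≤-pred x<k)))) (ℕ.m<n⇒m%n≡m x<k)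

    window-m : ∀ x → (k ℕ.+ (n ℕ.+ lag k r x)) % m ≡ τ x
    window-m x = begin
      (k ℕ.+ (n ℕ.+ l)) % m ≡⟨ cong (_% m) (trans (sym (ℕ.+-assoc k n l)) (cong (ℕ._+ l) (ℕ.+-comm k n))) ⟩
      (n ℕ.+ k ℕ.+ l) % m ≡⟨ ℕ.%-distribˡ-+ (n ℕ.+ k) l m ⟩
      (s ℕ.+ l % m) % m ≡⟨ cong (λ z → (z ℕ.+ l % m) % m) (ℕ.m%n%n≡m%n (n ℕ.+ k) m) ⟨
      (s % m ℕ.+ l % m) % m ≡⟨ ℕ.%-distribˡ-+ s l m ⟨
      (s ℕ.+ l) % m ≡⟨ shift-≡ k r s x ⟨
      τ x ∎
      where
      l : ℕ
      l = lag k r x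

    -- One function `b` serves for both periodic sequences: the zeros of the left padding make them
    -- agree on 0, ..., k - 1.
    potential : (ℕ → ℚ) → ℕ → ℚ
    potential b i = b (i % m) - b (i % k)

    %m-+m : ∀ i → (m ℕ.+ i) % m ≡ i % m
    %m-+m i = trans (cong (_% m) (ℕ.+-comm m i)) (ℕ.[m+n]%n≡m%n i m)

    potential-k : ∀ b → potential b k ≡ b k - b 0
    potential-k b = cong₂ (λ x y → b x - b y) (ℕ.m<n⇒m%n≡m (ℕ.n<1+n k)) (ℕ.n%n≡0 k)

    potential-m : ∀ b {j} → j ℕ.< k → potential b (m ℕ.+ j) ≡ b j - b (suc j % k)
    potential-m b {j} j<k = cong₂ (λ x y → b x - b y)
      (trans (%m-+m j) (ℕ.m<n⇒m%n≡m (ℕ.<-trans j<k (ℕ.n<1+n k))))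
      (trans (cong (_% k) (trans (cong suc (ℕ.+-comm k j)) refl)) (ℕ.[m+n]%n≡m%n (suc j) k))

    module FromKernel (x : Vector ℚ n) (Ax≡0 : Kernel (toeplitz n k) x) where
      y : ℕ → ℚ
      y = extend k x

      open Padded (extend-padded k x)

      windows : ∀ {i} → i ℕ.< n → window k y (suc (i ℕ.+ k)) ≡ window k y i
      windows {i} i<n = p-q≡0⇒p≡q (subst (λ z → window k y (suc (z ℕ.+ k)) - window k y z ≡ 0ℚ) (toℕ-fromℕ< i<n)
        (trans (sym (row-padded (extend-padded k x) (fromℕ< i<n)))
          (trans (sum-cong-≗ {n} (λ j → cong (toeplitz n k (fromℕ< i<n) j *_) (extend-inner k x j))) (Ax≡0 (fromℕ< i<n)))))

      -- Subtracting consecutive rows leaves only the end terms of the windows; the characteristic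
      -- polynomial becomes (t^k - 1)(t^m - 1).
      recurrence : ∀ {i} → suc i ℕ.< n → y (suc (i ℕ.+ k) ℕ.+ k) ≡ y (suc (i ℕ.+ k)) + y (i ℕ.+ k) - y i
      recurrence {i} 1+i<n = eliminate (windows (ℕ.<-trans (ℕ.n<1+n i) 1+i<n)) (windows 1+i<n)
                                       (sumTo-shift k y i) (sumTo-shift k y (suc (i ℕ.+ k)))
        where
        eliminate : ∀ {U₀ U₁ V₀ V₁ a b c d} → V₀ ≡ U₀ → V₁ ≡ U₁ → U₁ + a ≡ U₀ + b → V₁ + c ≡ V₀ + d → d ≡ c + b - a
        eliminate {U₀} {U₁} {a = a} {b} {c} {d} refl refl eq₁ eq₂ = begin
          d ≡⟨ solve 2 (λ u d → d := (u :+ d) :- u) refl U₀ d ⟩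
          (U₀ + d) - U₀ ≡⟨ cong (_- U₀) eq₂ ⟨
          (U₁ + c) - U₀ ≡⟨ solve 4 (λ u v a c → (u :+ c) :- v := (u :+ a) :+ c :- a :- v) refl U₁ U₀ a c ⟩
          (U₁ + a) + c - a - U₀ ≡⟨ cong (λ z → z + c - a - U₀) eq₁ ⟩
          (U₀ + b) + c - a - U₀ ≡⟨ solve 4 (λ u a b c → (u :+ b) :+ c :- a :- u := c :+ b :- a) refl U₀ a b c ⟩
          c + b - a ∎

      -- The solution of `potential b i = y i` for i = k, ..., m + k - 1, normalised by `b 0 = 0`.
      b : ℕ → ℚ
      b j with j ℕ.≟ k
      ... | yes _ = y k
      ... | no _  = - sumTo j (λ d → y (m ℕ.+ d))

      b-k : b k ≡ y k
      b-k with k ℕ.≟ k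
      ... | yes _  = refl
      ... | no k≢k = contradiction refl k≢k

      b-< : ∀ {j} → j ℕ.< k → b j ≡ - sumTo j (λ d → y (m ℕ.+ d))
      b-< {j} j<k with j ℕ.≟ k
      ... | yes refl = contradiction j<k (ℕ.<-irrefl refl)
      ... | no _     = refl

      b-step : ∀ {j} → j ℕ.< k → b j - b (suc j % k) ≡ y (m ℕ.+ j)
      b-step {j} j<k with ℕ.m≤n⇒m<n∨m≡n j<k
      ... | inj₁ 1+j<k = begin
        b j - b (suc j % k) ≡⟨ cong₂ _-_ (b-< j<k) (trans (cong b (ℕ.m<n⇒m%n≡m 1+j<k)) (b-< 1+j<k)) ⟩
        - S j - - S (suc j) ≡⟨ cong (λ z → - S j - - z) (sumTo-snoc j (λ d → y (m ℕ.+ d))) ⟩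
        - S j - - (S j + y (m ℕ.+ j)) ≡⟨ solve 2 (λ s y → :- s :- (:- (s :+ y)) := y) refl (S j) (y (m ℕ.+ j)) ⟩
        y (m ℕ.+ j) ∎
        where
        S : ℕ → ℚ
        S j = sumTo j (λ d → y (m ℕ.+ d))
      ... | inj₂ refl = begin
        b p - b (k % k) ≡⟨ cong₂ _-_ (b-< (ℕ.n<1+n p)) (trans (cong b (ℕ.n%n≡0 k)) (b-< (ℕ.s≤s ℕ.z≤n))) ⟩
        - S p - - 0ℚ ≡⟨ solve 2 (λ s y → :- s :- (:- con 0ℚ) := y :- (s :+ y)) refl (S p) (y (m ℕ.+ p)) ⟩
        y (m ℕ.+ p) - (S p + y (m ℕ.+ p)) ≡⟨ cong (λ z → y (m ℕ.+ p) - z) (trans (sym (sumTo-snoc p (λ d → y (m ℕ.+ d)))) S≡0) ⟩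
        y (m ℕ.+ p) - 0ℚ ≡⟨ solve 1 (λ y → y :- con 0ℚ := y) refl (y (m ℕ.+ p)) ⟩
        y (m ℕ.+ p) ∎
        where
        S : ℕ → ℚ
        S j = sumTo j (λ d → y (m ℕ.+ d))
        -- The wrap from `p` back to 0 is consistent: the first row equates this window with the
        -- left padding.
        S≡0 : S k ≡ 0ℚ
        S≡0 = trans (windows 0<n) (sumTo-zero k left)

      Represented : ℕ → Set
      Represented i = i ℕ.< k ℕ.+ (n ℕ.+ k) → y i ≡ potential b i

      -- The left padding and the choice of `b` settle the first 2k + 1 indices, which is the order
      -- of the recurrence.
      represented : ∀ i → Represented i
      represented = <-rec Represented step
        where
        step : ∀ i → (∀ {j} → j ℕ.< i → Represented j) → Represented i
        step i rec i< with ℕ.<-cmp i k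
        ... | tri< i<k _ _ = begin
          y i ≡⟨ left i i<k ⟩
          0ℚ ≡⟨ +-inverseʳ (b i) ⟨
          b i - b i ≡⟨ cong₂ (λ u v → b u - b v) (ℕ.m<n⇒m%n≡m (ℕ.<-trans i<k (ℕ.n<1+n k))) (ℕ.m<n⇒m%n≡m i<k) ⟨
          potential b i ∎
        ... | tri≈ _ refl _ = begin
          y k ≡⟨ solve 1 (λ y → y := y :- (:- con 0ℚ)) refl (y k) ⟩
          y k - - 0ℚ ≡⟨ cong₂ _-_ b-k (b-< (ℕ.s≤s ℕ.z≤n)) ⟨
          b k - b 0 ≡⟨ potential-k b ⟨
          potential b k ∎
        ... | tri> _ _ k<i with ℕ.≤-<-connex k (i ℕ.∸ m)
        ...   | inj₂ j<k = subst (λ z → y z ≡ potential b z) (ℕ.m+[n∸m]≡n k<i) (begin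
          y (m ℕ.+ j) ≡⟨ b-step j<k ⟨
          b j - b (suc j % k) ≡⟨ potential-m b j<k ⟨
          potential b (m ℕ.+ j) ∎)
          where
          j : ℕ
          j = i ℕ.∸ m
        ...   | inj₁ k≤j = subst (λ z → y z ≡ potential b z) i≡ (begin
          y (suc (j ℕ.+ k) ℕ.+ k)
            ≡⟨ recurrence 1+j<n ⟩
          y (suc (j ℕ.+ k)) + y (j ℕ.+ k) - y j
            ≡⟨ cong₂ (λ u v → u - v) (cong₂ _+_ (ih below₂) (ih below₁)) (ih below₀) ⟩
          potential b (suc (j ℕ.+ k)) + potential b (j ℕ.+ k) - potential b j
            ≡⟨ cong₂ _-_ (cong₂ _+_ (cong₂ (λ u v → b u - b v) 1+j+k%m 1+j+k%k) (cong (λ u → b ((j ℕ.+ k) % m) - b u) (ℕ.[m+n]%n≡m%n j k))) refl ⟩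
          (b (j % m) - b (suc j % k)) + (b ((j ℕ.+ k) % m) - b (j % k)) - (b (j % m) - b (j % k))
            ≡⟨ solve 4 (λ c d e f → (c :- d) :+ (e :- f) :- (c :- f) := e :- d) refl (b (j % m)) (b (suc j % k)) (b ((j ℕ.+ k) % m)) (b (j % k)) ⟩
          b ((j ℕ.+ k) % m) - b (suc j % k)
            ≡⟨ cong₂ (λ u v → b u - b v) 1+j+k+k%m (trans (ℕ.[m+n]%n≡m%n (suc j ℕ.+ k) k) 1+j+k%k) ⟨
          potential b (suc (j ℕ.+ k) ℕ.+ k) ∎)
          where
          j : ℕ
          j = i ℕ.∸ m ℕ.∸ k
          1+j+k%m : suc (j ℕ.+ k) % m ≡ j % m
          1+j+k%m = trans (cong (_% m) (sym (ℕ.+-suc j k))) (ℕ.[m+n]%n≡m%n j m)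
          1+j+k%k : suc (j ℕ.+ k) % k ≡ suc j % k
          1+j+k%k = ℕ.[m+n]%n≡m%n (suc j) k
          1+j+k+k%m : (suc (j ℕ.+ k) ℕ.+ k) % m ≡ (j ℕ.+ k) % m
          1+j+k+k%m = trans (cong (_% m) (sym (ℕ.+-suc (j ℕ.+ k) k))) (ℕ.[m+n]%n≡m%n (j ℕ.+ k) m)
          i≡ : suc (j ℕ.+ k) ℕ.+ k ≡ i
          i≡ = trans (cong (λ z → suc z ℕ.+ k) (ℕ.m∸n+n≡m k≤j)) (trans (sym (ℕ.+-suc (i ℕ.∸ m) k)) (ℕ.m∸n+n≡m k<i))
          1+j<n : suc j ℕ.< n
          1+j<n = ℕ.+-cancelʳ-< (k ℕ.+ k) (suc j) n (subst₂ ℕ._<_ (trans (sym i≡) (ℕ.+-assoc (suc j) k k))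
            (trans (ℕ.+-comm k (n ℕ.+ k)) (ℕ.+-assoc n k k)) i<)
          below₂ : suc (j ℕ.+ k) ℕ.< i
          below₂ = subst (suc (j ℕ.+ k) ℕ.<_) i≡ (ℕ.m<m+n (suc (j ℕ.+ k)) (ℕ.s≤s ℕ.z≤n))
          below₁ : j ℕ.+ k ℕ.< i
          below₁ = ℕ.<-trans (ℕ.n<1+n (j ℕ.+ k)) below₂
          below₀ : j ℕ.< i
          below₀ = ℕ.≤-<-trans (ℕ.m≤m+n j k) below₁
          ih : ∀ {l} → l ℕ.< i → y l ≡ potential b l
          ih l<i = rec l<i (ℕ.<-trans l<i i<)

      b-invariant : ∀ {x} → x ℕ.< k → b (τ x) ≡ b x
      b-invariant {x} x<k = p-q≡0⇒p≡q (begin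
        b (τ x) - b x ≡⟨ cong₂ (λ u v → b u - b v) (window-m x) (window-k x<k) ⟨
        potential b (k ℕ.+ (n ℕ.+ lag k r x)) ≡⟨ represented _ (ℕ.+-monoʳ-< k (ℕ.+-monoʳ-< n (lag-< x<k))) ⟨
        y (k ℕ.+ (n ℕ.+ lag k r x)) ≡⟨ right (lag k r x) (lag-< x<k) ⟩
        0ℚ ∎)

      module _ (covers : Covers k τ) where
        open Label (shift-closed k r s) covers

        -- Invariance is available except at `k`, and `k` comes last in the orbit, so no step has to
        -- start there.
        b-orbit : ∀ i → i ℕ.≤ k → b (position i) ≡ b (position 0)
        b-orbit zero    _   = refl
        b-orbit (suc i) i<k = trans (b-invariant (ℕ.≤∧≢⇒< (orbit≤ (shift-closed k r s) i)
            (λ eq → ℕ.<⇒≢ i<k (position-injective (ℕ.<⇒≤ i<k) ℕ.≤-refl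
              (trans eq (sym (orbit-return (shift-closed k r s) covers)))))))
          (b-orbit i (ℕ.<⇒≤ i<k))

        b-constant : ∀ {j} → j ℕ.≤ k → b j ≡ b (position 0)
        b-constant {j} j≤k = trans (cong b (sym (position-time j≤k))) (b-orbit (time j) (time≤ j j≤k))

        x≡0 : ∀ i → x i ≡ 0ℚ
        x≡0 i = begin
          x i ≡⟨ extend-inner k x i ⟨
          y l ≡⟨ represented l (ℕ.+-monoʳ-< k (ℕ.≤-trans (toℕ<n i) (ℕ.m≤m+n n k))) ⟩
          b (l % m) - b (l % k) ≡⟨ cong₂ _-_ (b-constant (ℕ.≤-pred (ℕ.m%n<n l m))) (b-constant (ℕ.<⇒≤ (ℕ.m%n<n l k))) ⟩
          b (position 0) - b (position 0) ≡⟨ +-inverseʳ (b (position 0)) ⟩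
          0ℚ ∎
          where
          l : ℕ
          l = k ℕ.+ toℕ i

    module FromInvariant (b : ℕ → ℚ) (invariant : ∀ {x} → x ℕ.< k → b (τ x) ≡ b x) where
      y : ℕ → ℚ
      y = potential b

      padded : Padded n k y
      padded = record { left = left ; right = right }
        where
        left : ∀ l → l ℕ.< k → y l ≡ 0ℚ
        left l l<k = trans (cong₂ (λ u v → b u - b v) (ℕ.m<n⇒m%n≡m (ℕ.<-trans l<k (ℕ.n<1+n k))) (ℕ.m<n⇒m%n≡m l<k))
                           (+-inverseʳ (b l))
        right : ∀ l → l ℕ.< k → y (k ℕ.+ (n ℕ.+ l)) ≡ 0ℚ
        right l l<k with lag-surjective l<k
        ... | x , x<k , refl = trans (cong₂ (λ u v → b u - b v) (window-m x) (window-k x<k))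
          (trans (cong (_- b x) (invariant x<k)) (+-inverseʳ (b x)))

      bᵐ bᵏ : ℕ → ℚ
      bᵐ i = b (i % m)
      bᵏ i = b (i % k)

      windowᵏ : ∀ i → window k bᵏ i ≡ sumTo k bᵏ
      windowᵏ = sumTo-periodic k bᵏ (λ i → cong b (ℕ.[m+n]%n≡m%n i k))

      windowᵐ : ∀ i → window k bᵐ i + bᵐ (i ℕ.+ k) ≡ sumTo m bᵐ
      windowᵐ i = trans (sym (sumTo-snoc k (λ d → bᵐ (i ℕ.+ d))))
        (sumTo-periodic m bᵐ (λ i → cong b (ℕ.[m+n]%n≡m%n i m)) i)

      -- A window of length `k` has constant sum for the k-periodic part. For the m-periodic part it
      -- misses one entry of a full period, and the shift by `m` leaves that entry unchanged.
      window-shift : ∀ i → window k y (suc (i ℕ.+ k)) ≡ window k y i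
      window-shift i = begin
        window k y i′ ≡⟨ sumTo-- k (λ d → bᵐ (i′ ℕ.+ d)) (λ d → bᵏ (i′ ℕ.+ d)) ⟩
        window k bᵐ i′ - window k bᵏ i′ ≡⟨ cong₂ _-_ (cancel (window k bᵐ i′) (window k bᵐ i) (trans (windowᵐ i′) (sym (windowᵐ i))) same) (trans (windowᵏ i′) (sym (windowᵏ i))) ⟩
        window k bᵐ i - window k bᵏ i ≡⟨ sumTo-- k (λ d → bᵐ (i ℕ.+ d)) (λ d → bᵏ (i ℕ.+ d)) ⟨
        window k y i ∎
        where
        i′ : ℕ
        i′ = suc (i ℕ.+ k)
        same : bᵐ (i′ ℕ.+ k) ≡ bᵐ (i ℕ.+ k)
        same = cong b (trans (cong (_% m) (sym (ℕ.+-suc (i ℕ.+ k) k))) (ℕ.[m+n]%n≡m%n (i ℕ.+ k) m))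
        cancel : ∀ u v {c d} → u + c ≡ v + d → c ≡ d → u ≡ v
        cancel u v {c} eq refl = p-q≡0⇒p≡q (trans (solve 3 (λ u v c → u :- v := (u :+ c) :- (v :+ c)) refl u v c)
          (trans (cong (_- (v + c)) eq) (+-inverseʳ (v + c))))

      inKernel : Kernel (toeplitz n k) (λ j → y (k ℕ.+ toℕ j))
      inKernel i = trans (row-padded padded i)
        (trans (cong (_- window k y (toℕ i)) (window-shift (toℕ i))) (+-inverseʳ (window k y (toℕ i))))

      module _ (trivial : TrivialKernel (toeplitz n k)) where
        y≡0 : ∀ {l} → l ℕ.< n ℕ.+ k → y (k ℕ.+ l) ≡ 0ℚ
        y≡0 {l} l<n+k with ℕ.≤-<-connex n l
        ... | inj₂ l<n = trans (cong (λ z → y (k ℕ.+ z)) (sym (toℕ-fromℕ< l<n)))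
                           (trivial (λ j → y (k ℕ.+ toℕ j)) inKernel (fromℕ< l<n))
        ... | inj₁ n≤l = trans (cong (λ z → y (k ℕ.+ z)) (sym (ℕ.m+[n∸m]≡n n≤l)))
          (Padded.right padded (l ℕ.∸ n) (ℕ.+-cancelˡ-< n _ _ (subst (ℕ._< n ℕ.+ k) (sym (ℕ.m+[n∸m]≡n n≤l)) l<n+k)))

        b-last : b k ≡ b 0
        b-last = p-q≡0⇒p≡q (trans (sym (potential-k b)) (trans (cong y (sym (ℕ.+-identityʳ k)))
          (y≡0 (ℕ.≤-trans 0<n (ℕ.m≤m+n n k)))))

        b-suc : ∀ {j} → suc j ℕ.< k → b j ≡ b (suc j)
        b-suc {j} 1+j<k = p-q≡0⇒p≡q (begin
          b j - b (suc j) ≡⟨ cong (λ z → b j - b z) (ℕ.m<n⇒m%n≡m 1+j<k) ⟨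
          b j - b (suc j % k) ≡⟨ potential-m b j<k ⟨
          y (m ℕ.+ j) ≡⟨ cong y (ℕ.+-suc k j) ⟨
          y (k ℕ.+ suc j) ≡⟨ y≡0 (ℕ.≤-trans 1+j<k (ℕ.m≤n+m k n)) ⟩
          0ℚ ∎)
          where
          j<k : j ℕ.< k
          j<k = ℕ.<-trans (ℕ.n<1+n j) 1+j<k

        b-first : ∀ j → j ℕ.< k → b j ≡ b 0
        b-first zero    _   = refl
        b-first (suc j) 1+j<k = trans (sym (b-suc 1+j<k)) (b-first j (ℕ.<-trans (ℕ.n<1+n j) 1+j<k))

        constant : ∀ {j} → j ℕ.≤ k → b j ≡ b 0
        constant {j} j≤k with ℕ.m≤n⇒m<n∨m≡n j≤k
        ... | inj₁ j<k  = b-first j j<k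
        ... | inj₂ refl = b-last

    τ-injective : ∀ {x y} → x ℕ.< k → y ℕ.≤ k → τ x ≡ τ y → x ≡ y
    τ-injective {x} {y} x<k y≤k eq with ℕ.m≤n⇒m<n∨m≡n y≤k
    ... | inj₁ y<k = trans (sym (window-k x<k)) (trans (cong (λ z → (k ℕ.+ (n ℕ.+ z)) % k) same) (window-k y<k))
      where
      same : lag k r x ≡ lag k r y
      same = %-cancelˡ s (ℕ.<⇒≤ (lag-< x<k)) (ℕ.<⇒≤ (lag-< y<k)) (trans (sym (shift-≡ k r s x)) (trans eq (shift-≡ k r s y)))
    ... | inj₂ refl = contradiction
      (%-cancelˡ s (ℕ.<⇒≤ (lag-< x<k)) ℕ.≤-refl (trans (sym (shift-≡ k r s x)) (trans eq (shift-last k r s))))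
      (ℕ.<⇒≢ (lag-< x<k))

    Reached : ℕ → Set
    Reached j = ∃[ i ] i ℕ.< m × orbit (shift-closed k r s) i ≡ j

    reached? : ∀ j → Dec (Reached j)
    reached? j = ℕ.anyUpTo? (λ i → orbit (shift-closed k r s) i ℕ.≟ j) m

    reached : ∀ i → Reached (orbit (shift-closed k r s) i)
    reached i = pack (early (shift-closed k r s) i)
      where
      pack : ∃[ j ] j ℕ.≤ k × orbit (shift-closed k r s) j ≡ orbit (shift-closed k r s) i →
             Reached (orbit (shift-closed k r s) i)
      pack (j , j≤k , eq) = j , ℕ.s≤s j≤k , eq

    reached-step : ∀ {x} → Reached x → Reached (τ x)
    reached-step (i , _ , refl) = reached (suc i)

    -- By injectivity of τ the preimage of an orbit point is the previous orbit point; for the first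
    -- one, `τ k`, it would be `k`.
    reached-back : ∀ {x} → x ℕ.< k → Reached (τ x) → Reached x
    reached-back x<k (zero , _ , eq) = contradiction (τ-injective x<k ℕ.≤-refl (sym eq)) (ℕ.<⇒≢ x<k)
    reached-back x<k (suc i , _ , eq) =
      subst Reached (sym (τ-injective x<k (orbit≤ (shift-closed k r s) i) (sym eq))) (reached i)

    indicator : ℕ → ℚ
    indicator j with reached? j
    ... | yes _ = 1ℚ
    ... | no _  = 0ℚ

    indicator-yes : ∀ {j} → Reached j → indicator j ≡ 1ℚ
    indicator-yes {j} reach with reached? j
    ... | yes _ = refl
    ... | no ¬r = contradiction reach ¬r

    indicator-no : ∀ {j} → ¬ Reached j → indicator j ≡ 0ℚ
    indicator-no {j} ¬r with reached? j
    ... | yes reach = contradiction reach ¬r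
    ... | no _      = refl

    indicator-invariant : ∀ {x} → x ℕ.< k → indicator (τ x) ≡ indicator x
    indicator-invariant {x} x<k = helper (reached? x)
      where
      helper : Dec (Reached x) → indicator (τ x) ≡ indicator x
      helper (yes reach) = trans (indicator-yes (reached-step reach)) (sym (indicator-yes reach))
      helper (no ¬r)     = trans (indicator-no (λ reach → ¬r (reached-back x<k reach))) (sym (indicator-no ¬r))

    covers⇒nullity≡0 : Covers k τ → nullity (toeplitz n k) ≡ 0
    covers⇒nullity≡0 covers = trivial⇒nullity≡0 (toeplitz n k) (λ x Ax≡0 → FromKernel.x≡0 x Ax≡0 covers)

    -- The indicator of the orbit is invariant, hence constant when the kernel is trivial, and it is
    -- 1 at `τ k`.
    nullity≡0⇒covers : nullity (toeplitz n k) ≡ 0 → Covers k τ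
    nullity≡0⇒covers eq y y≤k = helper (reached? y)
      where
      constant : ∀ {j} → j ℕ.≤ k → indicator j ≡ indicator 0
      constant = FromInvariant.constant indicator indicator-invariant (nullity≡0⇒trivial (toeplitz n k) eq)
      helper : Dec (Reached y) → ∃[ i ] fold k τ (suc i) ≡ y
      helper (yes (i , _ , eqᵢ)) = i , eqᵢ
      helper (no ¬r) = contradiction (begin
        0ℚ ≡⟨ indicator-no ¬r ⟨
        indicator y ≡⟨ constant y≤k ⟩
        indicator 0 ≡⟨ constant (shift-closed k r s k ℕ.≤-refl) ⟨
        indicator (τ k) ≡⟨ indicator-yes (reached 0) ⟩
        1ℚ ∎) λ ()

-- Pairs in a triangle, sorted by gcd

module Farey where

  open import Data.Fin.Base using (Fin)
  open import Data.Fin.Properties using (injective⇒≤)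
  open import Data.List.Base using (List; []; _∷_; _++_; length; lookup; filter; concat; applyUpTo)
  open import Data.List.Membership.Propositional using (_∈_)
  open import Data.List.Membership.Propositional.Properties
  open import Data.List.Properties using (length-++; length-applyUpTo; length-filter; filter-accept; filter-reject)
  open import Data.List.Relation.Unary.All as All using (All; []; _∷_)
  import Data.List.Relation.Unary.All.Properties as All
  import Data.List.Relation.Unary.AllPairs as AllPairs
  import Data.List.Relation.Unary.AllPairs.Properties as AllPairs
  open import Data.List.Relation.Unary.Any using (index)
  open import Data.List.Relation.Unary.Any.Properties using (lookup-index)
  open import Data.List.Relation.Unary.Unique.Propositional using (Unique)
  import Data.List.Relation.Unary.Unique.Propositional.Properties as Unique
  open import Data.Nat.Base
  open import Data.Nat.Divisibility using (divides)
  open import Data.Nat.DivMod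
  open import Data.Nat.GCD
  open import Data.Nat.Properties
  open import Data.Nat.Solver using (module +-*-Solver)
  open import Data.Product.Properties using (,-injectiveʳ)
  open +-*-Solver

  lookup-injective : ∀ {A : Set} {xs : List A} → Unique xs → ∀ i j → lookup xs i ≡ lookup xs j → i ≡ j
  lookup-injective (_ AllPairs.∷ _)  Fin.zero    Fin.zero    _  = refl
  lookup-injective (x≢ AllPairs.∷ _) Fin.zero    (Fin.suc j) eq = contradiction eq (All.lookup x≢ (∈-lookup j))
  lookup-injective (x≢ AllPairs.∷ _) (Fin.suc i) Fin.zero    eq = contradiction (sym eq) (All.lookup x≢ (∈-lookup i))
  lookup-injective (_ AllPairs.∷ u)  (Fin.suc i) (Fin.suc j) eq = cong Fin.suc (lookup-injective u i j eq)

  module _ {A B : Set} (R : A → B → Set) {xs : List A} {ys : List B} where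

    -- Stated for a relation, because the image of an element comes out of an existence proof.
    injection-length : Unique xs → (∀ {x} → x ∈ xs → ∃[ y ] y ∈ ys × R x y) →
                       (∀ {x x′ y} → x ∈ xs → x′ ∈ xs → R x y → R x′ y → x ≡ x′) → length xs ≤ length ys
    injection-length unique total injective = injective⇒≤ {f = f} λ {i} {j} eq →
      lookup-injective unique i j (injective (∈-lookup i) (∈-lookup j) (related i)
        (subst (R (lookup xs j)) (sym (image-≡ i j eq)) (related j)))
      where
      image : Fin (length xs) → B
      image i = proj₁ (total (∈-lookup i))
      image∈ : ∀ i → image i ∈ ys
      image∈ i = proj₁ (proj₂ (total (∈-lookup i)))
      related : ∀ i → R (lookup xs i) (image i)
      related i = proj₂ (proj₂ (total (∈-lookup i)))
      f : Fin (length xs) → Fin (length ys)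
      f i = index (image∈ i)
      image-≡ : ∀ i j → f i ≡ f j → image i ≡ image j
      image-≡ i j eq = trans (lookup-index (image∈ i)) (trans (cong (lookup ys) eq) (sym (lookup-index (image∈ j))))

  sumℕ : ℕ → (ℕ → ℕ) → ℕ
  sumℕ zero    f = 0
  sumℕ (suc n) f = f 0 + sumℕ n (λ i → f (suc i))

  sumℕ-cong : ∀ n {f g} → (∀ i → i < n → f i ≡ g i) → sumℕ n f ≡ sumℕ n g
  sumℕ-cong zero    eq = refl
  sumℕ-cong (suc n) eq = cong₂ _+_ (eq 0 (s≤s z≤n)) (sumℕ-cong n (λ i i<n → eq (suc i) (s≤s i<n)))

  sumℕ-+ : ∀ n f g → sumℕ n (λ i → f i + g i) ≡ sumℕ n f + sumℕ n g
  sumℕ-+ zero    f g = refl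
  sumℕ-+ (suc n) f g = trans (cong (f 0 + g 0 +_) (sumℕ-+ n (λ i → f (suc i)) (λ i → g (suc i))))
    (solve 4 (λ a b c d → (a :+ b) :+ (c :+ d) := (a :+ c) :+ (b :+ d)) refl (f 0) (g 0) (sumℕ n (λ i → f (suc i))) (sumℕ n (λ i → g (suc i))))

  sumℕ-zero : ∀ n → sumℕ n (λ _ → 0) ≡ 0
  sumℕ-zero zero    = refl
  sumℕ-zero (suc n) = sumℕ-zero n

  Pairs : Set
  Pairs = List (ℕ × ℕ)

  pairGcd : ℕ × ℕ → ℕ
  pairGcd (u , v) = gcd u v

  withGcd : ℕ → Pairs → Pairs
  withGcd d = filter (λ x → pairGcd x ≟ d)

  indicator : ℕ → ℕ → ℕ
  indicator a d with a ≟ d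
  ... | yes _ = 1
  ... | no _  = 0

  indicator-≢ : ∀ {a d} → a ≢ d → indicator a d ≡ 0
  indicator-≢ {a} {d} a≢d with a ≟ d
  ... | yes a≡d = contradiction a≡d a≢d
  ... | no _    = refl

  indicator-≡ : ∀ {a d} → a ≡ d → indicator a d ≡ 1
  indicator-≡ {a} {d} a≡d with a ≟ d
  ... | yes _  = refl
  ... | no a≢d = contradiction a≡d a≢d

  indicator-suc : ∀ a d → indicator (suc a) (suc d) ≡ indicator a d
  indicator-suc a d with a ≟ d
  ... | yes a≡d = indicator-≡ (cong suc a≡d)
  ... | no a≢d  = indicator-≢ (λ eq → a≢d (suc-injective eq))

  sumℕ-indicator : ∀ {a m} → a < m → sumℕ m (indicator a) ≡ 1
  sumℕ-indicator {zero}  {suc m} _         = cong suc (trans (sumℕ-cong m (λ i _ → indicator-≢ {0} {suc i} (λ ()))) (sumℕ-zero m))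
  sumℕ-indicator {suc a} {suc m} (s≤s a<m) = trans (sumℕ-cong m (λ i _ → indicator-suc a i)) (sumℕ-indicator a<m)

  length-withGcd : ∀ d x xs → length (withGcd d (x ∷ xs)) ≡ indicator (pairGcd x) d + length (withGcd d xs)
  length-withGcd d x xs = helper (pairGcd x ≟ d)
    where
    P? : ∀ y → Dec (pairGcd y ≡ d)
    P? y = pairGcd y ≟ d
    helper : Dec (pairGcd x ≡ d) → length (withGcd d (x ∷ xs)) ≡ indicator (pairGcd x) d + length (withGcd d xs)
    helper (yes eq) = trans (cong length (filter-accept P? {x} {xs} eq)) (cong (_+ length (withGcd d xs)) (sym (indicator-≡ eq)))
    helper (no ≢d)  = trans (cong length (filter-reject P? {x} {xs} ≢d)) (cong (_+ length (withGcd d xs)) (sym (indicator-≢ ≢d)))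

  partition-gcd : ∀ m xs → All (λ x → 1 ≤ pairGcd x × pairGcd x ≤ m) xs →
                  sumℕ m (λ d → length (withGcd (suc d) xs)) ≡ length xs
  partition-gcd m []       []                    = sumℕ-zero m
  partition-gcd m (x ∷ xs) ((1≤g , g≤m) ∷ bounds) = begin
    sumℕ m (λ d → length (withGcd (suc d) (x ∷ xs)))
      ≡⟨ sumℕ-cong m (λ d _ → length-withGcd (suc d) x xs) ⟩
    sumℕ m (λ d → indicator (pairGcd x) (suc d) + length (withGcd (suc d) xs))
      ≡⟨ sumℕ-+ m (λ d → indicator (pairGcd x) (suc d)) (λ d → length (withGcd (suc d) xs)) ⟩
    sumℕ m (λ d → indicator (pairGcd x) (suc d)) + sumℕ m (λ d → length (withGcd (suc d) xs))
      ≡⟨ cong₂ _+_ one (partition-gcd m xs bounds) ⟩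
    suc (length xs) ∎
    where
    open ≡-Reasoning
    1+g-1≡g : suc (pred (pairGcd x)) ≡ pairGcd x
    1+g-1≡g = suc-pred (pairGcd x) {{>-nonZero 1≤g}}
    one : sumℕ m (λ d → indicator (pairGcd x) (suc d)) ≡ 1
    one = trans (sumℕ-cong m (λ d _ → trans (cong (λ z → indicator z (suc d)) (sym 1+g-1≡g)) (indicator-suc (pred (pairGcd x)) d)))
      (sumℕ-indicator (subst (_≤ m) (sym 1+g-1≡g) g≤m))

  row : ℕ → ℕ → Pairs
  row m u = applyUpTo (λ i → suc u , m ∸ u + i) (suc u)

  upperTriangle : ℕ → Pairs
  upperTriangle m = concat (applyUpTo (row m) m)

  upperTriangle⁻ : ∀ {m u v} → (u , v) ∈ upperTriangle m → 1 ≤ u × u ≤ m × v ≤ m × m < u + v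
  upperTriangle⁻ {m} x∈ with ∈-concat⁻′ (applyUpTo (row m) m) x∈
  ... | _ , x∈row , row∈ with ∈-applyUpTo⁻ (row m) row∈
  ...   | u , u<m , refl with ∈-applyUpTo⁻ (λ i → suc u , m ∸ u + i) x∈row
  ...     | i , i<1+u , refl = s≤s z≤n , u<m ,
    ≤-trans (+-monoʳ-≤ (m ∸ u) (≤-pred i<1+u)) (≤-reflexive (m∸n+n≡m (<⇒≤ u<m))) ,
    s≤s (≤-trans (≤-reflexive (sym (m+[n∸m]≡n (<⇒≤ u<m)))) (+-monoʳ-≤ u (m≤m+n (m ∸ u) i)))

  upperTriangle⁺ : ∀ {m u v} → 1 ≤ u → u ≤ m → v ≤ m → m < u + v → (u , v) ∈ upperTriangle m
  upperTriangle⁺ {m} {suc u} {v} _ u<m v≤m m<u+v = ∈-concat⁺′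
    (subst (λ z → (suc u , z) ∈ row m u) (m+[n∸m]≡n m∸u≤v)
      (∈-applyUpTo⁺ (λ i → suc u , m ∸ u + i) (s≤s (m≤n+o⇒m∸n≤o v (m ∸ u) (≤-trans v≤m (≤-reflexive (sym (m∸n+n≡m (<⇒≤ u<m)))))))))
    (∈-applyUpTo⁺ (row m) u<m)
    where
    m∸u≤v : m ∸ u ≤ v
    m∸u≤v = m≤n+o⇒m∸n≤o m u (≤-pred m<u+v)

  upperTriangle-unique : ∀ m → Unique (upperTriangle m)
  upperTriangle-unique m = Unique.concat⁺
    (All.applyUpTo⁺₂ (row m) m (λ u → Unique.applyUpTo⁺₁ (λ i → suc u , m ∸ u + i) (suc u)
      (λ {i} {j} i<j _ eq → <⇒≢ i<j (+-cancelˡ-≡ (m ∸ u) i j (,-injectiveʳ eq)))))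
    (AllPairs.applyUpTo⁺₁ (row m) m (λ {i} {j} i<j _ {x} (x∈i , x∈j) → <⇒≢ i<j (separate i j x∈i x∈j)))
    where
    separate : ∀ i j {x} → x ∈ row m i → x ∈ row m j → i ≡ j
    separate i j x∈i x∈j with ∈-applyUpTo⁻ (λ l → suc i , m ∸ i + l) x∈i | ∈-applyUpTo⁻ (λ l → suc j , m ∸ j + l) x∈j
    ... | _ , _ , eq₁ | _ , _ , eq₂ = suc-injective (trans (sym (cong proj₁ eq₁)) (cong proj₁ eq₂))

  length-upperTriangle : ∀ m → 2 * length (upperTriangle m) ≡ m * m + m
  length-upperTriangle m = trans (rows m (row m) 0 (λ i → trans (length-applyUpTo (λ l → suc i , m ∸ i + l) (suc i)) (sym (+-identityʳ (suc i))))) (+-identityʳ (m * m + m))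
    where
    open ≡-Reasoning
    -- `c` is the number of rows already removed, by which the remaining rows are longer.
    rows : ∀ n (f : ℕ → Pairs) c → (∀ i → length (f i) ≡ suc i + c) →
           2 * length (concat (applyUpTo f n)) ≡ n * n + n + c * n * 2
    rows zero    f c lengths = cong (_* 2) (sym (*-zeroʳ c))
    rows (suc n) f c lengths = begin
      2 * length (f 0 ++ concat (applyUpTo (λ i → f (suc i)) n))
        ≡⟨ cong (2 *_) (length-++ (f 0)) ⟩
      2 * (length (f 0) + length (concat (applyUpTo (λ i → f (suc i)) n)))
        ≡⟨ *-distribˡ-+ 2 (length (f 0)) _ ⟩
      2 * length (f 0) + 2 * length (concat (applyUpTo (λ i → f (suc i)) n))
        ≡⟨ cong₂ (λ a b → 2 * a + b) (lengths 0) (rows n (λ i → f (suc i)) (suc c) (λ i → trans (lengths (suc i)) (cong suc (sym (+-suc i c))))) ⟩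
      2 * (1 + c) + (n * n + n + (1 + c) * n * 2)
        ≡⟨ solve 2 (λ n c → con 2 :* (con 1 :+ c) :+ (n :* n :+ n :+ (con 1 :+ c) :* n :* con 2) :=
             (con 1 :+ n) :* (con 1 :+ n) :+ (con 1 :+ n) :+ c :* (con 1 :+ n) :* con 2) refl n c ⟩
      suc n * suc n + suc n + c * suc n * 2 ∎

  coprimePairs : ℕ → Pairs
  coprimePairs m = withGcd 1 (upperTriangle m)

  -- The number of pairs of neighbours in the Farey sequence of order `m`, that is, φ(1) + ... +
  -- φ(m).
  coprimes : ℕ → ℕ
  coprimes m = length (coprimePairs m)

  coprimes≤ : ∀ m → coprimes m ≤ m * m
  coprimes≤ m = ≤-trans (length-filter _ (upperTriangle m)) (*-cancelˡ-≤ 2 (begin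
    2 * length (upperTriangle m) ≡⟨ length-upperTriangle m ⟩
    m * m + m ≤⟨ +-monoʳ-≤ (m * m) (m≤m*m m) ⟩
    m * m + m * m ≡⟨ cong (m * m +_) (+-identityʳ (m * m)) ⟨
    2 * (m * m) ∎))
    where
    open ≤-Reasoning
    m≤m*m : ∀ m → m ≤ m * m
    m≤m*m zero      = z≤n
    m≤m*m m@(suc _) = m≤m*n m m

  gcd-scale : ∀ u v d → gcd (u * d) (v * d) ≡ gcd u v * d
  gcd-scale u v d = begin
    gcd (u * d) (v * d) ≡⟨ cong₂ gcd (*-comm u d) (*-comm v d) ⟩
    gcd (d * u) (d * v) ≡⟨ c*gcd[m,n]≡gcd[cm,cn] d u v ⟨
    d * gcd u v ≡⟨ *-comm d (gcd u v) ⟩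
    gcd u v * d ∎
    where open ≡-Reasoning

  module _ (m d : ℕ) .{{_ : NonZero d}} where

    private
      Scaled : ℕ × ℕ → ℕ × ℕ → Set
      Scaled (u , v) (u′ , v′) = u ≡ u′ * d × v ≡ v′ * d

      P? : ∀ e (x : ℕ × ℕ) → Dec (pairGcd x ≡ e)
      P? e x = pairGcd x ≟ e

      down : ∀ {x} → x ∈ withGcd d (upperTriangle m) → ∃[ y ] y ∈ coprimePairs (m / d) × Scaled x y
      down {u , v} x∈ with ∈-filter⁻ (P? d) {xs = upperTriangle m} x∈
      ... | x∈Δ , refl with upperTriangle⁻ {m} x∈Δ | gcd[m,n]∣m u v | gcd[m,n]∣n u v
      ...   | 1≤u , u≤m , v≤m , m<u+v | divides u′ u≡ | divides v′ v≡ = (u′ , v′) ,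
        ∈-filter⁺ (P? 1) (upperTriangle⁺ 1≤u′
          (subst (_≤ m / d) (m*n/n≡m u′ d) (/-monoˡ-≤ d (subst (_≤ m) u≡ u≤m)))
          (subst (_≤ m / d) (m*n/n≡m v′ d) (/-monoˡ-≤ d (subst (_≤ m) v≡ v≤m)))
          (m<n*o⇒m/o<n (subst (m <_) (trans (cong₂ _+_ u≡ v≡) (sym (*-distribʳ-+ d u′ v′))) m<u+v)))
          (*-cancelʳ-≡ (gcd u′ v′) 1 d (trans (sym (gcd-scale u′ v′ d))
            (trans (cong₂ gcd (sym u≡) (sym v≡)) (sym (*-identityˡ d))))) ,
        u≡ , v≡
        where
        1≤u′ : 1 ≤ u′
        1≤u′ = n≢0⇒n>0 (λ { refl → m<n⇒n≢0 1≤u u≡ })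

      up : ∀ {y} → y ∈ coprimePairs (m / d) → ∃[ x ] x ∈ withGcd d (upperTriangle m) × Scaled x y
      up {u , v} y∈ with ∈-filter⁻ (P? 1) {xs = upperTriangle (m / d)} y∈
      ... | y∈Δ , g≡1 with upperTriangle⁻ {m / d} y∈Δ
      ...   | 1≤u , u≤ , v≤ , <u+v = (u * d , v * d) ,
        ∈-filter⁺ (P? d) (upperTriangle⁺ (*-mono-≤ 1≤u (>-nonZero⁻¹ d))
          (≤-trans (*-monoˡ-≤ d u≤) (m/n*n≤m m d)) (≤-trans (*-monoˡ-≤ d v≤) (m/n*n≤m m d))
          (begin-strict
            m ≡⟨ m≡m%n+[m/n]*n m d ⟩
            m % d + m / d * d <⟨ +-monoˡ-< (m / d * d) (m%n<n m d) ⟩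
            suc (m / d) * d ≤⟨ *-monoˡ-≤ d <u+v ⟩
            (u + v) * d ≡⟨ *-distribʳ-+ d u v ⟩
            u * d + v * d ∎))
          (trans (gcd-scale u v d) (trans (cong (_* d) g≡1) (*-identityˡ d))) ,
        refl , refl
        where open ≤-Reasoning

    -- Dividing both coordinates by `d` preserves the triangle: m < (u′ + v′) d holds iff u′ + v′
    -- exceeds the floor `m / d`.
    scaled-length : length (withGcd d (upperTriangle m)) ≡ coprimes (m / d)
    scaled-length = ≤-antisym
      (injection-length Scaled (Unique.filter⁺ (P? d) (upperTriangle-unique m)) down
        (λ { _ _ (refl , refl) (refl , refl) → refl }))
      (injection-length (λ y x → Scaled x y) (Unique.filter⁺ (P? 1) (upperTriangle-unique (m / d))) up
        (λ { {u , v} {u′ , v′} _ _ (refl , refl) (eq₁ , eq₂) →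
          cong₂ _,_ (*-cancelʳ-≡ u u′ d eq₁) (*-cancelʳ-≡ v v′ d eq₂) }))

  coprimes-sum : ∀ m → 2 * sumℕ m (λ d → coprimes (m / suc d)) ≡ m * m + m
  coprimes-sum m = begin
    2 * sumℕ m (λ d → coprimes (m / suc d))
      ≡⟨ cong (2 *_) (sumℕ-cong m (λ d _ → scaled-length m (suc d))) ⟨
    2 * sumℕ m (λ d → length (withGcd (suc d) (upperTriangle m)))
      ≡⟨ cong (2 *_) (partition-gcd m (upperTriangle m) (All.tabulate bounds)) ⟩
    2 * length (upperTriangle m)
      ≡⟨ length-upperTriangle m ⟩
    m * m + m ∎
    where
    open ≡-Reasoning
    bounds : ∀ {x} → x ∈ upperTriangle m → 1 ≤ pairGcd x × pairGcd x ≤ m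
    bounds {u , v} x∈ with upperTriangle⁻ {m} x∈
    ... | 1≤u , u≤m , _ , _ = n≢0⇒n>0 (gcd[m,n]≢0 u v (inj₁ (m<n⇒n≢0 1≤u))) ,
      ≤-trans (subst (_≤ u) (gcd-comm v u) (gcd[m,n]≤n v u {{>-nonZero 1≤u}})) u≤m

-- Zeros of the nullity matched with coprime pairs

module Zeros where

  open import Data.Integer.Base using (+_)
  open import Data.List.Base using (List; length; filter; upTo; map; _++_)
  open import Data.List.Membership.Propositional using (_∈_)
  open import Data.List.Membership.Propositional.Properties
  open import Data.List.Relation.Unary.Unique.Propositional using (Unique)
  open import Data.List.Properties using (length-++; length-map; length-upTo)
  import Data.List.Relation.Unary.Unique.Propositional.Properties as Unique
  open import Data.Nat.Base
  open import Data.Nat.Coprimality using (Coprime; coprime⇒gcd≡1; gcd≡1⇒coprime)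
  open import Data.Nat.Divisibility
  open import Data.Nat.DivMod
  open import Data.Nat.GCD using (gcd)
  open import Data.Nat.Properties
  open import Data.Nat.Solver using (module +-*-Solver)
  open import Defs using (period; period-nonZero; N)
  open Exchange
  open Duality
  open Graph using (covers⇒nullity≡0; nullity≡0⇒covers)
  open Farey
  open ≡-Reasoning
  open +-*-Solver

  %-≡⇒∣∸ : ∀ a b c d .{{_ : NonZero d}} → (a + c) % d ≡ (b + c) % d → d ∣ b ∸ a
  %-≡⇒∣∸ a b c d eq = divides ((b + c) / d ∸ (a + c) / d) (begin
    b ∸ a ≡⟨ [m+n]∸[m+o]≡n∸o c b a ⟨
    (c + b) ∸ (c + a) ≡⟨ cong₂ _∸_ (+-comm c b) (+-comm c a) ⟩
    (b + c) ∸ (a + c) ≡⟨ cong₂ _∸_ (m≡m%n+[m/n]*n (b + c) d) (trans (m≡m%n+[m/n]*n (a + c) d) (cong (_+ (a + c) / d * d) eq)) ⟩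
    ((b + c) % d + (b + c) / d * d) ∸ ((b + c) % d + (a + c) / d * d) ≡⟨ [m+n]∸[m+o]≡n∸o ((b + c) % d) _ _ ⟩
    (b + c) / d * d ∸ (a + c) / d * d ≡⟨ *-distribʳ-∸ d ((b + c) / d) ((a + c) / d) ⟨
    ((b + c) / d ∸ (a + c) / d) * d ∎)

  %-%-+ : ∀ a c {P d} .{{_ : NonZero P}} .{{_ : NonZero d}} → d ∣ P → (a % P + c) % d ≡ (a + c) % d
  %-%-+ a c {P} {d} d∣P = begin
    (a % P + c) % d ≡⟨ %-remove-+ʳ (a % P + c) (∣n⇒∣m*n (a / P) d∣P) ⟨
    (a % P + c + a / P * P) % d ≡⟨ cong (_% d) (solve 3 (λ x c q → x :+ c :+ q := x :+ q :+ c) refl (a % P) c (a / P * P)) ⟩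
    (a % P + a / P * P + c) % d ≡⟨ cong (λ z → (z + c) % d) (m≡m%n+[m/n]*n a P) ⟨
    (a + c) % d ∎

  -- From `k ∣ q * suc k = q * k + q` follows `k ∣ q`.
  consecutive-∣ : ∀ {k x} .{{_ : NonZero k}} → k ∣ x → suc k ∣ x → period k ∣ x
  consecutive-∣ {k} k∣x (divides q refl) = subst (_∣ q * suc k) (trans (*-suc k k) (+-comm k (k * k)))
    (*-pres-∣ (∣m+n∣m⇒∣n (subst (k ∣_) (trans (*-suc q k) (+-comm q (q * k))) k∣x) (n∣m*n q)) ∣-refl)

  module _ (p : ℕ) where

    k m P : ℕ
    k = suc p
    m = suc k
    P = period k

    instance
      P-nonZero : NonZero P
      P-nonZero = period-nonZero k

    -- What `representative (+ n) k` computes to, so that `N (+ n) k` is the nullity at this size.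
    size : ℕ → ℕ
    size n = n % P + P

    0<size : ∀ n → 0 < size n
    0<size n = ≤-trans (>-nonZero⁻¹ P) (m≤n+m P (n % P))

    ρ ς : ℕ → ℕ
    ρ n = (size n + p) % k
    ς n = (size n + k) % m

    k∣P : k ∣ P
    k∣P = ∣m∣n⇒∣m+n (n∣m*n k) ∣-refl

    m∣P : m ∣ P
    m∣P = divides k (trans (+-comm (k * k) k) (sym (*-suc k k)))

    size-% : ∀ n c d .{{_ : NonZero d}} → d ∣ P → (size n + c) % d ≡ (n + c) % d
    size-% n c d d∣P = begin
      (n % P + P + c) % d ≡⟨ cong (_% d) (solve 3 (λ x P c → x :+ P :+ c := x :+ c :+ P) refl (n % P) P c) ⟩
      (n % P + c + P) % d ≡⟨ %-remove-+ʳ (n % P + c) d∣P ⟩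
      (n % P + c) % d ≡⟨ %-%-+ n c d∣P ⟩
      (n + c) % d ∎

    residues-≤ : ∀ {n n′} → n′ < P → n ≤ n′ → ρ n ≡ ρ n′ → ς n ≡ ς n′ → n ≡ n′
    residues-≤ {n} {n′} n′<P n≤n′ eqᵏ eqᵐ = ≤-antisym n≤n′ (m∸n≡0⇒m≤n difference≡0)
      where
      divisible : P ∣ n′ ∸ n
      divisible = consecutive-∣
        (%-≡⇒∣∸ n n′ p k (trans (sym (size-% n p k k∣P)) (trans eqᵏ (size-% n′ p k k∣P))))
        (%-≡⇒∣∸ n n′ k m (trans (sym (size-% n k m m∣P)) (trans eqᵐ (size-% n′ k m m∣P))))
      difference≡0 : n′ ∸ n ≡ 0
      difference≡0 = trans (sym (m<n⇒m%n≡m (≤-<-trans (m∸n≤m n′ n) n′<P))) (n∣m⇒m%n≡0 (n′ ∸ n) P divisible)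

    residues-injective : ∀ {n n′} → n < P → n′ < P → ρ n ≡ ρ n′ → ς n ≡ ς n′ → n ≡ n′
    residues-injective {n} {n′} n<P n′<P eqᵏ eqᵐ with ≤-total n n′
    ... | inj₁ n≤n′ = residues-≤ n′<P n≤n′ eqᵏ eqᵐ
    ... | inj₂ n′≤n = sym (residues-≤ n<P n′≤n (sym eqᵏ) (sym eqᵐ))

    -- Chinese remaindering, using k ≡ -1 modulo m.
    residues-surjective : ∀ {r s} → r < k → s ≤ k → ∃[ n ] n < P × ρ n ≡ r × ς n ≡ s
    residues-surjective {r} {s} r<k s≤k = X % P , m%n<n X P ,
      trans (size-% (X % P) p k k∣P) (trans (%-%-+ X p k∣P) (begin
        (suc r + k * w + p) % k ≡⟨ cong (_% k) (solve 4 (λ r k w p → con 1 :+ r :+ k :* w :+ p := r :+ (con 1 :+ p) :+ w :* k) refl r k w p) ⟩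
        (r + k + w * k) % k ≡⟨ [m+kn]%n≡m%n (r + k) w k ⟩
        (r + k) % k ≡⟨ [m+n]%n≡m%n r k ⟩
        r % k ≡⟨ m<n⇒m%n≡m r<k ⟩
        r ∎)) ,
      trans (size-% (X % P) k m m∣P) (trans (%-%-+ X k m∣P) (begin
        (suc r + k * w + k) % m ≡⟨ cong (_% m) (solve 3 (λ r k w → con 1 :+ r :+ k :* w :+ k := (r :+ (con 1 :+ k)) :+ k :* w) refl r k w) ⟩
        (r + m + k * w) % m ≡⟨ cong (λ z → (z + k * w) % m) (m+[n∸m]≡n s≤r+m) ⟨
        (s + w + k * w) % m ≡⟨ cong (_% m) (solve 3 (λ s k w → s :+ w :+ k :* w := s :+ w :* (con 1 :+ k)) refl s k w) ⟩
        (s + w * m) % m ≡⟨ [m+kn]%n≡m%n s w m ⟩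
        s % m ≡⟨ m<n⇒m%n≡m (s≤s s≤k) ⟩
        s ∎))
      where
      s≤r+m : s ≤ r + m
      s≤r+m = ≤-trans s≤k (≤-trans (n≤1+n k) (m≤n+m m r))
      w X : ℕ
      w = r + m ∸ s
      X = suc r + k * w

    ρ≤k : ∀ n → ρ n ≤ k
    ρ≤k n = <⇒≤ (m%n<n (size n + p) k)

    ς≤k : ∀ n → ς n ≤ k
    ς≤k n = ≤-pred (m%n<n (size n + k) m)

    opaque
      zeroList : List ℕ
      zeroList = filter (λ n → N (+ n) (suc p) ≟ 0) (upTo (period (suc p)))

      length-zeroList : length zeroList ≡ length (filter (λ n → N (+ n) (suc p) ≟ 0) (upTo (period (suc p))))
      length-zeroList = refl

      zeroList-unique : Unique zeroList
      zeroList-unique = Unique.filter⁺ (λ n → N (+ n) (suc p) ≟ 0) (Unique.upTo⁺ (period (suc p)))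

      ∈-zeroList⁺ : ∀ {n} → n < period (suc p) → N (+ n) (suc p) ≡ 0 → n ∈ zeroList
      ∈-zeroList⁺ n<P N≡0 = ∈-filter⁺ (λ n → N (+ n) (suc p) ≟ 0) {xs = upTo (period (suc p))} (∈-upTo⁺ n<P) N≡0

      ∈-zeroList⁻ : ∀ {n} → n ∈ zeroList → n < period (suc p) × N (+ n) (suc p) ≡ 0
      ∈-zeroList⁻ n∈ with ∈-filter⁻ (λ n → N (+ n) (suc p) ≟ 0) {xs = upTo (period (suc p))} n∈
      ... | n∈upTo , N≡0 = ∈-upTo⁻ n∈upTo , N≡0

    Coprime? : ∀ (x : ℕ × ℕ) → Dec (pairGcd x ≡ 1)
    Coprime? x = pairGcd x ≟ 1

    -- Adjoins `m` spare targets for the exceptions of an injection.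
    tagged : ∀ {A : Set} → List A → List (A ⊎ ℕ)
    tagged xs = map inj₁ xs ++ map inj₂ (upTo m)

    length-tagged : ∀ {A : Set} (xs : List A) → length (tagged xs) ≡ length xs + m
    length-tagged xs = trans (length-++ (map inj₁ xs))
      (cong₂ _+_ (length-map inj₁ xs) (trans (length-map inj₂ (upTo m)) (length-upTo m)))

    ∈-tagged₁ : ∀ {A : Set} {xs : List A} {x} → x ∈ xs → inj₁ x ∈ tagged xs
    ∈-tagged₁ x∈ = ∈-++⁺ˡ (∈-map⁺ inj₁ x∈)

    ∈-tagged₂ : ∀ {A : Set} (xs : List A) {j} → j < m → inj₂ j ∈ tagged xs
    ∈-tagged₂ xs j<m = ∈-++⁺ʳ (map inj₁ xs) (∈-map⁺ inj₂ (∈-upTo⁺ j<m))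

    -- The multiples of k, which the duality misses, are told apart by their residue modulo m.
    ToPair : ℕ → (ℕ × ℕ) ⊎ ℕ → Set
    ToPair n (inj₁ (u , v)) = Match p (ρ n) (ς n) u v
    ToPair n (inj₂ j)       = ρ n ≡ p × ς n ≡ j

    toPair : ∀ {n} → n ∈ zeroList → ∃[ y ] y ∈ tagged (coprimePairs k) × ToPair n y
    toPair {n} n∈ with ∈-zeroList⁻ n∈ | m≤n⇒m<n∨m≡n (≤-pred (m%n<n (size n + p) k))
    ... | _ , N≡0 | inj₂ ρ≡p = inj₂ (ς n) , ∈-tagged₂ (coprimePairs k) (m%n<n (size n + k) m) , ρ≡p , refl
    ... | _ , N≡0 | inj₁ ρ<p = inj₁ (u , v) , ∈-++⁺ˡ (∈-map⁺ inj₁ (∈-filter⁺ Coprime? {xs = upperTriangle k}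
        (upperTriangle⁺ (Triangle.1≤u tri) (Triangle.u≤k tri) (Triangle.v≤k tri) (≤-trans (n≤1+n m) (Triangle.2+k≤u+v tri)))
        (coprime⇒gcd≡1 (covers⇒coprime tri exchange-covers)))) , match
      where
      open FromShift {p} {ρ n} {ς n} ρ<p (nullity≡0⇒covers p (size n) (0<size n) N≡0)

    toPair-injective : ∀ {n n′ y} → n ∈ zeroList → n′ ∈ zeroList → ToPair n y → ToPair n′ y → n ≡ n′
    toPair-injective {n} {n′} {y} n∈ n′∈ R R′ = helper y R R′
      where
      bound : ∀ {n} → n ∈ zeroList → n < P
      bound n∈ = proj₁ (∈-zeroList⁻ n∈)
      helper : ∀ y → ToPair n y → ToPair n′ y → n ≡ n′
      helper (inj₁ (u , v)) M M′ = residues-injective (bound n∈) (bound n′∈) (proj₁ same) (proj₂ same)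
        where
        same : ρ n ≡ ρ n′ × ς n ≡ ς n′
        same = Match-uniqueˡ M M′ (ρ≤k n) (ρ≤k n′) (ς≤k n) (ς≤k n′) refl refl
      helper (inj₂ j) (ρ≡p , ς≡j) (ρ′≡p , ς′≡j) =
        residues-injective (bound n∈) (bound n′∈) (trans ρ≡p (sym ρ′≡p)) (trans ς≡j (sym ς′≡j))

    -- Pairs with `u + v = m` have an empty middle interval and fall outside `Triangle`; they are
    -- told apart by `u`.
    ToZero : ℕ × ℕ → ℕ ⊎ ℕ → Set
    ToZero (u , v) (inj₁ n) = Match p (ρ n) (ς n) u v
    ToZero (u , v) (inj₂ j) = u + v ≡ m × u ≡ j

    zero-of : ∀ {u v} → Triangle k u v → Coprime u v → ∃[ n ] n < P × N (+ n) k ≡ 0 × Match p (ρ n) (ς n) u v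
    zero-of {u} {v} tri coprime = n , n<P , covers⇒nullity≡0 p (size n) (0<size n) (Match.shift-covers M) , M
      where
      open FromExchange tri (coprime⇒covers tri coprime)
      target : ∃[ n ] n < P × ρ n ≡ r × ς n ≡ s
      target = residues-surjective (≤-trans r<p (n≤1+n p)) s≤k
      n : ℕ
      n = proj₁ target
      n<P : n < P
      n<P = proj₁ (proj₂ target)
      M : Match p (ρ n) (ς n) u v
      M = subst₂ (λ r s → Match p r s u v) (sym (proj₁ (proj₂ (proj₂ target)))) (sym (proj₂ (proj₂ (proj₂ target)))) match

    toZero : ∀ {x} → x ∈ coprimePairs k → ∃[ y ] y ∈ tagged zeroList × ToZero x y
    toZero {u , v} x∈ = helper (upperTriangle⁻ {k} (proj₁ x∈′)) (proj₂ x∈′)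
      where
      x∈′ : (u , v) ∈ upperTriangle k × gcd u v ≡ 1
      x∈′ = ∈-filter⁻ Coprime? {xs = upperTriangle k} x∈
      inside : Triangle k u v → Coprime u v → ∃[ y ] y ∈ tagged zeroList × ToZero (u , v) y
      inside tri coprime = pack (zero-of tri coprime)
        where
        pack : ∃[ n ] n < P × N (+ n) k ≡ 0 × Match p (ρ n) (ς n) u v → ∃[ y ] y ∈ tagged zeroList × ToZero (u , v) y
        pack (n , n<P , N≡0 , M) = inj₁ n , ∈-tagged₁ (∈-zeroList⁺ n<P N≡0) , M
      helper : 1 ≤ u × u ≤ k × v ≤ k × k < u + v → gcd u v ≡ 1 → ∃[ y ] y ∈ tagged zeroList × ToZero (u , v) y
      helper (1≤u , u≤k , v≤k , m≤u+v) gcd≡1 with m≤n⇒m<n∨m≡n m≤u+v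
      ... | inj₂ m≡u+v = inj₂ u , ∈-tagged₂ zeroList (s≤s u≤k) , sym m≡u+v , refl
      ... | inj₁ m<u+v = inside (triangle 1≤u 1≤v u≤k v≤k m<u+v) (gcd≡1⇒coprime gcd≡1)
        where
        1≤v : 1 ≤ v
        1≤v = n≢0⇒n>0 λ { refl → <⇒≱ m≤u+v (≤-trans (≤-reflexive (+-identityʳ u)) u≤k) }

    toZero-injective : ∀ {x x′ y} → x ∈ coprimePairs k → x′ ∈ coprimePairs k → ToZero x y → ToZero x′ y → x ≡ x′
    toZero-injective {u , v} {u′ , v′} {inj₁ n} _ _ M M′ = cong₂ _,_ (proj₁ same) (proj₂ same)
      where
      same : u ≡ u′ × v ≡ v′
      same = Match-uniqueʳ M M′ (ρ≤k n) refl refl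
    toZero-injective {u , v} {u′ , v′} {inj₂ j} _ _ (eq , refl) (eq′ , refl) =
      cong (u ,_) (+-cancelˡ-≡ u v v′ (trans eq (sym eq′)))

    zeros≤coprimes : length zeroList ≤ coprimes (suc p) + (2 + p)
    zeros≤coprimes = subst (length zeroList ≤_) (length-tagged (coprimePairs k))
      (injection-length ToPair zeroList-unique toPair
        (λ {x} {x′} {y} → toPair-injective {x} {x′} {y}))

    coprimes≤zeros : coprimes (suc p) ≤ length zeroList + (2 + p)
    coprimes≤zeros = subst (coprimes k ≤_) (length-tagged zeroList)
      (injection-length ToZero (Unique.filter⁺ Coprime? (upperTriangle-unique k)) toZero
        (λ {x} {x′} {y} → toZero-injective {x} {x′} {y}))

open import Data.Integer.Base as ℤ using (-[1+_]; -1ℤ)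
import Data.Integer.Properties as ℤ
import Data.Integer.Solver as ℤ
open import Data.List.Base using (length; filter; upTo)
open import Data.Nat.Base as ℕ using (ℕ; zero; suc)
open import Data.Nat.DivMod as ℕ using (_%_; m≡m%n+[m/n]*n; m%n<n; n/1≡n)
import Data.Nat.Properties as ℕ
import Data.Nat.Solver as ℕ
open import Data.Rational.Base
open import Data.Rational.Properties
open import Data.Rational.Solver using (module +-*-Solver)
open import Data.Rational.Unnormalised.Base as ℚᵘ using (mkℚᵘ; *≡*)
import Data.Rational.Unnormalised.Properties as ℚᵘ
open import Defs
open ℕ.+-*-Solver using ()
  renaming (solve to solveℕ; _:+_ to _⊕_; _:*_ to _⊗_; _:=_ to _⊜_; con to conℕ)
open +-*-Solver using (solve; _:=_; _:+_; _:*_; _:-_; :-_; con)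
open Farey using (sumℕ; coprimes; coprimes≤; coprimes-sum)
open Zeros using (zeroList; length-zeroList; zeros≤coprimes; coprimes≤zeros)
open Sums

-- Rational arithmetic

-- Defined by recursion so that `ι (suc n)` unfolds to `1ℚ + ι n`, a polynomial identity for the
-- ring solver.
ι : ℕ → ℚ
ι zero    = 0ℚ
ι (suc n) = 1ℚ + ι n

opaque
  inv : ℕ → ℚ
  inv d = ℤ.+ 1 / suc d

  toℚᵘ-/ : ∀ i d → toℚᵘ (i / suc d) ℚᵘ.≃ mkℚᵘ i d
  toℚᵘ-/ i d = toℚᵘ-fromℚᵘ (mkℚᵘ i d)

  /-homo-+ : ∀ i j d → (i ℤ.+ j) / suc d ≡ i / suc d + j / suc d
  /-homo-+ i j d = toℚᵘ-injective (begin
    toℚᵘ ((i ℤ.+ j) / suc d) ≈⟨ toℚᵘ-/ (i ℤ.+ j) d ⟩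
    mkℚᵘ (i ℤ.+ j) d ≈⟨ *≡* (ℤSolver.solve 3 (λ i j d → (i ℤSolver.:+ j) ℤSolver.:* (d ℤSolver.:* d) ℤSolver.:= (i ℤSolver.:* d ℤSolver.:+ j ℤSolver.:* d) ℤSolver.:* d) refl i j (ℤ.+ suc d)) ⟩
    mkℚᵘ i d ℚᵘ.+ mkℚᵘ j d ≈⟨ ℚᵘ.+-cong (toℚᵘ-/ i d) (toℚᵘ-/ j d) ⟨
    toℚᵘ (i / suc d) ℚᵘ.+ toℚᵘ (j / suc d) ≈⟨ toℚᵘ-homo-+ (i / suc d) (j / suc d) ⟨
    toℚᵘ (i / suc d + j / suc d) ∎)
    where
    open ℚᵘ.≃-Reasoning
    module ℤSolver = ℤ.+-*-Solver

  /-ι : ∀ z d → ℤ.+ z / suc d ≡ ι z * inv d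
  /-ι zero    d = trans (0/n≡0 (suc d)) (sym (*-zeroˡ (inv d)))
  /-ι (suc z) d = begin
    ℤ.+ suc z / suc d ≡⟨ /-homo-+ (ℤ.+ 1) (ℤ.+ z) d ⟩
    inv d + ℤ.+ z / suc d ≡⟨ cong (λ z → inv d + z) (/-ι z d) ⟩
    inv d + ι z * inv d ≡⟨ solve 2 (λ i z → i :+ z :* i := (con 1ℚ :+ z) :* i) refl (inv d) (ι z) ⟩
    ι (suc z) * inv d ∎
    where open ≡-Reasoning

  ι-inv : ∀ d → ι (suc d) * inv d ≡ 1ℚ
  ι-inv d = trans (sym (/-ι (suc d) d)) (toℚᵘ-injective (ℚᵘ.≃-trans (toℚᵘ-/ (ℤ.+ suc d) d) (*≡* (ℤ.*-comm (ℤ.+ suc d) (ℤ.+ 1)))))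

  0<inv : ∀ d → 0ℚ < inv d
  0<inv d = positive⁻¹ (inv d) {{normalize-pos 1 (suc d)}}

  -- Archimedes: a positive p/q is at least 1/q.
  inv≤ : ∀ ε → 0ℚ < ε → ∃[ d ] inv d ≤ ε
  inv≤ (mkℚ (ℤ.+ suc n) d c) 0<ε = d , toℚᵘ-cancel-≤ (ℚᵘ.≤-trans (ℚᵘ.≤-reflexive (toℚᵘ-/ (ℤ.+ 1) d))
    (ℚᵘ.*≤* (ℤ.*-monoʳ-≤-nonNeg (ℤ.+ suc d) {ℤ.+ 1} {ℤ.+ suc n} (ℤ.+≤+ (ℕ.s≤s ℕ.z≤n)))))
  inv≤ (mkℚ (ℤ.+ zero) d c)   (*<* 0<0) = contradiction 0<0 (ℤ.<-irrefl refl)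
  inv≤ (mkℚ (-[1+ n ]) d c) (*<* 0<n) = contradiction 0<n (ℤ.≤⇒≯ ℤ.-≤+)

  neg-/ : ∀ i d → (ℤ.- i) / suc d ≡ - (i / suc d)
  neg-/ i d = toℚᵘ-injective (begin
    toℚᵘ ((ℤ.- i) / suc d) ≈⟨ toℚᵘ-/ (ℤ.- i) d ⟩
    ℚᵘ.- mkℚᵘ i d ≈⟨ ℚᵘ.-‿cong (toℚᵘ-/ i d) ⟨
    ℚᵘ.- toℚᵘ (i / suc d) ≈⟨ toℚᵘ-homo‿- (i / suc d) ⟨
    toℚᵘ (- (i / suc d)) ∎)
    where open ℚᵘ.≃-Reasoning

  inv-≡ : ∀ d → ℤ.+ 1 / suc d ≡ inv d
  inv-≡ d = refl

sgn : ℕ → ℚ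
sgn zero    = 1ℚ
sgn (suc j) = - sgn j

signed-/ : ∀ j d → (-1ℤ ℤ.^ j) / suc d ≡ sgn j * inv d
signed-/ zero    d = trans (inv-≡ d) (sym (*-identityˡ (inv d)))
signed-/ (suc j) d = begin
  (-1ℤ ℤ.* (-1ℤ ℤ.^ j)) / suc d ≡⟨ cong (_/ suc d) (ℤ.-1*i≡-i (-1ℤ ℤ.^ j)) ⟩
  (ℤ.- (-1ℤ ℤ.^ j)) / suc d ≡⟨ neg-/ (-1ℤ ℤ.^ j) d ⟩
  - ((-1ℤ ℤ.^ j) / suc d) ≡⟨ cong -_ (signed-/ j d) ⟩
  - (sgn j * inv d) ≡⟨ neg-distribˡ-* (sgn j) (inv d) ⟩
  - sgn j * inv d ∎
  where open ≡-Reasoning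

ι-+ : ∀ a b → ι (a ℕ.+ b) ≡ ι a + ι b
ι-+ zero    b = sym (+-identityˡ (ι b))
ι-+ (suc a) b = trans (cong (λ z → 1ℚ + z) (ι-+ a b)) (sym (+-assoc 1ℚ (ι a) (ι b)))

ι-* : ∀ a b → ι (a ℕ.* b) ≡ ι a * ι b
ι-* zero    b = sym (*-zeroˡ (ι b))
ι-* (suc a) b = trans (ι-+ b (a ℕ.* b)) (trans (cong (λ z → ι b + z) (ι-* a b))
  (solve 2 (λ a b → b :+ a :* b := (con 1ℚ :+ a) :* b) refl (ι a) (ι b)))

≤-by : ∀ {p q} d → 0ℚ ≤ d → q ≡ p + d → p ≤ q
≤-by {p} d 0≤d refl = subst (_≤ p + d) (+-identityʳ p) (+-monoʳ-≤ p 0≤d)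

0≤q-p : ∀ {p q} → p ≤ q → 0ℚ ≤ q - p
0≤q-p {p} {q} p≤q = subst (_≤ q - p) (+-inverseʳ p) (+-monoˡ-≤ (- p) p≤q)

0≤+ : ∀ {p q} → 0ℚ ≤ p → 0ℚ ≤ q → 0ℚ ≤ p + q
0≤+ 0≤p 0≤q = +-mono-≤ 0≤p 0≤q

*-monoˡ : ∀ {r p q} → 0ℚ ≤ r → p ≤ q → r * p ≤ r * q
*-monoˡ {r} 0≤r p≤q = *-monoˡ-≤-nonNeg r {{nonNegative 0≤r}} p≤q

*-monoʳ : ∀ {r p q} → 0ℚ ≤ r → p ≤ q → p * r ≤ q * r
*-monoʳ {r} 0≤r p≤q = *-monoʳ-≤-nonNeg r {{nonNegative 0≤r}} p≤q

*-mono : ∀ {p q r s} → 0ℚ ≤ r → 0ℚ ≤ q → p ≤ q → r ≤ s → p * r ≤ q * s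
*-mono 0≤r 0≤q p≤q r≤s = ≤-trans (*-monoʳ 0≤r p≤q) (*-monoˡ 0≤q r≤s)

0≤* : ∀ {p q} → 0ℚ ≤ p → 0ℚ ≤ q → 0ℚ ≤ p * q
0≤* {p} {q} 0≤p 0≤q = subst (_≤ p * q) (*-zeroʳ p) (*-monoˡ 0≤p 0≤q)

0≤1 : 0ℚ ≤ 1ℚ
0≤1 = nonNegative⁻¹ 1ℚ

0≤ι : ∀ n → 0ℚ ≤ ι n
0≤ι zero    = ≤-refl
0≤ι (suc n) = 0≤+ 0≤1 (0≤ι n)

ι-mono : ∀ {a b} → a ℕ.≤ b → ι a ≤ ι b
ι-mono {a} {b} a≤b = ≤-by (ι (b ℕ.∸ a)) (0≤ι (b ℕ.∸ a))
  (trans (cong ι (sym (ℕ.m+[n∸m]≡n a≤b))) (ι-+ a (b ℕ.∸ a)))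

0<ι : ∀ n → 0ℚ < ι (suc n)
0<ι n = <-≤-trans (positive⁻¹ 1ℚ) (≤-by (ι n) (0≤ι n) refl)

*-cancelˡ-≤ι : ∀ n {p q} → ι (suc n) * p ≤ ι (suc n) * q → p ≤ q
*-cancelˡ-≤ι n = *-cancelˡ-≤-pos (ι (suc n)) {{positive (0<ι n)}}

*-cancelˡ-≡ : ∀ r {p q} → 0ℚ < r → r * p ≡ r * q → p ≡ q
*-cancelˡ-≡ r {p} {q} 0<r eq = ≤-antisym (cancel (≤-reflexive eq)) (cancel (≤-reflexive (sym eq)))
  where
  cancel : ∀ {p q} → r * p ≤ r * q → p ≤ q
  cancel = *-cancelˡ-≤-pos r {{positive 0<r}}

0≤inv : ∀ d → 0ℚ ≤ inv d
0≤inv d = <⇒≤ (0<inv d)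

inv-antitone : ∀ {a b} → a ℕ.≤ b → inv b ≤ inv a
inv-antitone {a} {b} a≤b = *-cancelˡ-≤ι b (begin
  ι (suc b) * inv b ≡⟨ ι-inv b ⟩
  1ℚ ≡⟨ ι-inv a ⟨
  ι (suc a) * inv a ≤⟨ *-monoʳ (0≤inv a) (ι-mono (ℕ.s≤s a≤b)) ⟩
  ι (suc b) * inv a ∎)
  where open ≤-Reasoning

inv≤1 : ∀ d → inv d ≤ 1ℚ
inv≤1 d = ≤-trans (inv-antitone {0} {d} ℕ.z≤n) (≤-reflexive (trans (sym (*-identityˡ (inv 0))) (ι-inv 0)))

∣p∣≤ : ∀ {p q} → p ≤ q → - p ≤ q → ∣ p ∣ ≤ q
∣p∣≤ {p} p≤q -p≤q with ∣p∣≡p∨∣p∣≡-p p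
... | inj₁ eq = ≤-trans (≤-reflexive eq) p≤q
... | inj₂ eq = ≤-trans (≤-reflexive eq) -p≤q

∣c*p∣ : ∀ {c} p → 0ℚ ≤ c → ∣ c * p ∣ ≡ c * ∣ p ∣
∣c*p∣ {c} p 0≤c = trans (∣p*q∣≡∣p∣*∣q∣ c p) (cong (_* ∣ p ∣) (0≤p⇒∣p∣≡p 0≤c))

sumTo-mono : ∀ n {f g} → (∀ i → i ℕ.< n → f i ≤ g i) → sumTo n f ≤ sumTo n g
sumTo-mono zero    f≤g = ≤-refl
sumTo-mono (suc n) f≤g = +-mono-≤ (f≤g 0 (ℕ.s≤s ℕ.z≤n)) (sumTo-mono n (λ i i<n → f≤g (suc i) (ℕ.s≤s i<n)))

sumTo-const : ∀ n c → sumTo n (λ _ → c) ≡ ι n * c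
sumTo-const zero    c = sym (*-zeroˡ c)
sumTo-const (suc n) c = trans (cong (λ z → c + z) (sumTo-const n c))
  (solve 2 (λ n c → c :+ n :* c := (con 1ℚ :+ n) :* c) refl (ι n) c)

0≤sumTo : ∀ n {f} → (∀ i → i ℕ.< n → 0ℚ ≤ f i) → 0ℚ ≤ sumTo n f
0≤sumTo zero    0≤f = ≤-refl
0≤sumTo (suc n) 0≤f = 0≤+ (0≤f 0 (ℕ.s≤s ℕ.z≤n)) (0≤sumTo n (λ i i<n → 0≤f (suc i) (ℕ.s≤s i<n)))

∣sumTo∣≤ : ∀ n f → ∣ sumTo n f ∣ ≤ sumTo n (λ i → ∣ f i ∣)
∣sumTo∣≤ zero    f = ≤-refl
∣sumTo∣≤ (suc n) f = ≤-trans (∣p+q∣≤∣p∣+∣q∣ (f 0) (sumTo n (λ i → f (suc i)))) (+-monoʳ-≤ ∣ f 0 ∣ (∣sumTo∣≤ n (λ i → f (suc i))))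

sumTo-reverse : ∀ n f → sumTo n (λ i → f (n ℕ.∸ suc i)) ≡ sumTo n f
sumTo-reverse zero    f = refl
sumTo-reverse (suc n) f = trans (cong (λ z → f n + z) (sumTo-reverse n f))
  (trans (+-comm (f n) (sumTo n f)) (sym (sumTo-snoc n f)))

harmonic : ℕ → ℚ
harmonic n = sumTo n inv

harmonic≤ : ∀ n → harmonic n ≤ ι n
harmonic≤ n = ≤-trans (sumTo-mono n (λ i _ → inv≤1 i)) (≤-reflexive (trans (sumTo-const n 1ℚ) (*-identityʳ (ι n))))

-- Replaces logarithmic growth: after multiplication by D each of the first D terms is at most D,
-- and every later one at most 1.
harmonic-sublinear : ∀ D n → ι D * harmonic n ≤ ι n + ι D * ι D
harmonic-sublinear D zero = ≤-by (ι D * ι D) (0≤* (0≤ι D) (0≤ι D))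
  (cong (_+ ι D * ι D) (sym (*-zeroʳ (ι D))))
harmonic-sublinear D (suc n) with ℕ.≤-<-connex D n
... | inj₁ D≤n = begin
  ι D * harmonic (suc n) ≡⟨ cong (ι D *_) (sumTo-snoc n inv) ⟩
  ι D * (harmonic n + inv n) ≡⟨ *-distribˡ-+ (ι D) (harmonic n) (inv n) ⟩
  ι D * harmonic n + ι D * inv n ≤⟨ +-mono-≤ (harmonic-sublinear D n) (≤-trans (*-monoʳ (0≤inv n) (ι-mono (ℕ.m≤n⇒m≤1+n D≤n))) (≤-reflexive (ι-inv n))) ⟩
  ι n + ι D * ι D + 1ℚ ≡⟨ solve 2 (λ n d → n :+ d :+ con 1ℚ := (con 1ℚ :+ n) :+ d) refl (ι n) (ι D * ι D) ⟩
  ι (suc n) + ι D * ι D ∎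
  where open ≤-Reasoning
... | inj₂ n<D = begin
  ι D * harmonic (suc n) ≤⟨ *-monoˡ (0≤ι D) (≤-trans (harmonic≤ (suc n)) (ι-mono n<D)) ⟩
  ι D * ι D ≤⟨ ≤-by (ι (suc n)) (0≤ι (suc n)) (+-comm (ι (suc n)) (ι D * ι D)) ⟩
  ι (suc n) + ι D * ι D ∎
  where open ≤-Reasoning

-- Partial sums of ζ(2)

private
  2ℚ 3ℚ 4ℚ 5ℚ 6ℚ 8ℚ : ℚ
  2ℚ = ι 2
  3ℚ = ι 3
  4ℚ = ι 4
  5ℚ = ι 5
  6ℚ = ι 6
  8ℚ = ι 8

ζ : ℕ → ℚ
ζ n = sumTo n (λ d → inv d * inv d)

ζ-suc : ∀ n → ζ (suc n) ≡ ζ n + inv n * inv n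
ζ-suc n = sumTo-snoc n (λ d → inv d * inv d)

oddInv : ℕ → ℚ
oddInv j = inv (2 ℕ.* j)

oddSquares : ℕ → ℚ
oddSquares n = sumTo n (λ j → oddInv j * oddInv j)

inv-step : ∀ n → inv n - inv (suc n) ≡ inv n * inv (suc n)
inv-step n = begin
  x - y ≡⟨ cong₂ _-_ (sym (trans (cong (x *_) (ι-inv (suc n))) (*-identityʳ x))) (sym (trans (cong (y *_) (ι-inv n)) (*-identityʳ y))) ⟩
  x * (ι (2 ℕ.+ n) * y) - y * (ι (suc n) * x) ≡⟨ solve 3 (λ x y n → x :* ((con 1ℚ :+ (con 1ℚ :+ n)) :* y) :- y :* ((con 1ℚ :+ n) :* x) := x :* y) refl x y (ι n) ⟩
  x * y ∎
  where
  open ≡-Reasoning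
  x = inv n
  y = inv (suc n)

-- ζ(N) + 1/N decreases in N, because 1/(N+1)² ≤ 1/(N(N+1)) = 1/N - 1/(N+1).
ζ-tail : ∀ c t → ζ (suc c ℕ.+ t) + inv (c ℕ.+ t) ≤ ζ (suc c) + inv c
ζ-tail c zero    = ≤-reflexive (cong₂ (λ a b → ζ a + inv b) (ℕ.+-identityʳ (suc c)) (ℕ.+-identityʳ c))
ζ-tail c (suc t) = begin
  ζ (suc c ℕ.+ suc t) + inv (c ℕ.+ suc t) ≡⟨ cong₂ (λ a b → ζ a + inv b) (ℕ.+-suc (suc c) t) (ℕ.+-suc c t) ⟩
  ζ (suc (suc n)) + y ≡⟨ cong (_+ y) (ζ-suc (suc n)) ⟩
  ζ (suc n) + y * y + y ≤⟨ ≤-by ((x - y) * y) (0≤* (0≤q-p y≤x) (0≤inv (suc n))) split ⟩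
  ζ (suc n) + x ≤⟨ ζ-tail c t ⟩
  ζ (suc c) + inv c ∎
  where
  open ≤-Reasoning
  n = c ℕ.+ t
  x = inv n
  y = inv (suc n)
  y≤x : y ≤ x
  y≤x = inv-antitone (ℕ.n≤1+n n)
  split : ζ (suc n) + x ≡ ζ (suc n) + y * y + y + (x - y) * y
  split = trans (cong (λ z → ζ (suc n) + z) (trans (solve 2 (λ x y → x := y :+ (x :- y)) refl x y) (cong (y +_) (inv-step n))))
    (solve 3 (λ z x y → z :+ (y :+ x :* y) := z :+ y :* y :+ y :+ (x :- y) :* y) refl (ζ (suc n)) x y)

0≤inv² : ∀ d → 0ℚ ≤ inv d * inv d
0≤inv² d = 0≤* (0≤inv d) (0≤inv d)

ζ-mono : ∀ {a b} → a ℕ.≤ b → ζ a ≤ ζ b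
ζ-mono {a} {b} a≤b = ≤-by (sumTo (b ℕ.∸ a) (λ i → inv (a ℕ.+ i) * inv (a ℕ.+ i))) (0≤sumTo (b ℕ.∸ a) (λ i _ → 0≤inv² (a ℕ.+ i)))
  (trans (cong ζ (sym (ℕ.m+[n∸m]≡n a≤b))) (sumTo-split a (b ℕ.∸ a) (λ d → inv d * inv d)))

ζ-upper : ∀ {c a} → suc c ℕ.≤ a → ζ a ≤ ζ (suc c) + inv c
ζ-upper {c} {a} c<a = ≤-trans (≤-by (inv (c ℕ.+ t)) (0≤inv (c ℕ.+ t)) refl)
  (subst (λ z → ζ z + inv (c ℕ.+ t) ≤ ζ (suc c) + inv c) (ℕ.m+[n∸m]≡n c<a) (ζ-tail c t))
  where
  t : ℕ
  t = a ℕ.∸ suc c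

ζ-close : ∀ {c a b} → suc c ℕ.≤ a → suc c ℕ.≤ b → ∣ ζ a - ζ b ∣ ≤ inv c
ζ-close {c} {a} {b} c<a c<b = ∣p∣≤ (half c<a c<b)
  (subst (_≤ inv c) (solve 2 (λ a b → b :- a := :- (a :- b)) refl (ζ a) (ζ b)) (half c<b c<a))
  where
  half : ∀ {a b} → suc c ℕ.≤ a → suc c ℕ.≤ b → ζ a - ζ b ≤ inv c
  half {a} {b} c<a c<b = begin
    ζ a - ζ b ≤⟨ +-mono-≤ (ζ-upper c<a) (neg-antimono-≤ (ζ-mono c<b)) ⟩
    ζ (suc c) + inv c - ζ (suc c) ≡⟨ solve 2 (λ z i → z :+ i :- z := i) refl (ζ (suc c)) (inv c) ⟩
    inv c ∎
    where open ≤-Reasoning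

-- 1/N² ≤ 4/(4N² - 1), which telescopes to ζ ≤ 5/3.
ζ≤5/3 : ∀ n → 3ℚ * ζ (suc n) + 6ℚ * inv (2 ℕ.* n ℕ.+ 2) ≤ 5ℚ
ζ≤5/3 zero = ≤-reflexive (begin
  3ℚ * (inv 0 * inv 0 + 0ℚ) + 6ℚ * inv 2 ≡⟨ cong (λ z → 3ℚ * (z * z + 0ℚ) + 6ℚ * inv 2) inv0 ⟩
  3ℚ + 6ℚ * inv 2 ≡⟨ cong (λ z → 3ℚ + z) (trans (*-assoc 2ℚ 3ℚ (inv 2)) (trans (cong (2ℚ *_) (ι-inv 2)) refl)) ⟩
  5ℚ ∎)
  where
  open ≡-Reasoning
  inv0 : inv 0 ≡ 1ℚ
  inv0 = trans (sym (*-identityˡ (inv 0))) (ι-inv 0)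
ζ≤5/3 (suc n) = begin
  3ℚ * ζ (2 ℕ.+ n) + 6ℚ * inv (2 ℕ.* suc n ℕ.+ 2)
    ≡⟨ cong₂ (λ a b → 3ℚ * a + 6ℚ * inv b) (ζ-suc (suc n)) index ⟩
  3ℚ * (ζ (suc n) + w * w) + 6ℚ * q
    ≤⟨ ≤-by (3ℚ * (w * w * (p * q))) (0≤* (0≤ι 3) (0≤* (0≤inv² (suc n)) (0≤* (0≤inv _) (0≤inv _)))) split ⟩
  3ℚ * ζ (suc n) + 6ℚ * p
    ≤⟨ ζ≤5/3 n ⟩
  5ℚ ∎
  where
  open ≤-Reasoning
  open ℕ.+-*-Solver using () renaming (solve to solveℕ; _:+_ to _⊕_; _:*_ to _⊗_; _:=_ to _⊜_; con to conℕ)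
  w p q : ℚ
  w = inv (suc n)
  p = inv (2 ℕ.* n ℕ.+ 2)
  q = inv (2 ℕ.* n ℕ.+ 4)
  index : 2 ℕ.* suc n ℕ.+ 2 ≡ 2 ℕ.* n ℕ.+ 4
  index = solveℕ 1 (λ n → conℕ 2 ⊗ (conℕ 1 ⊕ n) ⊕ conℕ 2 ⊜ conℕ 2 ⊗ n ⊕ conℕ 4) refl n
  ι-index : ∀ c → ι (suc (2 ℕ.* n ℕ.+ c)) ≡ 1ℚ + (2ℚ * ι n + ι c)
  ι-index c = cong (λ z → 1ℚ + z) (trans (ι-+ (2 ℕ.* n) c) (cong (_+ ι c) (ι-* 2 n)))
  pp : (2ℚ * ι n + 3ℚ) * p ≡ 1ℚ
  pp = trans (cong (_* p) (trans (solve 1 (λ n → con 2ℚ :* n :+ con 3ℚ := con 1ℚ :+ (con 2ℚ :* n :+ con 2ℚ)) refl (ι n)) (sym (ι-index 2)))) (ι-inv (2 ℕ.* n ℕ.+ 2))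
  qq : (2ℚ * ι n + 5ℚ) * q ≡ 1ℚ
  qq = trans (cong (_* q) (trans (solve 1 (λ n → con 2ℚ :* n :+ con 5ℚ := con 1ℚ :+ (con 2ℚ :* n :+ con 4ℚ)) refl (ι n)) (sym (ι-index 4)))) (ι-inv (2 ℕ.* n ℕ.+ 4))
  p-q : p - q ≡ 2ℚ * (p * q)
  p-q = begin-equality
    p - q ≡⟨ cong₂ _-_ (sym (trans (cong (p *_) qq) (*-identityʳ p))) (sym (trans (cong (q *_) pp) (*-identityʳ q))) ⟩
    p * ((2ℚ * ι n + 5ℚ) * q) - q * ((2ℚ * ι n + 3ℚ) * p) ≡⟨ solve 3 (λ p q n → p :* ((con 2ℚ :* n :+ con 5ℚ) :* q) :- q :* ((con 2ℚ :* n :+ con 3ℚ) :* p) := con 2ℚ :* (p :* q)) refl p q (ι n) ⟩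
    2ℚ * (p * q) ∎
  -- With N = n + 2 this reads 4/(4N² - 1) = 1/N² + 1/(N²(4N² - 1)).
  4pq : 4ℚ * (p * q) ≡ w * w + w * w * (p * q)
  4pq = begin-equality
    4ℚ * (p * q)
      ≡⟨ solve 1 (λ x → con 4ℚ :* x := con 4ℚ :* (con 1ℚ :* con 1ℚ) :* x) refl (p * q) ⟩
    4ℚ * (1ℚ * 1ℚ) * (p * q)
      ≡⟨ cong (λ z → 4ℚ * (z * z) * (p * q)) (ι-inv (suc n)) ⟨
    4ℚ * (ι (2 ℕ.+ n) * w * (ι (2 ℕ.+ n) * w)) * (p * q)
      ≡⟨ solve 4 (λ n w p q → con 4ℚ :* ((con 1ℚ :+ (con 1ℚ :+ n)) :* w :* ((con 1ℚ :+ (con 1ℚ :+ n)) :* w)) :* (p :* q) :=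
           w :* w :* (((con 2ℚ :* n :+ con 3ℚ) :* p) :* ((con 2ℚ :* n :+ con 5ℚ) :* q)) :+ w :* w :* (p :* q)) refl (ι n) w p q ⟩
    w * w * (((2ℚ * ι n + 3ℚ) * p) * ((2ℚ * ι n + 5ℚ) * q)) + w * w * (p * q)
      ≡⟨ cong₂ (λ a b → w * w * (a * b) + w * w * (p * q)) pp qq ⟩
    w * w * (1ℚ * 1ℚ) + w * w * (p * q)
      ≡⟨ cong (_+ w * w * (p * q)) (*-identityʳ (w * w)) ⟩
    w * w + w * w * (p * q) ∎
  split : 3ℚ * ζ (suc n) + 6ℚ * p ≡ 3ℚ * (ζ (suc n) + w * w) + 6ℚ * q + 3ℚ * (w * w * (p * q))
  split = begin-equality
    3ℚ * ζ (suc n) + 6ℚ * p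
      ≡⟨ solve 3 (λ z p q → con 3ℚ :* z :+ con 6ℚ :* p := con 3ℚ :* z :+ con 6ℚ :* q :+ con 6ℚ :* (p :- q)) refl (ζ (suc n)) p q ⟩
    3ℚ * ζ (suc n) + 6ℚ * q + 6ℚ * (p - q)
      ≡⟨ cong (λ a → 3ℚ * ζ (suc n) + 6ℚ * q + 6ℚ * a) p-q ⟩
    3ℚ * ζ (suc n) + 6ℚ * q + 6ℚ * (2ℚ * (p * q))
      ≡⟨ solve 3 (λ z q x → con 3ℚ :* z :+ con 6ℚ :* q :+ con 6ℚ :* (con 2ℚ :* x) := con 3ℚ :* z :+ con 6ℚ :* q :+ con 3ℚ :* (con 4ℚ :* x)) refl (ζ (suc n)) q (p * q) ⟩
    3ℚ * ζ (suc n) + 6ℚ * q + 3ℚ * (4ℚ * (p * q))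
      ≡⟨ cong (λ a → 3ℚ * ζ (suc n) + 6ℚ * q + 3ℚ * a) 4pq ⟩
    3ℚ * ζ (suc n) + 6ℚ * q + 3ℚ * (w * w + w * w * (p * q))
      ≡⟨ solve 4 (λ z q w x → con 3ℚ :* z :+ con 6ℚ :* q :+ con 3ℚ :* (w :* w :+ x) := con 3ℚ :* (z :+ w :* w) :+ con 6ℚ :* q :+ con 3ℚ :* x) refl (ζ (suc n)) q w (w * w * (p * q)) ⟩
    3ℚ * (ζ (suc n) + w * w) + 6ℚ * q + 3ℚ * (w * w * (p * q)) ∎

-- The even terms of ζ(2n) form ζ(n)/4. In the limit the odd squares make up three quarters of ζ(2).
ζ-even : ∀ n → 4ℚ * ζ (2 ℕ.* n) ≡ 4ℚ * oddSquares n + ζ n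
ζ-even zero    = refl
ζ-even (suc n) = begin
  4ℚ * ζ (2 ℕ.* suc n)
    ≡⟨ cong (λ z → 4ℚ * ζ z) (ℕ.*-suc 2 n) ⟩
  4ℚ * ζ (2 ℕ.+ 2 ℕ.* n)
    ≡⟨ cong (4ℚ *_) (trans (ζ-suc (suc (2 ℕ.* n))) (cong (_+ e * e) (ζ-suc (2 ℕ.* n)))) ⟩
  4ℚ * (ζ (2 ℕ.* n) + oddInv n * oddInv n + e * e)
    ≡⟨ solve 3 (λ z o e → con 4ℚ :* (z :+ o :* o :+ e :* e) := con 4ℚ :* z :+ con 4ℚ :* (o :* o) :+ (con 2ℚ :* e) :* (con 2ℚ :* e)) refl (ζ (2 ℕ.* n)) (oddInv n) e ⟩
  4ℚ * ζ (2 ℕ.* n) + 4ℚ * (oddInv n * oddInv n) + (2ℚ * e) * (2ℚ * e)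
    ≡⟨ cong₂ (λ a b → a + 4ℚ * (oddInv n * oddInv n) + b * b) (ζ-even n) 2e ⟩
  4ℚ * oddSquares n + ζ n + 4ℚ * (oddInv n * oddInv n) + inv n * inv n
    ≡⟨ solve 4 (λ a z o i → con 4ℚ :* a :+ z :+ con 4ℚ :* o :+ i := con 4ℚ :* (a :+ o) :+ (z :+ i)) refl (oddSquares n) (ζ n) (oddInv n * oddInv n) (inv n * inv n) ⟩
  4ℚ * (oddSquares n + oddInv n * oddInv n) + (ζ n + inv n * inv n)
    ≡⟨ cong₂ (λ a b → 4ℚ * a + b) (sumTo-snoc n (λ j → oddInv j * oddInv j)) (ζ-suc n) ⟨
  4ℚ * oddSquares (suc n) + ζ (suc n) ∎
  where
  open ≡-Reasoning
  e : ℚ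
  e = inv (suc (2 ℕ.* n))
  2e : 2ℚ * e ≡ inv n
  2e = *-cancelˡ-≡ (ι (suc n)) (0<ι n) (begin
    ι (suc n) * (2ℚ * e) ≡⟨ solve 2 (λ n e → (con 1ℚ :+ n) :* (con 2ℚ :* e) := (con 1ℚ :+ (con 1ℚ :+ con 2ℚ :* n)) :* e) refl (ι n) e ⟩
    (1ℚ + (1ℚ + 2ℚ * ι n)) * e ≡⟨ cong (λ z → (1ℚ + (1ℚ + z)) * e) (ι-* 2 n) ⟨
    ι (2 ℕ.+ 2 ℕ.* n) * e ≡⟨ ι-inv (suc (2 ℕ.* n)) ⟩
    1ℚ ≡⟨ ι-inv n ⟨
    ι (suc n) * inv n ∎)

-- The square of the Leibniz series

sgn² : ∀ j → sgn j * sgn j ≡ 1ℚ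
sgn² zero    = refl
sgn² (suc j) = trans (solve 1 (λ s → (:- s) :* (:- s) := s :* s) refl (sgn j)) (sgn² j)

∣sgn∣ : ∀ j → ∣ sgn j ∣ ≡ 1ℚ
∣sgn∣ zero    = refl
∣sgn∣ (suc j) = trans (∣-p∣≡∣p∣ (sgn j)) (∣sgn∣ j)

sgn-+ : ∀ a b → sgn (a ℕ.+ b) ≡ sgn a * sgn b
sgn-+ zero    b = sym (*-identityˡ (sgn b))
sgn-+ (suc a) b = trans (cong -_ (sgn-+ a b)) (neg-distribˡ-* (sgn a) (sgn b))

sgn-double : ∀ n → sgn (2 ℕ.* n) ≡ 1ℚ
sgn-double n = trans (sgn-+ n (n ℕ.+ 0)) (trans (cong (λ z → sgn n * sgn z) (ℕ.+-identityʳ n)) (sgn² n))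

alternating : ℕ → ℚ
alternating h = sgn h * inv h

-- The alternating sum from s on, divided by its leading sign.
alternatingTail : ℕ → ℕ → ℚ
alternatingTail s zero    = 0ℚ
alternatingTail s (suc n) = inv s - alternatingTail (suc s) n

alternatingTail-bounds : ∀ s n → 0ℚ ≤ alternatingTail s n × alternatingTail s n ≤ inv s
alternatingTail-bounds s zero    = ≤-refl , 0≤inv s
alternatingTail-bounds s (suc n) with alternatingTail-bounds (suc s) n
... | 0≤t , t≤ = 0≤q-p (≤-trans t≤ (inv-antitone (ℕ.n≤1+n s))) ,
  ≤-by (alternatingTail (suc s) n) 0≤t (solve 2 (λ i t → i := i :- t :+ t) refl (inv s) (alternatingTail (suc s) n))

sumTo-alternating : ∀ s n → sumTo n (λ i → alternating (s ℕ.+ i)) ≡ sgn s * alternatingTail s n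
sumTo-alternating s zero    = sym (*-zeroʳ (sgn s))
sumTo-alternating s (suc n) = begin
  alternating (s ℕ.+ 0) + sumTo n (λ i → alternating (s ℕ.+ suc i))
    ≡⟨ cong₂ _+_ (cong alternating (ℕ.+-identityʳ s)) (sumTo-cong n (λ i _ → cong alternating (ℕ.+-suc s i))) ⟩
  sgn s * inv s + sumTo n (λ i → alternating (suc s ℕ.+ i))
    ≡⟨ cong (sgn s * inv s +_) (sumTo-alternating (suc s) n) ⟩
  sgn s * inv s + - sgn s * alternatingTail (suc s) n
    ≡⟨ solve 3 (λ g i t → g :* i :+ (:- g) :* t := g :* (i :- t)) refl (sgn s) (inv s) (alternatingTail (suc s) n) ⟩
  sgn s * alternatingTail s (suc n) ∎
  where open ≡-Reasoning

∣sumTo-alternating∣≤ : ∀ s n → ∣ sumTo n (λ i → alternating (s ℕ.+ i)) ∣ ≤ inv s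
∣sumTo-alternating∣≤ s n = begin
  ∣ sumTo n (λ i → alternating (s ℕ.+ i)) ∣ ≡⟨ cong ∣_∣ (sumTo-alternating s n) ⟩
  ∣ sgn s * t ∣ ≡⟨ ∣p*q∣≡∣p∣*∣q∣ (sgn s) t ⟩
  ∣ sgn s ∣ * ∣ t ∣ ≡⟨ cong₂ _*_ (∣sgn∣ s) (0≤p⇒∣p∣≡p (proj₁ (alternatingTail-bounds s n))) ⟩
  1ℚ * t ≡⟨ *-identityˡ t ⟩
  t ≤⟨ proj₂ (alternatingTail-bounds s n) ⟩
  inv s ∎
  where
  open ≤-Reasoning
  t : ℚ
  t = alternatingTail s n

leibnizSum-≡ : ∀ n → leibnizSum n ≡ sumTo n (λ j → sgn j * oddInv j)
leibnizSum-≡ zero    = refl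
leibnizSum-≡ (suc n) = trans (cong₂ _+_ (leibnizSum-≡ n) (signed-/ n (2 ℕ.* n)))
  (sym (sumTo-snoc n (λ j → sgn j * oddInv j)))

-- Up to sign, the alternating sum of 1/(n - m) over -N ≤ n < N, n ≠ m; all but 2m + 1 terms cancel.
crossTerm : ℕ → ℕ → ℚ
crossTerm N m = sumTo (1 ℕ.+ 2 ℕ.* m) (λ i → alternating (N ℕ.∸ suc m ℕ.+ i))

-- Squaring the Leibniz sum over -N ≤ n < N leaves, besides the diagonal, the terms with
-- 1/((2m + 1)(2n + 1)) = (1/(2m + 1) - 1/(2n + 1)) / (2(n - m)).
crossSum : ℕ → ℚ
crossSum N = sumTo N (λ m → oddInv m * crossTerm N m)

odd-split : ∀ {N m} → m ℕ.< N → ι (suc (2 ℕ.* N)) ≡ 2ℚ * ι (suc (N ℕ.∸ suc m)) + ι (suc (2 ℕ.* m))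
odd-split {N} {m} m<N = begin
  ι (suc (2 ℕ.* N)) ≡⟨ cong (λ z → ι (suc (2 ℕ.* z))) (ℕ.m+[n∸m]≡n m<N) ⟨
  ι (suc (2 ℕ.* (suc m ℕ.+ h))) ≡⟨ cong ι (solveℕ 2 (λ m h → conℕ 1 ⊕ conℕ 2 ⊗ (conℕ 1 ⊕ m ⊕ h) ⊜ conℕ 2 ⊗ (conℕ 1 ⊕ h) ⊕ (conℕ 1 ⊕ conℕ 2 ⊗ m)) refl m h) ⟩
  ι (2 ℕ.* suc h ℕ.+ suc (2 ℕ.* m)) ≡⟨ ι-+ (2 ℕ.* suc h) (suc (2 ℕ.* m)) ⟩
  ι (2 ℕ.* suc h) + ι (suc (2 ℕ.* m)) ≡⟨ cong (_+ ι (suc (2 ℕ.* m))) (ι-* 2 (suc h)) ⟩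
  2ℚ * ι (suc h) + ι (suc (2 ℕ.* m)) ∎
  where
  open ≡-Reasoning
  h : ℕ
  h = N ℕ.∸ suc m

module _ {N m} (m<N : m ℕ.< N) where
  private
    h : ℕ
    h = N ℕ.∸ suc m
    a x X i j y Y : ℚ
    a = ι (suc h)
    x = ι (suc (2 ℕ.* m))
    X = ι (suc (2 ℕ.* N))
    i = inv h
    j = inv (N ℕ.+ m)
    y = oddInv m
    Y = oddInv N

    cancel-X : ∀ {p q} → (2ℚ * a + x) * p ≡ 1ℚ * q → p ≡ Y * q
    cancel-X {p} {q} eq = *-cancelˡ-≡ X (0<ι (2 ℕ.* N)) (begin
      X * p ≡⟨ cong (_* p) (odd-split m<N) ⟩
      (2ℚ * a + x) * p ≡⟨ eq ⟩
      1ℚ * q ≡⟨ cong (_* q) (ι-inv (2 ℕ.* N)) ⟨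
      X * Y * q ≡⟨ *-assoc X Y q ⟩
      X * (Y * q) ∎)
      where open ≡-Reasoning

    middle : (a + x) * j ≡ 1ℚ
    middle = begin
      (a + x) * j ≡⟨ cong (_* j) (ι-+ (suc h) (suc (2 ℕ.* m))) ⟨
      ι (suc h ℕ.+ suc (2 ℕ.* m)) * j ≡⟨ cong (λ z → ι z * j) (solveℕ 2 (λ m h → conℕ 1 ⊕ (conℕ 1 ⊕ m ⊕ h ⊕ m) ⊜ (conℕ 1 ⊕ h) ⊕ (conℕ 1 ⊕ conℕ 2 ⊗ m)) refl m h) ⟨
      ι (suc (suc m ℕ.+ h ℕ.+ m)) * j ≡⟨ cong (λ z → ι (suc (z ℕ.+ m)) * j) (ℕ.m+[n∸m]≡n m<N) ⟩
      ι (suc (N ℕ.+ m)) * j ≡⟨ ι-inv (N ℕ.+ m) ⟩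
      1ℚ ∎
      where open ≡-Reasoning

  -- Partial fractions: 2N + 1 equals both 2(N - m) + (2m + 1) and 2(N + m + 1) - (2m + 1), and each
  -- form clears one of the two products.
  odd-odd : oddInv m * (inv (N ℕ.∸ suc m) + inv (N ℕ.+ m)) ≡
            oddInv N * (4ℚ * oddInv m + (inv (N ℕ.∸ suc m) - inv (N ℕ.+ m)))
  odd-odd = cancel-X (begin
    (2ℚ * a + x) * (y * (i + j))
      ≡⟨ solve 5 (λ a x i j y → (con 2ℚ :* a :+ x) :* (y :* (i :+ j)) :=
           y :* (con 2ℚ :* (a :* i)) :+ y :* (con 2ℚ :* ((a :+ x) :* j)) :+ (x :* y) :* (i :- j)) refl a x i j y ⟩
    y * (2ℚ * (a * i)) + y * (2ℚ * ((a + x) * j)) + (x * y) * (i - j)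
      ≡⟨ cong₂ _+_ (cong₂ (λ u v → y * (2ℚ * u) + y * (2ℚ * v)) (ι-inv h) middle) (cong (_* (i - j)) (ι-inv (2 ℕ.* m))) ⟩
    y * (2ℚ * 1ℚ) + y * (2ℚ * 1ℚ) + 1ℚ * (i - j)
      ≡⟨ solve 2 (λ y d → y :* (con 2ℚ :* con 1ℚ) :+ y :* (con 2ℚ :* con 1ℚ) :+ con 1ℚ :* d := con 1ℚ :* (con 4ℚ :* y :+ d)) refl y (i - j) ⟩
    1ℚ * (4ℚ * y + (i - j)) ∎)
    where open ≡-Reasoning

  odd-mixed : oddInv m * inv (N ℕ.∸ suc m) ≡ oddInv N * (2ℚ * oddInv m + inv (N ℕ.∸ suc m))
  odd-mixed = cancel-X (begin
    (2ℚ * a + x) * (y * i)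
      ≡⟨ solve 4 (λ a x y i → (con 2ℚ :* a :+ x) :* (y :* i) := con 2ℚ :* (a :* i) :* y :+ (x :* y) :* i) refl a x y i ⟩
    2ℚ * (a * i) * y + x * y * i
      ≡⟨ cong₂ (λ u v → 2ℚ * u * y + v * i) (ι-inv h) (ι-inv (2 ℕ.* m)) ⟩
    2ℚ * 1ℚ * y + 1ℚ * i
      ≡⟨ solve 2 (λ y i → con 2ℚ :* con 1ℚ :* y :+ con 1ℚ :* i := con 1ℚ :* (con 2ℚ :* y :+ i)) refl y i ⟩
    1ℚ * (2ℚ * y + i) ∎)
    where open ≡-Reasoning

index-sum : ∀ {N m} → m ℕ.< N → N ℕ.∸ suc m ℕ.+ (1 ℕ.+ 2 ℕ.* m) ≡ N ℕ.+ m
index-sum {N} {m} m<N = trans (solveℕ 2 (λ m h → h ⊕ (conℕ 1 ⊕ conℕ 2 ⊗ m) ⊜ conℕ 1 ⊕ m ⊕ h ⊕ m) refl m (N ℕ.∸ suc m))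
  (cong (ℕ._+ m) (ℕ.m+[n∸m]≡n m<N))

sgn-below : ∀ {N m} → m ℕ.< N → sgn (N ℕ.∸ suc m) ≡ - sgn (N ℕ.+ m)
sgn-below {N} {m} m<N = begin
  sgn h ≡⟨ solve 1 (λ s → s := :- (:- (s :* con 1ℚ))) refl (sgn h) ⟩
  - - (sgn h * 1ℚ) ≡⟨ cong (λ z → - - (sgn h * z)) (sgn-double m) ⟨
  - - (sgn h * sgn (2 ℕ.* m)) ≡⟨ cong -_ (neg-distribʳ-* (sgn h) (sgn (2 ℕ.* m))) ⟩
  - (sgn h * sgn (1 ℕ.+ 2 ℕ.* m)) ≡⟨ cong -_ (sgn-+ h (1 ℕ.+ 2 ℕ.* m)) ⟨
  - sgn (h ℕ.+ (1 ℕ.+ 2 ℕ.* m)) ≡⟨ cong (λ z → - sgn z) (index-sum m<N) ⟩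
  - sgn (N ℕ.+ m) ∎
  where
  open ≡-Reasoning
  h : ℕ
  h = N ℕ.∸ suc m

crossTerm-suc : ∀ {N m} → m ℕ.< N → crossTerm (suc N) m ≡
                crossTerm N m + sgn (N ℕ.+ m) * (inv (N ℕ.∸ suc m) + inv (N ℕ.+ m))
crossTerm-suc {N} {m} m<N = begin
  sumTo n (λ d → alternating (N ℕ.∸ m ℕ.+ d))
    ≡⟨ sumTo-cong n (λ d _ → cong (λ z → alternating (z ℕ.+ d)) N-m) ⟩
  sumTo n (λ d → alternating (suc h ℕ.+ d))
    ≡⟨ solve 2 (λ s a → s := s :+ a :- a) refl _ (alternating h) ⟩
  sumTo n (λ d → alternating (suc h ℕ.+ d)) + alternating h - alternating h
    ≡⟨ cong (_- alternating h) (sumTo-shift n alternating h) ⟩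
  crossTerm N m + alternating (h ℕ.+ n) - alternating h
    ≡⟨ cong₂ (λ u v → crossTerm N m + u * inv (h ℕ.+ n) - v * inv h) (cong sgn (index-sum m<N)) (sgn-below m<N) ⟩
  crossTerm N m + g * inv (h ℕ.+ n) - - g * inv h
    ≡⟨ cong (λ z → crossTerm N m + g * inv z - - g * inv h) (index-sum m<N) ⟩
  crossTerm N m + g * inv (N ℕ.+ m) - - g * inv h
    ≡⟨ solve 4 (λ c g i j → c :+ g :* j :- (:- g) :* i := c :+ g :* (i :+ j)) refl (crossTerm N m) g (inv h) (inv (N ℕ.+ m)) ⟩
  crossTerm N m + g * (inv h + inv (N ℕ.+ m)) ∎
  where
  open ≡-Reasoning
  n h : ℕ
  n = 1 ℕ.+ 2 ℕ.* m
  h = N ℕ.∸ suc m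
  g : ℚ
  g = sgn (N ℕ.+ m)
  N-≡ : suc m ℕ.+ h ≡ N
  N-≡ = ℕ.m+[n∸m]≡n m<N
  N-m : N ℕ.∸ m ≡ suc h
  N-m = trans (cong (ℕ._∸ m) (trans (sym N-≡) (sym (ℕ.+-suc m h)))) (ℕ.m+n∸m≡n m (suc h))

signed-difference : ∀ {N m} → m ℕ.< N → sgn (N ℕ.+ m) * (inv (N ℕ.∸ suc m) - inv (N ℕ.+ m)) ≡
                    - (alternating (N ℕ.∸ suc m) + alternating (N ℕ.+ m))
signed-difference {N} {m} m<N = trans
  (solve 3 (λ g i j → g :* (i :- j) := :- ((:- g) :* i :+ g :* j)) refl (sgn (N ℕ.+ m)) (inv (N ℕ.∸ suc m)) (inv (N ℕ.+ m)))
  (cong (λ z → - (z * inv (N ℕ.∸ suc m) + alternating (N ℕ.+ m))) (sym (sgn-below m<N)))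

-- By `odd-odd` the old terms change by multiples of the Leibniz terms and by alternating terms. The
-- latter add up to -Y S and cancel against the new term Y (S + Y) at m = N, which leaves Y².
crossSum-suc : ∀ N → crossSum (suc N) ≡ crossSum N + 4ℚ * (sgn N * oddInv N * leibnizSum N) + oddInv N * oddInv N
crossSum-suc N = begin
  crossSum (suc N)
    ≡⟨ sumTo-snoc N (λ m → oddInv m * crossTerm (suc N) m) ⟩
  sumTo N (λ m → oddInv m * crossTerm (suc N) m) + Y * crossTerm (suc N) N
    ≡⟨ cong₂ (λ u v → u + Y * v) (sumTo-cong N pointwise) last ⟩
  sumTo N (λ m → oddInv m * crossTerm N m + (4ℚ * Y * sgn N * (sgn m * oddInv m) + - Y * (alternating (N ℕ.∸ suc m) + alternating (N ℕ.+ m)))) +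
    Y * (S + Y)
    ≡⟨ cong (_+ Y * (S + Y)) (trans (sumTo-+ N (λ m → oddInv m * crossTerm N m)
           (λ m → 4ℚ * Y * sgn N * (sgn m * oddInv m) + - Y * (alternating (N ℕ.∸ suc m) + alternating (N ℕ.+ m)))) (cong (crossSum N +_) sums)) ⟩
  crossSum N + (4ℚ * Y * sgn N * leibnizSum N + - Y * S) + Y * (S + Y)
    ≡⟨ solve 5 (λ c y s l S → c :+ (con 4ℚ :* y :* s :* l :+ (:- y) :* S) :+ y :* (S :+ y) := c :+ con 4ℚ :* (s :* y :* l) :+ y :* y)
         refl (crossSum N) Y (sgn N) (leibnizSum N) S ⟩
  crossSum N + 4ℚ * (sgn N * Y * leibnizSum N) + Y * Y ∎
  where
  open ≡-Reasoning
  Y S : ℚ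
  Y = oddInv N
  S = sumTo (2 ℕ.* N) alternating
  last : crossTerm (suc N) N ≡ S + Y
  last = begin
    sumTo (1 ℕ.+ 2 ℕ.* N) (λ i → alternating (N ℕ.∸ N ℕ.+ i)) ≡⟨ sumTo-cong (1 ℕ.+ 2 ℕ.* N) (λ i _ → cong (λ z → alternating (z ℕ.+ i)) (ℕ.n∸n≡0 N)) ⟩
    sumTo (1 ℕ.+ 2 ℕ.* N) alternating ≡⟨ sumTo-snoc (2 ℕ.* N) alternating ⟩
    S + sgn (2 ℕ.* N) * Y ≡⟨ cong (λ z → S + z * Y) (sgn-double N) ⟩
    S + 1ℚ * Y ≡⟨ cong (S +_) (*-identityˡ Y) ⟩
    S + Y ∎
  pointwise : ∀ m → m ℕ.< N → oddInv m * crossTerm (suc N) m ≡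
    oddInv m * crossTerm N m + (4ℚ * Y * sgn N * (sgn m * oddInv m) + - Y * (alternating (N ℕ.∸ suc m) + alternating (N ℕ.+ m)))
  pointwise m m<N = begin
    y * crossTerm (suc N) m
      ≡⟨ cong (y *_) (crossTerm-suc m<N) ⟩
    y * (crossTerm N m + g * (i + j))
      ≡⟨ solve 4 (λ y c g s → y :* (c :+ g :* s) := y :* c :+ g :* (y :* s)) refl y (crossTerm N m) g (i + j) ⟩
    y * crossTerm N m + g * (y * (i + j))
      ≡⟨ cong (λ z → y * crossTerm N m + g * z) (odd-odd m<N) ⟩
    y * crossTerm N m + g * (Y * (4ℚ * y + (i - j)))
      ≡⟨ solve 5 (λ c g Y y d → c :+ g :* (Y :* (con 4ℚ :* y :+ d)) := c :+ (con 4ℚ :* Y :* (g :* y) :+ Y :* (g :* d))) refl (y * crossTerm N m) g Y y (i - j) ⟩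
    y * crossTerm N m + (4ℚ * Y * (g * y) + Y * (g * (i - j)))
      ≡⟨ cong₂ (λ u v → y * crossTerm N m + (4ℚ * Y * (u * y) + Y * v)) (sgn-+ N m) (signed-difference m<N) ⟩
    y * crossTerm N m + (4ℚ * Y * (sgn N * sgn m * y) + Y * - (alternating (N ℕ.∸ suc m) + alternating (N ℕ.+ m)))
      ≡⟨ solve 6 (λ c Y s t y a → c :+ (con 4ℚ :* Y :* (s :* t :* y) :+ Y :* (:- a)) := c :+ (con 4ℚ :* Y :* s :* (t :* y) :+ (:- Y) :* a))
           refl (y * crossTerm N m) Y (sgn N) (sgn m) y (alternating (N ℕ.∸ suc m) + alternating (N ℕ.+ m)) ⟩
    y * crossTerm N m + (4ℚ * Y * sgn N * (sgn m * y) + - Y * (alternating (N ℕ.∸ suc m) + alternating (N ℕ.+ m))) ∎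
    where
    y g i j : ℚ
    y = oddInv m
    g = sgn (N ℕ.+ m)
    i = inv (N ℕ.∸ suc m)
    j = inv (N ℕ.+ m)
  sums : sumTo N (λ m → 4ℚ * Y * sgn N * (sgn m * oddInv m) + - Y * (alternating (N ℕ.∸ suc m) + alternating (N ℕ.+ m))) ≡
         4ℚ * Y * sgn N * leibnizSum N + - Y * S
  sums = begin
    sumTo N (λ m → 4ℚ * Y * sgn N * (sgn m * oddInv m) + - Y * (alternating (N ℕ.∸ suc m) + alternating (N ℕ.+ m)))
      ≡⟨ sumTo-+ N (λ m → 4ℚ * Y * sgn N * (sgn m * oddInv m)) (λ m → - Y * (alternating (N ℕ.∸ suc m) + alternating (N ℕ.+ m))) ⟩
    sumTo N (λ m → 4ℚ * Y * sgn N * (sgn m * oddInv m)) + sumTo N (λ m → - Y * (alternating (N ℕ.∸ suc m) + alternating (N ℕ.+ m)))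
      ≡⟨ cong₂ _+_ (trans (sumTo-* N (4ℚ * Y * sgn N) (λ m → sgn m * oddInv m)) (cong (4ℚ * Y * sgn N *_) (sym (leibnizSum-≡ N))))
           (trans (sumTo-* N (- Y) (λ m → alternating (N ℕ.∸ suc m) + alternating (N ℕ.+ m))) (cong (- Y *_) pairs)) ⟩
    4ℚ * Y * sgn N * leibnizSum N + - Y * S ∎
    where
    pairs : sumTo N (λ m → alternating (N ℕ.∸ suc m) + alternating (N ℕ.+ m)) ≡ S
    pairs = begin
      sumTo N (λ m → alternating (N ℕ.∸ suc m) + alternating (N ℕ.+ m))
        ≡⟨ sumTo-+ N (λ m → alternating (N ℕ.∸ suc m)) (λ m → alternating (N ℕ.+ m)) ⟩
      sumTo N (λ m → alternating (N ℕ.∸ suc m)) + sumTo N (λ m → alternating (N ℕ.+ m))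
        ≡⟨ cong (_+ sumTo N (λ m → alternating (N ℕ.+ m))) (sumTo-reverse N alternating) ⟩
      sumTo N alternating + sumTo N (λ m → alternating (N ℕ.+ m))
        ≡⟨ sumTo-split N N alternating ⟨
      sumTo (N ℕ.+ N) alternating
        ≡⟨ cong (λ z → sumTo (N ℕ.+ z) alternating) (ℕ.+-identityʳ N) ⟨
      S ∎

leibniz-square : ∀ N → 2ℚ * (leibnizSum N * leibnizSum N) ≡ oddSquares N + crossSum N
leibniz-square zero    = refl
leibniz-square (suc N) = begin
  2ℚ * ((l + leibnizTerm N) * (l + leibnizTerm N))
    ≡⟨ cong (λ z → 2ℚ * ((l + z) * (l + z))) (signed-/ N (2 ℕ.* N)) ⟩
  2ℚ * ((l + s * Y) * (l + s * Y))
    ≡⟨ solve 3 (λ l s y → con 2ℚ :* ((l :+ s :* y) :* (l :+ s :* y)) := con 2ℚ :* (l :* l) :+ con 4ℚ :* (s :* y :* l) :+ con 2ℚ :* ((s :* s) :* (y :* y))) refl l s Y ⟩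
  2ℚ * (l * l) + 4ℚ * (s * Y * l) + 2ℚ * ((s * s) * (Y * Y))
    ≡⟨ cong₂ (λ u v → u + 4ℚ * (s * Y * l) + 2ℚ * (v * (Y * Y))) (leibniz-square N) (sgn² N) ⟩
  oddSquares N + crossSum N + 4ℚ * (s * Y * l) + 2ℚ * (1ℚ * (Y * Y))
    ≡⟨ solve 4 (λ o c t y → o :+ c :+ t :+ con 2ℚ :* (con 1ℚ :* y) := (o :+ y) :+ (c :+ t :+ y)) refl (oddSquares N) (crossSum N) (4ℚ * (s * Y * l)) (Y * Y) ⟩
  (oddSquares N + Y * Y) + (crossSum N + 4ℚ * (s * Y * l) + Y * Y)
    ≡⟨ cong₂ _+_ (sumTo-snoc N (λ j → oddInv j * oddInv j)) (crossSum-suc N) ⟨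
  oddSquares (suc N) + crossSum (suc N) ∎
  where
  open ≡-Reasoning
  l s Y : ℚ
  l = leibnizSum N
  s = sgn N
  Y = oddInv N

-- An alternating sum is at most its first term, here 1/(N - m). Then `odd-mixed` extracts the
-- factor 1/(2N + 1) and leaves harmonic sums.
∣crossSum∣≤ : ∀ N → ∣ crossSum N ∣ ≤ oddInv N * (3ℚ * harmonic N)
∣crossSum∣≤ N = begin
  ∣ crossSum N ∣
    ≤⟨ ∣sumTo∣≤ N (λ m → oddInv m * crossTerm N m) ⟩
  sumTo N (λ m → ∣ oddInv m * crossTerm N m ∣)
    ≤⟨ sumTo-mono N (λ m m<N → ≤-trans (≤-reflexive (∣c*p∣ (crossTerm N m) (0≤inv (2 ℕ.* m))))
         (≤-trans (*-monoˡ (0≤inv (2 ℕ.* m)) (∣sumTo-alternating∣≤ (N ℕ.∸ suc m) (1 ℕ.+ 2 ℕ.* m)))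
           (≤-trans (≤-reflexive (odd-mixed m<N)) (*-monoˡ (0≤inv (2 ℕ.* N))
             (+-monoˡ-≤ (inv (N ℕ.∸ suc m)) (*-monoˡ (0≤ι 2) (inv-antitone (ℕ.m≤m+n m (m ℕ.+ 0))))))))) ⟩
  sumTo N (λ m → oddInv N * (2ℚ * inv m + inv (N ℕ.∸ suc m)))
    ≡⟨ trans (sumTo-* N (oddInv N) (λ m → 2ℚ * inv m + inv (N ℕ.∸ suc m))) (cong (oddInv N *_) (begin-equality
         sumTo N (λ m → 2ℚ * inv m + inv (N ℕ.∸ suc m)) ≡⟨ sumTo-+ N (λ m → 2ℚ * inv m) (λ m → inv (N ℕ.∸ suc m)) ⟩
         sumTo N (λ m → 2ℚ * inv m) + sumTo N (λ m → inv (N ℕ.∸ suc m)) ≡⟨ cong₂ _+_ (sumTo-* N 2ℚ inv) (sumTo-reverse N inv) ⟩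
         2ℚ * harmonic N + harmonic N ≡⟨ solve 1 (λ h → con 2ℚ :* h :+ h := con 3ℚ :* h) refl (harmonic N) ⟩
         3ℚ * harmonic N ∎)) ⟩
  oddInv N * (3ℚ * harmonic N) ∎
  where open ≤-Reasoning

crossSum-small : ∀ E N → 3 ℕ.* (E ℕ.* E) ℕ.≤ N → ι E * ∣ crossSum N ∣ ≤ 2ℚ
crossSum-small E N large = *-cancelˡ-≤ι 1 (begin
  2ℚ * (ι E * ∣ crossSum N ∣)
    ≤⟨ *-monoˡ (0≤ι 2) (*-monoˡ (0≤ι E) (∣crossSum∣≤ N)) ⟩
  2ℚ * (ι E * (Y * (3ℚ * harmonic N)))
    ≡⟨ solve 3 (λ e y h → con 2ℚ :* (e :* (y :* (con 3ℚ :* h))) := con (ι 6) :* y :* (e :* h)) refl (ι E) Y (harmonic N) ⟩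
  ι 6 * Y * (ι E * harmonic N)
    ≤⟨ *-monoˡ (0≤* (0≤ι 6) (0≤inv (2 ℕ.* N))) (harmonic-sublinear E N) ⟩
  ι 6 * Y * (ι N + ι E * ι E)
    ≡⟨ solve 3 (λ y n e → con (ι 6) :* y :* (n :+ e) := con 3ℚ :* ((con 2ℚ :* n) :* y) :+ con 2ℚ :* ((con 3ℚ :* e) :* y)) refl Y (ι N) (ι E * ι E) ⟩
  3ℚ * ((2ℚ * ι N) * Y) + 2ℚ * ((3ℚ * (ι E * ι E)) * Y)
    ≤⟨ +-mono-≤ (*-monoˡ (0≤ι 3) 2NY≤1) (*-monoˡ (0≤ι 2) (*-monoʳ (0≤inv (2 ℕ.* N)) 3E²≤N)) ⟩
  3ℚ * 1ℚ + 2ℚ * (ι N * Y)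
    ≡⟨ solve 2 (λ n y → con 3ℚ :* con 1ℚ :+ con 2ℚ :* (n :* y) := con 3ℚ :+ (con 2ℚ :* n) :* y) refl (ι N) Y ⟩
  3ℚ + (2ℚ * ι N) * Y
    ≤⟨ +-monoʳ-≤ 3ℚ 2NY≤1 ⟩
  2ℚ * 2ℚ ∎)
  where
  open ≤-Reasoning
  Y : ℚ
  Y = oddInv N
  2NY≤1 : (2ℚ * ι N) * Y ≤ 1ℚ
  2NY≤1 = ≤-trans (*-monoʳ (0≤inv (2 ℕ.* N)) (≤-by {2ℚ * ι N} 1ℚ 0≤1 (trans (cong (λ z → 1ℚ + z) (ι-* 2 N)) (+-comm 1ℚ (2ℚ * ι N)))))
                  (≤-reflexive (ι-inv (2 ℕ.* N)))
  3E²≤N : 3ℚ * (ι E * ι E) ≤ ι N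
  3E²≤N = ≤-trans (≤-reflexive (sym (trans (ι-* 3 (E ℕ.* E)) (cong (3ℚ *_) (ι-* E E))))) (ι-mono large)

leibniz-ζ : ∀ D → ∃[ M ] ∀ {n m} → M ℕ.≤ n → M ℕ.≤ m →
            ι D * ∣ ι 8 * (leibnizSum n * leibnizSum n) - 3ℚ * ζ m ∣ ≤ 2ℚ
leibniz-ζ D = M , λ {n} {m} M≤n M≤m → bound M≤n M≤m
  where
  -- After doubling, `8 * D` is the factor of `crossSum` and 2 times `5 * D` that of the ζ tails
  -- (four at 2n, one at n). Each of the two contributions is at most 2.
  E c M : ℕ
  E = 8 ℕ.* D
  c = 5 ℕ.* D
  M = suc c ℕ.+ 3 ℕ.* (E ℕ.* E)
  bound : ∀ {n m} → M ℕ.≤ n → M ℕ.≤ m → ι D * ∣ ι 8 * (leibnizSum n * leibnizSum n) - 3ℚ * ζ m ∣ ≤ 2ℚ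
  bound {n} {m} M≤n M≤m = *-cancelˡ-≤ι 1 (begin
    2ℚ * (ι D * ∣ ι 8 * (leibnizSum n * leibnizSum n) - 3ℚ * ζ m ∣)
      ≡⟨ cong (λ z → 2ℚ * (ι D * ∣ z ∣)) split ⟩
    2ℚ * (ι D * ∣ 4ℚ * W + 4ℚ * (ζ (2 ℕ.* n) - ζ m) - (ζ n - ζ m) ∣)
      ≤⟨ *-monoˡ (0≤ι 2) (*-monoˡ (0≤ι D) (≤-trans (∣p-q∣≤∣p∣+∣q∣ (4ℚ * W + 4ℚ * (ζ (2 ℕ.* n) - ζ m)) (ζ n - ζ m))
           (+-monoˡ-≤ ∣ ζ n - ζ m ∣ (∣p+q∣≤∣p∣+∣q∣ (4ℚ * W) (4ℚ * (ζ (2 ℕ.* n) - ζ m)))))) ⟩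
    2ℚ * (ι D * (∣ 4ℚ * W ∣ + ∣ 4ℚ * (ζ (2 ℕ.* n) - ζ m) ∣ + ∣ ζ n - ζ m ∣))
      ≡⟨ cong₂ (λ u v → 2ℚ * (ι D * (u + v + ∣ ζ n - ζ m ∣))) (∣c*p∣ W (0≤ι 4)) (∣c*p∣ (ζ (2 ℕ.* n) - ζ m) (0≤ι 4)) ⟩
    2ℚ * (ι D * (4ℚ * ∣ W ∣ + 4ℚ * ∣ ζ (2 ℕ.* n) - ζ m ∣ + ∣ ζ n - ζ m ∣))
      ≤⟨ *-monoˡ (0≤ι 2) (*-monoˡ (0≤ι D) (+-mono-≤ (+-monoʳ-≤ (4ℚ * ∣ W ∣) (*-monoˡ (0≤ι 4) (ζ-close c<2n c<m))) (ζ-close c<n c<m))) ⟩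
    2ℚ * (ι D * (4ℚ * ∣ W ∣ + 4ℚ * inv c + inv c))
      ≡⟨ solve 3 (λ d w i → con 2ℚ :* (d :* (con 4ℚ :* w :+ con 4ℚ :* i :+ i)) := (con (ι 8) :* d) :* w :+ con 2ℚ :* ((con (ι 5) :* d) :* i)) refl (ι D) ∣ W ∣ (inv c) ⟩
    (ι 8 * ι D) * ∣ W ∣ + 2ℚ * ((ι 5 * ι D) * inv c)
      ≡⟨ cong₂ (λ u v → u * ∣ W ∣ + 2ℚ * (v * inv c)) (ι-* 8 D) (ι-* 5 D) ⟨
    ι E * ∣ W ∣ + 2ℚ * (ι c * inv c)
      ≤⟨ +-mono-≤ (crossSum-small E n (ℕ.≤-trans (ℕ.m≤n+m (3 ℕ.* (E ℕ.* E)) (suc c)) M≤n))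
           (*-monoˡ (0≤ι 2) (≤-trans (*-monoʳ (0≤inv c) (ι-mono (ℕ.n≤1+n c))) (≤-reflexive (ι-inv c)))) ⟩
    2ℚ * 2ℚ ∎)
    where
    open ≤-Reasoning
    W : ℚ
    W = crossSum n
    c<n : suc c ℕ.≤ n
    c<n = ℕ.≤-trans (ℕ.m≤m+n (suc c) (3 ℕ.* (E ℕ.* E))) M≤n
    c<m : suc c ℕ.≤ m
    c<m = ℕ.≤-trans (ℕ.m≤m+n (suc c) (3 ℕ.* (E ℕ.* E))) M≤m
    c<2n : suc c ℕ.≤ 2 ℕ.* n
    c<2n = ℕ.≤-trans c<n (ℕ.m≤m+n n (n ℕ.+ 0))
    split : ι 8 * (leibnizSum n * leibnizSum n) - 3ℚ * ζ m ≡ 4ℚ * W + 4ℚ * (ζ (2 ℕ.* n) - ζ m) - (ζ n - ζ m)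
    split = begin-equality
      ι 8 * (leibnizSum n * leibnizSum n) - 3ℚ * ζ m
        ≡⟨ solve 2 (λ l z → con (ι 8) :* l :- con 3ℚ :* z := con 4ℚ :* (con 2ℚ :* l) :- con 3ℚ :* z) refl (leibnizSum n * leibnizSum n) (ζ m) ⟩
      4ℚ * (2ℚ * (leibnizSum n * leibnizSum n)) - 3ℚ * ζ m
        ≡⟨ cong (λ z → 4ℚ * z - 3ℚ * ζ m) (leibniz-square n) ⟩
      4ℚ * (oddSquares n + W) - 3ℚ * ζ m
        ≡⟨ solve 4 (λ o w z ζ → con 4ℚ :* (o :+ w) :- con 3ℚ :* ζ := con 4ℚ :* w :+ ((con 4ℚ :* o :+ z) :- con 4ℚ :* ζ) :- (z :- ζ)) refl (oddSquares n) W (ζ n) (ζ m) ⟩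
      4ℚ * W + ((4ℚ * oddSquares n + ζ n) - 4ℚ * ζ m) - (ζ n - ζ m)
        ≡⟨ cong (λ z → 4ℚ * W + (z - 4ℚ * ζ m) - (ζ n - ζ m)) (ζ-even n) ⟨
      4ℚ * W + (4ℚ * ζ (2 ℕ.* n) - 4ℚ * ζ m) - (ζ n - ζ m)
        ≡⟨ solve 4 (λ w a b d → con 4ℚ :* w :+ (con 4ℚ :* a :- con 4ℚ :* b) :- d := con 4ℚ :* w :+ con 4ℚ :* (a :- b) :- d) refl W (ζ (2 ℕ.* n)) (ζ m) (ζ n - ζ m) ⟩
      4ℚ * W + 4ℚ * (ζ (2 ℕ.* n) - ζ m) - (ζ n - ζ m) ∎

-- The density of coprime pairs

sq : ℕ → ℚ
sq n = ι n * ι n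

0≤sq : ∀ n → 0ℚ ≤ sq n
0≤sq n = 0≤* (0≤ι n) (0≤ι n)

sq-mono : ∀ {a b} → a ℕ.≤ b → sq a ≤ sq b
sq-mono {a} {b} a≤b = *-mono (0≤ι a) (0≤ι b) (ι-mono a≤b) (ι-mono a≤b)

coprimesℚ : ℕ → ℚ
coprimesℚ m = ι (coprimes m)

ι-sumℕ : ∀ n f → ι (sumℕ n f) ≡ sumTo n (λ i → ι (f i))
ι-sumℕ zero    f = refl
ι-sumℕ (suc n) f = trans (ι-+ (f 0) (sumℕ n (λ i → f (suc i)))) (cong (ι (f 0) +_) (ι-sumℕ n (λ i → f (suc i))))

coprimesℚ-sum : ∀ m → 2ℚ * sumTo m (λ d → coprimesℚ (m ℕ./ suc d)) ≡ sq m + ι m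
coprimesℚ-sum m = begin
  2ℚ * sumTo m (λ d → coprimesℚ (m ℕ./ suc d)) ≡⟨ cong (2ℚ *_) (ι-sumℕ m (λ d → coprimes (m ℕ./ suc d))) ⟨
  2ℚ * ι (sumℕ m (λ d → coprimes (m ℕ./ suc d))) ≡⟨ ι-* 2 (sumℕ m (λ d → coprimes (m ℕ./ suc d))) ⟨
  ι (2 ℕ.* sumℕ m (λ d → coprimes (m ℕ./ suc d))) ≡⟨ cong ι (coprimes-sum m) ⟩
  ι (m ℕ.* m ℕ.+ m) ≡⟨ trans (ι-+ (m ℕ.* m) m) (cong (_+ ι m) (ι-* m m)) ⟩
  sq m + ι m ∎
  where open ≡-Reasoning

module _ (m d : ℕ) where
  private
    q r x : ℚ
    q = ι (m ℕ./ suc d)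
    r = ι (m % suc d) * inv d
    x = ι m * inv d

    x-≡ : x ≡ r + q
    x-≡ = begin
      ι m * inv d ≡⟨ cong (λ z → ι z * inv d) (m≡m%n+[m/n]*n m (suc d)) ⟩
      ι (m % suc d ℕ.+ m ℕ./ suc d ℕ.* suc d) * inv d ≡⟨ cong (_* inv d) (trans (ι-+ (m % suc d) (m ℕ./ suc d ℕ.* suc d)) (cong (ι (m % suc d) +_) (ι-* (m ℕ./ suc d) (suc d)))) ⟩
      (ι (m % suc d) + q * ι (suc d)) * inv d ≡⟨ solve 4 (λ r q n i → (r :+ q :* n) :* i := r :* i :+ q :* (n :* i)) refl (ι (m % suc d)) q (ι (suc d)) (inv d) ⟩
      r + q * (ι (suc d) * inv d) ≡⟨ cong (r +_) (trans (cong (q *_) (ι-inv d)) (*-identityʳ q)) ⟩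
      r + q ∎
      where open ≡-Reasoning

    0≤r : 0ℚ ≤ r
    0≤r = 0≤* (0≤ι (m % suc d)) (0≤inv d)

    r≤1 : r ≤ 1ℚ
    r≤1 = ≤-trans (*-monoʳ (0≤inv d) (ι-mono (ℕ.<⇒≤ (m%n<n m (suc d))))) (≤-reflexive (ι-inv d))

    q≤x : q ≤ x
    q≤x = ≤-by r 0≤r (trans x-≡ (+-comm r q))

    0≤q : 0ℚ ≤ q
    0≤q = 0≤ι (m ℕ./ suc d)

    difference : x * x - q * q ≡ r * (x + q)
    difference = trans (solve 2 (λ x q → x :* x :- q :* q := (x :- q) :* (x :+ q)) refl x q)
      (cong (_* (x + q)) (trans (cong (_- q) x-≡) (solve 2 (λ r q → r :+ q :- q := r) refl r q)))

  floor-square : sq (m ℕ./ suc d) ≤ x * x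
  floor-square = *-mono 0≤q (≤-trans 0≤q q≤x) q≤x q≤x

  0≤floor-loss : 0ℚ ≤ x * x - sq (m ℕ./ suc d)
  0≤floor-loss = 0≤q-p floor-square

  -- The loss factors as r (x + q), where r is the fractional part of x.
  floor-loss≤ : x * x - sq (m ℕ./ suc d) ≤ 2ℚ * x
  floor-loss≤ = begin
    x * x - q * q ≡⟨ difference ⟩
    r * (x + q) ≤⟨ *-mono (0≤+ (≤-trans 0≤q q≤x) 0≤q) 0≤1 r≤1 (+-monoʳ-≤ x q≤x) ⟩
    1ℚ * (x + x) ≡⟨ solve 1 (λ x → con 1ℚ :* (x :+ x) := con 2ℚ :* x) refl x ⟩
    2ℚ * x ∎
    where open ≤-Reasoning

floorSquares : ℕ → ℚ
floorSquares m = sumTo m (λ d → sq (m ℕ./ suc d))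

scaled-ζ : ∀ m n → sq m * ζ n ≡ sumTo n (λ d → ι m * inv d * (ι m * inv d))
scaled-ζ m n = trans (sym (sumTo-* n (sq m) (λ d → inv d * inv d)))
  (sumTo-cong n (λ d _ → solve 2 (λ a i → a :* a :* (i :* i) := a :* i :* (a :* i)) refl (ι m) (inv d)))

floorLoss : ℕ → ℚ
floorLoss m = sq m * ζ m - floorSquares m

floorLoss-≡ : ∀ m → floorLoss m ≡ sumTo m (λ d → ι m * inv d * (ι m * inv d) - sq (m ℕ./ suc d))
floorLoss-≡ m = trans (cong (_- floorSquares m) (scaled-ζ m m)) (sym (sumTo-- m (λ d → ι m * inv d * (ι m * inv d)) (λ d → sq (m ℕ./ suc d))))

0≤floorLoss : ∀ m → 0ℚ ≤ floorLoss m
0≤floorLoss m = ≤-trans (0≤sumTo m (λ d _ → 0≤floor-loss m d)) (≤-reflexive (sym (floorLoss-≡ m)))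

floorLoss≤ : ∀ m → floorLoss m ≤ 2ℚ * (ι m * harmonic m)
floorLoss≤ m = begin
  floorLoss m ≡⟨ floorLoss-≡ m ⟩
  sumTo m (λ d → ι m * inv d * (ι m * inv d) - sq (m ℕ./ suc d)) ≤⟨ sumTo-mono m (λ d _ → floor-loss≤ m d) ⟩
  sumTo m (λ d → 2ℚ * (ι m * inv d)) ≡⟨ trans (sumTo-* m 2ℚ (λ d → ι m * inv d)) (cong (2ℚ *_) (sumTo-* m (ι m) inv)) ⟩
  2ℚ * (ι m * harmonic m) ∎
  where open ≤-Reasoning

-- Source of the contraction factor 2/3.
ζ-rest : ∀ m → 3ℚ * sumTo m (λ d → inv (suc d) * inv (suc d)) ≤ 2ℚ
ζ-rest m = begin
  3ℚ * s ≡⟨ solve 1 (λ s → con 3ℚ :* s := con 3ℚ :* (con 1ℚ :* con 1ℚ :+ s) :- con 3ℚ) refl s ⟩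
  3ℚ * (1ℚ * 1ℚ + s) - 3ℚ ≡⟨ cong (λ z → 3ℚ * (z * z + s) - 3ℚ) (trans (sym (*-identityˡ (inv 0))) (ι-inv 0)) ⟨
  3ℚ * ζ (suc m) - 3ℚ ≤⟨ +-monoˡ-≤ (- 3ℚ) (≤-trans (≤-by {3ℚ * ζ (suc m)} (ι 6 * inv (2 ℕ.* m ℕ.+ 2)) (0≤* (0≤ι 6) (0≤inv (2 ℕ.* m ℕ.+ 2))) refl) (ζ≤5/3 m)) ⟩
  2ℚ ∎
  where
  open ≤-Reasoning
  s : ℚ
  s = sumTo m (λ d → inv (suc d) * inv (suc d))

-- Absorbs a linear term at the price of one more `sq m` and a constant.
c*m≤ : ∀ c m → ι c * ι m ≤ sq m + sq c
c*m≤ c m with ℕ.≤-total c m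
... | inj₁ c≤m = ≤-trans (*-monoʳ (0≤ι m) (ι-mono c≤m)) (≤-by (sq c) (0≤sq c) refl)
... | inj₂ m≤c = ≤-trans (*-monoˡ (0≤ι c) (ι-mono m≤c)) (≤-by (sq m) (0≤sq m) (+-comm (sq m) (sq c)))

error : ℚ → ℕ → ℚ
error θ m = coprimesℚ m - θ * sq m

-- Sorting by gcd determines F = coprimesℚ at m from its values at m / 2, m / 3, …; as ζ(2) - 1 < 1 this
-- is a contraction for F m - θ m², and no Möbius inversion is needed.
module Contraction (D M₀ : ℕ) where

  record Admissible (θ : ℚ) : Set where
    field
      0≤θ   : 0ℚ ≤ θ
      θ≤1   : θ ≤ 1ℚ
      close : ∀ m → M₀ ℕ.≤ m → ι D * ∣ 1ℚ - 2ℚ * θ * ζ m ∣ ≤ 2ℚ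

  -- `K` is quantified before θ: one threshold for k must serve all terms of the sequence
  -- representing 3/π².
  Bound : ℕ → Set
  Bound j = ∃[ K ] ∀ θ → Admissible θ → ∀ m → ι D * ∣ error θ m ∣ ≤ ι (9 ℕ.+ j) * sq m + ι K

  error≤ : ∀ {θ} → Admissible θ → ∀ m → ∣ error θ m ∣ ≤ sq m
  error≤ {θ} admissible m = ∣p∣≤
    (≤-trans (≤-by (θ * sq m) 0≤θm² (solve 2 (λ f t → f := f :- t :+ t) refl (coprimesℚ m) (θ * sq m)))
      (≤-trans (ι-mono (coprimes≤ m)) (≤-reflexive (ι-* m m))))
    (≤-trans (≤-by (coprimesℚ m) (0≤ι (coprimes m)) (solve 2 (λ f t → t := (:- (f :- t)) :+ f) refl (coprimesℚ m) (θ * sq m)))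
      (≤-trans (*-monoʳ (0≤sq m) θ≤1) (≤-reflexive (*-identityˡ (sq m)))))
    where
    open Admissible admissible
    0≤θm² : 0ℚ ≤ θ * sq m
    0≤θm² = 0≤* 0≤θ (0≤sq m)

  remainder : ℚ → ℕ → ℚ
  remainder θ m = sumTo m (λ d → error θ (suc m ℕ./ suc (suc d)))

  error-recursion : ∀ θ m′ → let m = suc m′ in
    2ℚ * error θ m ≡ sq m * (1ℚ - 2ℚ * θ * ζ m) + ι m + 2ℚ * (θ * floorLoss m) - 2ℚ * remainder θ m′
  error-recursion θ m′ = begin
    2ℚ * error θ m
      ≡⟨ solve 2 (λ e r → con 2ℚ :* e := con 2ℚ :* (e :+ r) :- con 2ℚ :* r) refl (error θ m) (remainder θ m′) ⟩
    2ℚ * (error θ m + remainder θ m′) - 2ℚ * remainder θ m′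
      ≡⟨ cong (λ z → 2ℚ * z - 2ℚ * remainder θ m′) total ⟩
    2ℚ * (sumTo m (λ d → coprimesℚ (m ℕ./ suc d)) - θ * floorSquares m) - 2ℚ * remainder θ m′
      ≡⟨ solve 4 (λ s t q r → con 2ℚ :* (s :- t :* q) :- con 2ℚ :* r := con 2ℚ :* s :- con 2ℚ :* (t :* q) :- con 2ℚ :* r) refl (sumTo m (λ d → coprimesℚ (m ℕ./ suc d))) θ (floorSquares m) (remainder θ m′) ⟩
    2ℚ * sumTo m (λ d → coprimesℚ (m ℕ./ suc d)) - 2ℚ * (θ * floorSquares m) - 2ℚ * remainder θ m′
      ≡⟨ cong (λ z → z - 2ℚ * (θ * floorSquares m) - 2ℚ * remainder θ m′) (coprimesℚ-sum m) ⟩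
    sq m + ι m - 2ℚ * (θ * floorSquares m) - 2ℚ * remainder θ m′
      ≡⟨ solve 6 (λ s n t q r z → s :+ n :- con 2ℚ :* (t :* q) :- con 2ℚ :* r :=
           s :* (con 1ℚ :- con 2ℚ :* t :* z) :+ n :+ con 2ℚ :* (t :* (s :* z :- q)) :- con 2ℚ :* r)
           refl (sq m) (ι m) θ (floorSquares m) (remainder θ m′) (ζ m) ⟩
    sq m * (1ℚ - 2ℚ * θ * ζ m) + ι m + 2ℚ * (θ * floorLoss m) - 2ℚ * remainder θ m′ ∎
    where
    open ≡-Reasoning
    m : ℕ
    m = suc m′
    total : error θ m + remainder θ m′ ≡ sumTo m (λ d → coprimesℚ (m ℕ./ suc d)) - θ * floorSquares m
    total = begin
      error θ m + remainder θ m′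
        ≡⟨ cong (λ z → error θ z + remainder θ m′) (n/1≡n m) ⟨
      sumTo m (λ d → error θ (m ℕ./ suc d))
        ≡⟨ sumTo-- m (λ d → coprimesℚ (m ℕ./ suc d)) (λ d → θ * sq (m ℕ./ suc d)) ⟩
      sumTo m (λ d → coprimesℚ (m ℕ./ suc d)) - sumTo m (λ d → θ * sq (m ℕ./ suc d))
        ≡⟨ cong (λ z → sumTo m (λ d → coprimesℚ (m ℕ./ suc d)) - z) (sumTo-* m θ (λ d → sq (m ℕ./ suc d))) ⟩
      sumTo m (λ d → coprimesℚ (m ℕ./ suc d)) - θ * floorSquares m ∎

  module _ {θ} (admissible : Admissible θ) (m′ : ℕ) (M₀≤m : M₀ ℕ.≤ suc m′) where
    open Admissible admissible

    private
      m : ℕ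
      m = suc m′

    -- Of the coefficient 3, two come from `close` and one from the harmonic sum in the floor loss,
    -- by `harmonic-sublinear` with `4 * D`.
    2error≤ : 2ℚ * (ι D * ∣ error θ m ∣) ≤ 3ℚ * sq m + ι (D ℕ.+ 4 ℕ.* D ℕ.* (4 ℕ.* D)) * ι m + 2ℚ * (ι D * ∣ remainder θ m′ ∣)
    2error≤ = begin
      2ℚ * (ι D * ∣ error θ m ∣)
        ≡⟨ solve 2 (λ d e → con 2ℚ :* (d :* e) := d :* (con 2ℚ :* e)) refl (ι D) ∣ error θ m ∣ ⟩
      ι D * (2ℚ * ∣ error θ m ∣)
        ≡⟨ cong (ι D *_) (∣c*p∣ (error θ m) (0≤ι 2)) ⟨
      ι D * ∣ 2ℚ * error θ m ∣
        ≡⟨ cong (λ z → ι D * ∣ z ∣) (error-recursion θ m′) ⟩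
      ι D * ∣ a + ι m + b - 2ℚ * remainder θ m′ ∣
        ≤⟨ *-monoˡ (0≤ι D) (≤-trans (∣p-q∣≤∣p∣+∣q∣ (a + ι m + b) (2ℚ * remainder θ m′))
             (+-mono-≤ (≤-trans (∣p+q∣≤∣p∣+∣q∣ (a + ι m) b) (+-mono-≤ (≤-trans (∣p+q∣≤∣p∣+∣q∣ a (ι m))
               (+-mono-≤ (≤-reflexive (∣c*p∣ (1ℚ - 2ℚ * θ * ζ m) (0≤sq m))) (≤-reflexive (0≤p⇒∣p∣≡p (0≤ι m)))))
               b≤)) (≤-reflexive (∣c*p∣ (remainder θ m′) (0≤ι 2))))) ⟩
      ι D * (sq m * e + ι m + 4ℚ * (ι m * harmonic m) + 2ℚ * ∣ remainder θ m′ ∣)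
        ≡⟨ solve 6 (λ d s e n h r → d :* (s :* e :+ n :+ con 4ℚ :* (n :* h) :+ con 2ℚ :* r) :=
             s :* (d :* e) :+ d :* n :+ n :* ((con 4ℚ :* d) :* h) :+ con 2ℚ :* (d :* r)) refl (ι D) (sq m) e (ι m) (harmonic m) ∣ remainder θ m′ ∣ ⟩
      sq m * (ι D * e) + ι D * ι m + ι m * ((4ℚ * ι D) * harmonic m) + R
        ≡⟨ cong (λ z → sq m * (ι D * e) + ι D * ι m + ι m * (z * harmonic m) + R) (ι-* 4 D) ⟨
      sq m * (ι D * e) + ι D * ι m + ι m * (ι D₄ * harmonic m) + R
        ≤⟨ +-monoˡ-≤ R (+-mono-≤ (+-monoˡ-≤ (ι D * ι m) (*-monoˡ (0≤sq m) (close m M₀≤m)))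
             (*-monoˡ (0≤ι m) (harmonic-sublinear D₄ m))) ⟩
      sq m * 2ℚ + ι D * ι m + ι m * (ι m + ι D₄ * ι D₄) + R
        ≡⟨ solve 4 (λ n d e r → n :* n :* con 2ℚ :+ d :* n :+ n :* (n :+ e) :+ r := con 3ℚ :* (n :* n) :+ (d :+ e) :* n :+ r) refl (ι m) (ι D) (ι D₄ * ι D₄) R ⟩
      3ℚ * sq m + (ι D + ι D₄ * ι D₄) * ι m + R
        ≡⟨ cong (λ z → 3ℚ * sq m + z * ι m + R) (trans (ι-+ D (D₄ ℕ.* D₄)) (cong (ι D +_) (ι-* D₄ D₄))) ⟨
      3ℚ * sq m + ι (D ℕ.+ D₄ ℕ.* D₄) * ι m + R ∎
      where
      open ≤-Reasoning
      D₄ : ℕ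
      D₄ = 4 ℕ.* D
      a b e R : ℚ
      a = sq m * (1ℚ - 2ℚ * θ * ζ m)
      b = 2ℚ * (θ * floorLoss m)
      e = ∣ 1ℚ - 2ℚ * θ * ζ m ∣
      R = 2ℚ * (ι D * ∣ remainder θ m′ ∣)
      b≤ : ∣ b ∣ ≤ 4ℚ * (ι m * harmonic m)
      b≤ = begin
        ∣ b ∣ ≡⟨ 0≤p⇒∣p∣≡p (0≤* (0≤ι 2) (0≤* 0≤θ (0≤floorLoss m))) ⟩
        2ℚ * (θ * floorLoss m) ≤⟨ *-monoˡ (0≤ι 2) (*-mono (0≤floorLoss m) 0≤1 θ≤1 (floorLoss≤ m)) ⟩
        2ℚ * (1ℚ * (2ℚ * (ι m * harmonic m))) ≡⟨ solve 1 (λ h → con 2ℚ :* (con 1ℚ :* (con 2ℚ :* h)) := con 4ℚ :* h) refl (ι m * harmonic m) ⟩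
        4ℚ * (ι m * harmonic m) ∎

    remainder≤ : ∀ {A K} → 0ℚ ≤ A → (∀ x → ι D * ∣ error θ x ∣ ≤ A * sq x + ι K) →
                 3ℚ * (ι D * ∣ remainder θ m′ ∣) ≤ 2ℚ * A * sq m + 3ℚ * ι K * ι m
    remainder≤ {A} {K} 0≤A bound = begin
      3ℚ * (ι D * ∣ remainder θ m′ ∣)
        ≤⟨ *-monoˡ (0≤ι 3) (*-monoˡ (0≤ι D) (∣sumTo∣≤ m′ (λ d → error θ (m ℕ./ suc (suc d))))) ⟩
      3ℚ * (ι D * sumTo m′ (λ d → ∣ error θ (m ℕ./ suc (suc d)) ∣))
        ≡⟨ cong (3ℚ *_) (sumTo-* m′ (ι D) (λ d → ∣ error θ (m ℕ./ suc (suc d)) ∣)) ⟨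
      3ℚ * sumTo m′ (λ d → ι D * ∣ error θ (m ℕ./ suc (suc d)) ∣)
        ≤⟨ *-monoˡ (0≤ι 3) (sumTo-mono m′ (λ d _ → ≤-trans (bound (m ℕ./ suc (suc d)))
             (+-monoˡ-≤ (ι K) (≤-trans (*-monoˡ 0≤A (floor-square m (suc d))) (≤-reflexive (solve 3 (λ a n i → a :* (n :* i :* (n :* i)) := a :* (n :* n) :* (i :* i)) refl A (ι m) (inv (suc d)))))))) ⟩
      3ℚ * sumTo m′ (λ d → A * sq m * (inv (suc d) * inv (suc d)) + ι K)
        ≡⟨ cong (3ℚ *_) (trans (sumTo-+ m′ (λ d → A * sq m * (inv (suc d) * inv (suc d))) (λ _ → ι K))
             (cong₂ _+_ (sumTo-* m′ (A * sq m) (λ d → inv (suc d) * inv (suc d))) (sumTo-const m′ (ι K)))) ⟩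
      3ℚ * (A * sq m * s + ι m′ * ι K)
        ≡⟨ solve 5 (λ A n s m k → con 3ℚ :* (A :* n :* s :+ m :* k) := (con 3ℚ :* s) :* (A :* n) :+ con 3ℚ :* k :* m) refl A (sq m) s (ι m′) (ι K) ⟩
      3ℚ * s * (A * sq m) + 3ℚ * ι K * ι m′
        ≤⟨ +-mono-≤ (*-monoʳ (0≤* 0≤A (0≤sq m)) (ζ-rest m′)) (*-monoˡ (0≤* (0≤ι 3) (0≤ι K)) (ι-mono (ℕ.n≤1+n m′))) ⟩
      2ℚ * (A * sq m) + 3ℚ * ι K * ι m
        ≡⟨ cong (_+ 3ℚ * ι K * ι m) (*-assoc 2ℚ A (sq m)) ⟨
      2ℚ * A * sq m + 3ℚ * ι K * ι m ∎
      where
      open ≤-Reasoning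
      s : ℚ
      s = sumTo m′ (λ d → inv (suc d) * inv (suc d))

  -- The recursion turns the coefficient A of m² into (2A + 5)/3, which is at most A - 1 once A ≥ 8;
  -- here A = 10 + j. Linear terms and small `m` are paid for by a larger constant.
  improve : ∀ j → Bound (suc j) → Bound j
  improve j (K , bound) = K′ , bound′
    where
    c K′ M₁ : ℕ
    c = 3 ℕ.* (D ℕ.+ 4 ℕ.* D ℕ.* (4 ℕ.* D)) ℕ.+ 6 ℕ.* K
    M₁ = suc M₀
    K′ = D ℕ.* (M₁ ℕ.* M₁) ℕ.+ c ℕ.* c
    K′-≡ : ι K′ ≡ ι D * sq M₁ + sq c
    K′-≡ = trans (ι-+ (D ℕ.* (M₁ ℕ.* M₁)) (c ℕ.* c)) (cong₂ _+_ (trans (ι-* D (M₁ ℕ.* M₁)) (cong (ι D *_) (ι-* M₁ M₁))) (ι-* c c))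
    9+j : ι (9 ℕ.+ j) ≡ ι 9 + ι j
    9+j = ι-+ 9 j
    bound′ : ∀ θ → Admissible θ → ∀ m → ι D * ∣ error θ m ∣ ≤ ι (9 ℕ.+ j) * sq m + ι K′
    bound′ θ admissible m with ℕ.≤-<-connex m M₁
    ... | inj₁ m≤M₁ = begin
      ι D * ∣ error θ m ∣ ≤⟨ *-monoˡ (0≤ι D) (≤-trans (error≤ admissible m) (sq-mono m≤M₁)) ⟩
      ι D * sq M₁ ≤⟨ ≤-by (ι (9 ℕ.+ j) * sq m + sq c) (0≤+ (0≤* (0≤ι (9 ℕ.+ j)) (0≤sq m)) (0≤sq c))
                                        (trans (cong (ι (9 ℕ.+ j) * sq m +_) K′-≡) (solve 3 (λ a b c → a :+ (b :+ c) := b :+ (a :+ c)) refl (ι (9 ℕ.+ j) * sq m) (ι D * sq M₁) (sq c))) ⟩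
      ι (9 ℕ.+ j) * sq m + ι K′ ∎
      where open ≤-Reasoning
    bound′ θ admissible (suc m′) | inj₂ M₁<m = *-cancelˡ-≤ι 5 (begin
      ι 6 * (ι D * ∣ error θ m ∣)
        ≡⟨ solve 1 (λ e → con (ι 6) :* e := con 3ℚ :* (con 2ℚ :* e)) refl (ι D * ∣ error θ m ∣) ⟩
      3ℚ * (2ℚ * (ι D * ∣ error θ m ∣))
        ≤⟨ *-monoˡ (0≤ι 3) (2error≤ admissible m′ M₀≤m) ⟩
      3ℚ * (3ℚ * sq m + ι B * ι m + 2ℚ * (ι D * r))
        ≡⟨ solve 4 (λ s b n x → con 3ℚ :* (con 3ℚ :* s :+ b :* n :+ con 2ℚ :* x) := con (ι 9) :* s :+ con 3ℚ :* b :* n :+ con 2ℚ :* (con 3ℚ :* x)) refl (sq m) (ι B) (ι m) (ι D * r) ⟩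
      ι 9 * sq m + 3ℚ * ι B * ι m + 2ℚ * (3ℚ * (ι D * r))
        ≤⟨ +-monoʳ-≤ (ι 9 * sq m + 3ℚ * ι B * ι m) (*-monoˡ (0≤ι 2)
             (remainder≤ admissible m′ M₀≤m {ι (9 ℕ.+ suc j)} {K} (0≤ι (9 ℕ.+ suc j)) (bound θ admissible))) ⟩
      ι 9 * sq m + 3ℚ * ι B * ι m + 2ℚ * (2ℚ * ι (9 ℕ.+ suc j) * sq m + 3ℚ * ι K * ι m)
        ≡⟨ cong (λ z → ι 9 * sq m + 3ℚ * ι B * ι m + 2ℚ * (2ℚ * z * sq m + 3ℚ * ι K * ι m)) (trans (cong ι (ℕ.+-suc 9 j)) (ι-+ 10 j)) ⟩
      ι 9 * sq m + 3ℚ * ι B * ι m + 2ℚ * (2ℚ * (ι 10 + ι j) * sq m + 3ℚ * ι K * ι m)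
        ≡⟨ solve 5 (λ s b n k j → con (ι 9) :* s :+ con 3ℚ :* b :* n :+ con 2ℚ :* (con 2ℚ :* (con (ι 10) :+ j) :* s :+ con 3ℚ :* k :* n) :=
             (con (ι 49) :+ con 4ℚ :* j) :* s :+ (con 3ℚ :* b :+ con (ι 6) :* k) :* n) refl (sq m) (ι B) (ι m) (ι K) (ι j) ⟩
      (ι 49 + 4ℚ * ι j) * sq m + (3ℚ * ι B + ι 6 * ι K) * ι m
        ≡⟨ cong (λ z → (ι 49 + 4ℚ * ι j) * sq m + z * ι m) (trans (ι-+ (3 ℕ.* B) (6 ℕ.* K)) (cong₂ _+_ (ι-* 3 B) (ι-* 6 K))) ⟨
      (ι 49 + 4ℚ * ι j) * sq m + ι c * ι m
        ≤⟨ +-monoʳ-≤ ((ι 49 + 4ℚ * ι j) * sq m) (c*m≤ c m) ⟩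
      (ι 49 + 4ℚ * ι j) * sq m + (sq m + sq c)
        ≤⟨ ≤-by ((4ℚ + 2ℚ * ι j) * sq m + (ι 5 * sq c + ι 6 * (ι D * sq M₁)))
             (0≤+ (0≤* (0≤+ (0≤ι 4) (0≤* (0≤ι 2) (0≤ι j))) (0≤sq m)) (0≤+ (0≤* (0≤ι 5) (0≤sq c)) (0≤* (0≤ι 6) (0≤* (0≤ι D) (0≤sq M₁)))))
             (solve 4 (λ j s c d → con (ι 6) :* ((con (ι 9) :+ j) :* s :+ (d :+ c)) :=
               (con (ι 49) :+ con 4ℚ :* j) :* s :+ (s :+ c) :+ ((con 4ℚ :+ con 2ℚ :* j) :* s :+ (con (ι 5) :* c :+ con (ι 6) :* d))) refl (ι j) (sq m) (sq c) (ι D * sq M₁)) ⟩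
      ι 6 * ((ι 9 + ι j) * sq m + (ι D * sq M₁ + sq c))
        ≡⟨ cong₂ (λ u v → ι 6 * (u * sq m + v)) 9+j K′-≡ ⟨
      ι 6 * (ι (9 ℕ.+ j) * sq m + ι K′) ∎)
      where
      open ≤-Reasoning
      m B : ℕ
      m = suc m′
      B = D ℕ.+ 4 ℕ.* D ℕ.* (4 ℕ.* D)
      r : ℚ
      r = ∣ remainder θ m′ ∣
      M₀≤m : M₀ ℕ.≤ m
      M₀≤m = ℕ.≤-trans (ℕ.n≤1+n M₀) (ℕ.<⇒≤ M₁<m)

  -- The trivial bound m² gives coefficient D, so D improvements lead from 9 + D down to 9.
  initial : Bound D
  initial = 0 , λ θ admissible m → ≤-trans (*-monoˡ (0≤ι D) (error≤ admissible m))
    (≤-trans (*-monoʳ (0≤sq m) (ι-mono (ℕ.m≤n+m D 9))) (≤-reflexive (sym (+-identityʳ (ι (9 ℕ.+ D) * sq m)))))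

  descend : ∀ j → Bound j → Bound 0
  descend zero    bound = bound
  descend (suc j) bound = descend j (improve j bound)

  error-bound : Bound 0
  error-bound = descend D initial

-- The limit

reciprocalℚ-inverse : ∀ q → 0ℚ < q → reciprocalℚ q * q ≡ 1ℚ
reciprocalℚ-inverse q 0<q with q ≟ 0ℚ
... | yes q≡0 = contradiction (sym q≡0) (<⇒≢ 0<q)
... | no q≢0  = *-inverseˡ q {{≢-nonZero q≢0}}

0≤reciprocalℚ : ∀ {q} → 0ℚ < q → 0ℚ ≤ reciprocalℚ q
0≤reciprocalℚ {q} 0<q = *-cancelʳ-≤-pos q {{positive 0<q}}
  (≤-trans (≤-reflexive (*-zeroˡ q)) (≤-trans 0≤1 (≤-reflexive (sym (reciprocalℚ-inverse q 0<q)))))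

reciprocalℚ≤ : ∀ {a q} → 0ℚ < q → a ≤ q → a * reciprocalℚ q ≤ 1ℚ
reciprocalℚ≤ {a} {q} 0<q a≤q = ≤-trans (*-monoʳ (0≤reciprocalℚ 0<q) a≤q)
  (≤-reflexive (trans (*-comm q (reciprocalℚ q)) (reciprocalℚ-inverse q 0<q)))

module _ (n : ℕ) (1≤n : 1 ℕ.≤ n) where
  private
    s q l : ℚ
    s = seq π n
    q = reciprocalℚ (s * s)
    l = leibnizSum n

    -- The witness `0<π` carries the margin 4 · 2/3, valid from index 1 on; its square 64/9 is 6 +
    -- 10/9.
    8/3≤s : ℤ.+ 8 / 3 ≤ s
    8/3≤s = proj₂ (proj₂ (proj₂ 0<π)) n 1≤n

    6≤s² : ι 6 ≤ s * s
    6≤s² = ≤-trans (≤-by {ι 6} {(ℤ.+ 8 / 3) * (ℤ.+ 8 / 3)} (ℤ.+ 10 / 9) (nonNegative⁻¹ (ℤ.+ 10 / 9)) refl)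
      (*-mono (nonNegative⁻¹ (ℤ.+ 8 / 3)) (≤-trans (nonNegative⁻¹ (ℤ.+ 8 / 3)) 8/3≤s) 8/3≤s 8/3≤s)

    0<s² : 0ℚ < s * s
    0<s² = <-≤-trans (positive⁻¹ (ι 6)) 6≤s²

    6q≤1 : ι 6 * q ≤ 1ℚ
    6q≤1 = reciprocalℚ≤ 0<s² 6≤s²

    0≤q : 0ℚ ≤ q
    0≤q = 0≤reciprocalℚ 0<s²

  3/π²-admissible : ∀ D M₀ →
    (∀ m → M₀ ℕ.≤ m → ι D * ∣ ι 8 * (leibnizSum n * leibnizSum n) - ι 3 * ζ m ∣ ≤ ι 2) →
    Contraction.Admissible D M₀ (seq 3/π² n)
  3/π²-admissible D M₀ close = record
    { 0≤θ = 0≤* (0≤ι 3) 0≤q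
    ; θ≤1 = ≤-trans (≤-by (ι 3 * q) (0≤* (0≤ι 3) 0≤q) (solve 1 (λ q → con (ι 6) :* q := con (ι 3) :* q :+ con (ι 3) :* q) refl q)) 6q≤1
    ; close = λ m M₀≤m → begin
        ι D * ∣ 1ℚ - ι 2 * (ι 3 * q) * ζ m ∣
          ≡⟨ cong (λ z → ι D * ∣ z ∣) (split m) ⟩
        ι D * ∣ ι 2 * q * (ι 8 * (l * l) - ι 3 * ζ m) ∣
          ≡⟨ cong (ι D *_) (∣c*p∣ (ι 8 * (l * l) - ι 3 * ζ m) (0≤* (0≤ι 2) 0≤q)) ⟩
        ι D * (ι 2 * q * ∣ ι 8 * (l * l) - ι 3 * ζ m ∣)
          ≡⟨ solve 3 (λ d q e → d :* (con (ι 2) :* q :* e) := con (ι 2) :* q :* (d :* e)) refl (ι D) q ∣ ι 8 * (l * l) - ι 3 * ζ m ∣ ⟩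
        ι 2 * q * (ι D * ∣ ι 8 * (l * l) - ι 3 * ζ m ∣)
          ≤⟨ *-monoˡ (0≤* (0≤ι 2) 0≤q) (close m M₀≤m) ⟩
        ι 2 * q * ι 2
          ≤⟨ ≤-by (ι 2 * q) (0≤* (0≤ι 2) 0≤q) (solve 1 (λ q → con (ι 6) :* q := con (ι 2) :* q :* con (ι 2) :+ con (ι 2) :* q) refl q) ⟩
        ι 6 * q
          ≤⟨ ≤-trans 6q≤1 (≤-by 1ℚ 0≤1 refl) ⟩
        ι 2 ∎
    }
    where
    open ≤-Reasoning
    split : ∀ m → 1ℚ - ι 2 * (ι 3 * q) * ζ m ≡ ι 2 * q * (ι 8 * (l * l) - ι 3 * ζ m)
    split m = trans (cong (_- ι 2 * (ι 3 * q) * ζ m) (sym (reciprocalℚ-inverse (s * s) 0<s²)))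
      (solve 3 (λ q l z → q :* (con (ι 4) :* l :* (con (ι 4) :* l)) :- con (ι 2) :* (con (ι 3) :* q) :* z :=
        con (ι 2) :* q :* (con (ι 8) :* (l :* l) :- con (ι 3) :* z)) refl q l (ζ m))

P₀-period : ∀ p → P₀ (suc p) * ι (period (suc p)) ≡ ι (length (zeroList p))
P₀-period p = begin
  P₀ (suc p) * ι (suc d) ≡⟨ cong (_* ι (suc d)) (/-ι zeros d) ⟩
  ι zeros * inv d * ι (suc d) ≡⟨ cong (λ z → ι z * inv d * ι (suc d)) (length-zeroList p) ⟨
  ι (length (zeroList p)) * inv d * ι (suc d) ≡⟨ trans (*-assoc (ι (length (zeroList p))) (inv d) (ι (suc d)))
                                                     (trans (cong (ι (length (zeroList p)) *_) (trans (*-comm (inv d) (ι (suc d))) (ι-inv d))) (*-identityʳ (ι (length (zeroList p))))) ⟩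
  ι (length (zeroList p)) ∎
  where
  open ≡-Reasoning
  zeros d : ℕ
  zeros = length (filter (λ n → N (ℤ.+ n) (suc p) ℕ.≟ 0) (upTo (period (suc p))))
  d = p ℕ.+ p ℕ.* suc p ℕ.+ suc p

ι-distance : ∀ {a b c} → a ℕ.≤ b ℕ.+ c → b ℕ.≤ a ℕ.+ c → ∣ ι a - ι b ∣ ≤ ι c
ι-distance {a} {b} {c} a≤ b≤ = ∣p∣≤ (half a≤)
  (subst (_≤ ι c) (solve 2 (λ a b → b :- a := :- (a :- b)) refl (ι a) (ι b)) (half b≤))
  where
  half : ∀ {a b} → a ℕ.≤ b ℕ.+ c → ι a - ι b ≤ ι c
  half {a} {b} a≤ = ≤-trans (+-monoˡ-≤ (- ι b) (≤-trans (ι-mono a≤) (≤-reflexive (ι-+ b c))))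
    (≤-reflexive (solve 2 (λ b c → b :+ c :- b := c) refl (ι b) (ι c)))

module _ (G : ℕ) where
  private
    D : ℕ
    D = 20 ℕ.* G

  -- After multiplication by 10(k² + k), with 20 = 10 · 2 supplied by D: the error costs 9k² + K,
  -- the k + 1 exceptions and θk cost at most 3Dk, and `3D + K ≤ k` bounds all but 9k² by k².
  P₀-close : ∀ p {θ K} → 3 ℕ.* D ℕ.+ K ℕ.≤ suc p → 0ℚ ≤ θ → θ ≤ 1ℚ →
             ι D * ∣ error θ (suc p) ∣ ≤ ι 9 * sq (suc p) + ι K → ι 2 * ι G * ∣ P₀ (suc p) - θ ∣ ≤ 1ℚ
  P₀-close p {θ} {K} large 0≤θ θ≤1 bound = *-cancelˡ-≤-pos (ι 10 * ι P) {{positive 0<10P}} (begin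
    ι 10 * ι P * (ι 2 * ι G * ∣ X ∣)
      ≡⟨ solve 3 (λ p g x → con (ι 10) :* p :* (con (ι 2) :* g :* x) := con (ι 20) :* g :* (p :* x)) refl (ι P) (ι G) ∣ X ∣ ⟩
    ι 20 * ι G * (ι P * ∣ X ∣)
      ≡⟨ cong₂ _*_ (ι-* 20 G) (∣c*p∣ X (0≤ι P)) ⟨
    ι D * ∣ ι P * X ∣
      ≡⟨ cong (λ z → ι D * ∣ z ∣) split ⟩
    ι D * ∣ (ι z - coprimesℚ k) + error θ k - θ * ι k ∣
      ≤⟨ *-monoˡ (0≤ι D) (≤-trans (∣p-q∣≤∣p∣+∣q∣ ((ι z - coprimesℚ k) + error θ k) (θ * ι k))
           (+-mono-≤ (≤-trans (∣p+q∣≤∣p∣+∣q∣ (ι z - coprimesℚ k) (error θ k))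
             (+-monoˡ-≤ ∣ error θ k ∣ (ι-distance {z} {coprimes k} {suc k} (zeros≤coprimes p) (coprimes≤zeros p)))) θk≤)) ⟩
    ι D * (ι (suc k) + ∣ error θ k ∣ + ι k)
      ≡⟨ solve 3 (λ d n e → d :* ((con 1ℚ :+ n) :+ e :+ n) := d :* (con 1ℚ :+ con (ι 2) :* n) :+ d :* e) refl (ι D) (ι k) ∣ error θ k ∣ ⟩
    ι D * (1ℚ + ι 2 * ι k) + ι D * ∣ error θ k ∣
      ≤⟨ +-mono-≤ (*-monoˡ (0≤ι D) (+-monoˡ-≤ (ι 2 * ι k) 1≤k)) bound ⟩
    ι D * (ι k + ι 2 * ι k) + (ι 9 * sq k + ι K)
      ≤⟨ +-monoʳ-≤ (ι D * (ι k + ι 2 * ι k)) (+-monoʳ-≤ (ι 9 * sq k) (≤-trans (≤-reflexive (sym (*-identityʳ (ι K)))) (*-monoˡ (0≤ι K) 1≤k))) ⟩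
    ι D * (ι k + ι 2 * ι k) + (ι 9 * sq k + ι K * ι k)
      ≡⟨ solve 4 (λ d n s c → d :* (n :+ con (ι 2) :* n) :+ (s :+ c :* n) := s :+ (con (ι 3) :* d :+ c) :* n) refl (ι D) (ι k) (ι 9 * sq k) (ι K) ⟩
    ι 9 * sq k + (ι 3 * ι D + ι K) * ι k
      ≤⟨ +-monoʳ-≤ (ι 9 * sq k) (*-monoʳ (0≤ι k) (≤-trans (≤-reflexive (sym (trans (ι-+ (3 ℕ.* D) K) (cong (_+ ι K) (ι-* 3 D))))) (ι-mono large))) ⟩
    ι 9 * sq k + sq k
      ≤⟨ ≤-by (ι 10 * ι k) (0≤* (0≤ι 10) (0≤ι k)) (trans (cong (λ z → ι 10 * z * 1ℚ) P-≡)
           (solve 2 (λ s n → con (ι 10) :* (s :+ n) :* con 1ℚ := con (ι 9) :* s :+ s :+ con (ι 10) :* n) refl (sq k) (ι k))) ⟩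
    ι 10 * ι P * 1ℚ ∎)
    where
    open ≤-Reasoning
    k z P : ℕ
    k = suc p
    z = length (zeroList p)
    P = period k
    X : ℚ
    X = P₀ k - θ
    P-≡ : ι P ≡ sq k + ι k
    P-≡ = trans (ι-+ (k ℕ.* k) k) (cong (_+ ι k) (ι-* k k))
    0<10P : 0ℚ < ι 10 * ι P
    0<10P = <-≤-trans (positive⁻¹ (ι 10)) (≤-trans (≤-reflexive (sym (*-identityʳ (ι 10))))
      (*-monoˡ (0≤ι 10) (≤-by (ι (p ℕ.+ p ℕ.* suc p ℕ.+ suc p)) (0≤ι (p ℕ.+ p ℕ.* suc p ℕ.+ suc p)) refl)))
    1≤k : 1ℚ ≤ ι k
    1≤k = ≤-by (ι p) (0≤ι p) refl
    θk≤ : ∣ θ * ι k ∣ ≤ ι k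
    θk≤ = ≤-trans (≤-reflexive (0≤p⇒∣p∣≡p (0≤* 0≤θ (0≤ι k)))) (≤-trans (*-monoʳ (0≤ι k) θ≤1) (≤-reflexive (*-identityˡ (ι k))))
    split : ι P * X ≡ (ι z - coprimesℚ k) + error θ k - θ * ι k
    split = begin-equality
      ι P * (P₀ k - θ)
        ≡⟨ solve 3 (λ p x t → p :* (x :- t) := x :* p :- t :* p) refl (ι P) (P₀ k) θ ⟩
      P₀ k * ι P - θ * ι P
        ≡⟨ cong₂ (λ u v → u - θ * v) (P₀-period p) P-≡ ⟩
      ι z - θ * (sq k + ι k)
        ≡⟨ solve 5 (λ z c t s n → z :- t :* (s :+ n) := (z :- c) :+ (c :- t :* s) :- t :* n) refl (ι z) (coprimesℚ k) θ (sq k) (ι k) ⟩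
      (ι z - coprimesℚ k) + error θ k - θ * ι k ∎

theorem8p1 : (λ k → fromℚ (P₀ k)) ⟶ 3/π²
-- The order on the reals asks for a positive margin: of `inv d ≤ ε`, one half bounds the distance
-- and the other is the margin.
theorem8p1 ε 0<ε = K₀ , λ { (suc p) K₀≤k → ½ * inv d , 0<δ , M , λ n M≤n → close p n K₀≤k M≤n }
  where
  d G D M₀ M K K₀ : ℕ
  d = proj₁ (inv≤ ε 0<ε)
  G = suc d
  D = 20 ℕ.* G
  M₀ = proj₁ (leibniz-ζ D)
  -- The successor guarantees `1 ≤ n`, where the terms of `π` are bounded away from 0.
  M = suc M₀
  K = proj₁ (Contraction.error-bound D M₀)
  K₀ = 3 ℕ.* D ℕ.+ K
  0<δ : 0ℚ < ½ * inv d
  0<δ = positive⁻¹ (½ * inv d) {{pos*pos⇒pos ½ (inv d) {{positive (0<inv d)}}}}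
  close : ∀ p n → K₀ ℕ.≤ suc p → M ℕ.≤ n → ∣ P₀ (suc p) - seq 3/π² n ∣ + ½ * inv d ≤ ε
  close p n K₀≤k M≤n = ≤-trans (*-cancelˡ-≤-pos (ι 2 * ι G) {{positive 0<2G}} (begin
    ι 2 * ι G * (x + ½ * inv d) ≡⟨ solve 3 (λ g x i → con (ι 2) :* g :* (x :+ con ½ :* i) := con (ι 2) :* g :* x :+ g :* i) refl (ι G) x (inv d) ⟩
    ι 2 * ι G * x + ι G * inv d ≤⟨ +-mono-≤ (P₀-close G p {θ} {K} K₀≤k 0≤θ θ≤1 (proj₂ (Contraction.error-bound D M₀) θ admissible (suc p))) (≤-reflexive (ι-inv d)) ⟩
    ι 2 * 1ℚ ≡⟨ cong (ι 2 *_) (ι-inv d) ⟨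
    ι 2 * (ι G * inv d) ≡⟨ *-assoc (ι 2) (ι G) (inv d) ⟨
    ι 2 * ι G * inv d ∎)) (proj₂ (inv≤ ε 0<ε))
    where
    open ≤-Reasoning
    θ x : ℚ
    θ = seq 3/π² n
    x = ∣ P₀ (suc p) - θ ∣
    admissible : Contraction.Admissible D M₀ θ
    admissible = 3/π²-admissible n (ℕ.≤-trans (ℕ.s≤s ℕ.z≤n) M≤n) D M₀
      (λ m M₀≤m → proj₂ (leibniz-ζ D) (ℕ.≤-trans (ℕ.n≤1+n M₀) M≤n) M₀≤m)
    open Contraction.Admissible admissible
    0<2G : 0ℚ < ι 2 * ι G
    0<2G = positive⁻¹ (ι 2 * ι G) {{pos*pos⇒pos (ι 2) (ι G) {{positive (0<ι d)}}}}
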